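{- Let $m\geq 1$ and let $P_1,\dots,P_m\in\mathbb{Z}[y]$ be polynomials with zero constant term that are linearly independent over $\mathbb{Q}$. There exist $c,\gamma>0$ such that if the characteristic of the finite field $\mathbb{F}_q$ is at least $c$, then \[ r_{P_1,\dots,P_m}(\mathbb{F}_q)\ll_{P_1,\dots,P_m}q^{1-\gamma} \] and \[ \#\{(x,y)\in\mathbb{F}_q^2:x,x+P_1(y),\dots,x+P_m(y)\in A\}=\frac{|A|^{m+1}}{q^{m-1}}+O_{P_1,\dots,P_m}(q^{2-(m+1)\gamma}) \] for every $A\subset\mathbb{F}_q$.
   Context: Polynomials in $\mathbb{Z}[y]$ are evaluated on $\mathbb{F}_q$ via reduction of their coefficients modulo the characteristic. For $P_1,\dots,P_m\in\mathbb{Z}[y]$, $r_{P_1,\dots,P_m}(\mathbb{F}_q)$ denotes the size of the largest subset of $\mathbb{F}_q$ that contains no progression of the form $x,x+P_1(y),\dots,x+P_m(y)$ with $x,y\in\mathbb{F}_q$ and $y\neq 0$. The implied constants in $\ll$ and $O(\cdot)$ depend only on $P_1,\dots,P_m$. -}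

module Defs where

open import Level using (0ℓ)
open import Data.Nat as ℕ using (ℕ; zero; suc)
open import Data.Integer as ℤ using (ℤ; +_; -[1+_])
open import Data.Rational as ℚ using (ℚ)
open import Data.Fin using (Fin)
open import Data.Bool using (Bool; true; false; _∧_)
open import Data.List using (List; []; _∷_; map; allFin)
open import Data.Nat.ListAction using (sum)
open import Data.Bool.ListAction using (all)
open import Data.Product using (Σ; _×_; _,_)
open import Relation.Binary.PropositionalEquality using (_≡_; _≢_)
open import Relation.Nullary using (¬_; Dec; does)
open import Function.Bundles using (Bijection)
import Relation.Binary.PropositionalEquality as PE
open import Algebra.Bundles using (CommutativeRing)

record FiniteField : Set₁ where
  field
    cring     : CommutativeRing 0ℓ 0ℓ
  open CommutativeRing cring public
  field
    ≈⇒≡       : ∀ {x y} → x ≈ y → x ≡ y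
    _≟F_      : (x y : Carrier) → Dec (x ≡ y)
    0≢1       : 0# ≢ 1#
    inverse   : ∀ x → x ≢ 0# → Σ Carrier (λ y → x * y ≡ 1#)
    size      : ℕ
    enum      : Bijection (PE.setoid (Fin size)) (PE.setoid Carrier)

module _ (F : FiniteField) where
  open FiniteField F

  natF : ℕ → Carrier
  natF zero    = 0#
  natF (suc n) = 1# + natF n

  intF : ℤ → Carrier
  intF (+ n)      = natF n
  intF -[1+ n ]   = - natF (suc n)

  CharAtLeast : ℕ → Set
  CharAtLeast c = ∀ n → 0 ℕ.< n → n ℕ.< c → natF n ≢ 0#

  evalF : List ℤ → Carrier → Carrier
  evalF []       y = 0#
  evalF (a ∷ as) y = intF a + y * evalF as y

  elem : Fin size → Carrier
  elem = Bijection.to enum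

  card : (Carrier → Bool) → ℕ
  card A = sum (map (λ i → if A (elem i) then 1 else 0) (allFin size))
    where open import Data.Bool using (if_then_else_)

  ProgIn : ∀ {m} → (Fin m → List ℤ) → (Carrier → Bool) → Carrier → Carrier → Bool
  ProgIn {m} P A x y =
    A x ∧ all (λ i → A (x + evalF (P i) y)) (allFin m)

  ProgFree : ∀ {m} → (Fin m → List ℤ) → (Carrier → Bool) → Set
  ProgFree P A = ∀ x y → y ≢ 0# → ProgIn P A x y ≡ false

  countProg : ∀ {m} → (Fin m → List ℤ) → (Carrier → Bool) → ℕ
  countProg P A =
    sum (map (λ i → sum (map (λ j → if ProgIn P A (elem i) (elem j) then 1 else 0)
                              (allFin size)))
             (allFin size))
    where open import Data.Bool using (if_then_else_)

coeff : List ℤ → ℕ → ℤ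
coeff []       j       = + 0
coeff (a ∷ as) zero    = a
coeff (a ∷ as) (suc j) = coeff as j

ZeroConstTerm : List ℤ → Set
ZeroConstTerm P = coeff P 0 ≡ + 0

sumℚ : ∀ {m} → (Fin m → ℚ) → ℚ
sumℚ {m} f = Data.List.foldr ℚ._+_ ℚ.0ℚ (map f (allFin m))

LinIndepℚ : ∀ {m} → (Fin m → List ℤ) → Set
LinIndepℚ {m} P =
  (λc : Fin m → ℚ) →
  (∀ j → sumℚ (λ i → λc i ℚ.* (coeff (P i) j ℚ./ 1)) ≡ ℚ.0ℚ) →
  ∀ i → λc i ≡ ℚ.0ℚ

{-# OPTIONS --safe #-}

-- The proof follows Peluse's degree lowering, but with no characters: every function is rational valued, and
-- averages of convolutions (Conv below) replace functions with absolutely summable Fourier coefficients.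
-- Let Λ(f₀,…,f_m) be the average over x, y of ∏ f_i(x + P_i(y)), with P₀ = 0. The claim is that Λ is close to the
-- product of the means of the f_i, up to a fixed power of 1/q, and the slots that may hold arbitrary functions are
-- added one at a time, the other slots holding averages of convolutions.
-- With one arbitrary slot, Cauchy–Schwarz over the variables of the convolutions reduces the claim to mean-square
-- equidistribution of y ↦ (P_i(y))_i in F^m. This is Weyl differencing, applied to one direction (the vector of
-- coefficients of a given y^d) after the other: differencing kills functions whose averages along that direction vanish.
-- Linear independence says that these directions span.
-- For the induction step let l be an arbitrary slot and suppose that another slot j has mean zero. Then Λ² ≤ E F² for the
-- dual function F of slot l, and E F² is Λ with F in slot l. PET induction bounds this by a U^s norm of F. The U^(k+2) norm
-- of F is controlled by its U^(k+1) norm: expanding F at the top vertex of each cube as an average over y and applying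
-- Cauchy–Schwarz in every direction yields configurations with a positive-definite function in slot l, to which the
-- induction hypothesis applies. What is left at the end is (E F)², again small by the induction hypothesis.
module Submission where

-- Rational arithmetic has neither characters nor fractional powers, and this shapes every
-- statement. A power saving reads `pow2 N x ≤ C * ε` with ε = 1/q and `pow2 N x` = x^(2^N); each
-- Cauchy-Schwarz costs one squaring, boundedness is c² ≤ 1, and γ is read off only at the end. `N`
-- and `C` must not depend on the field, so whatever produces them quantifies over `F` inside.
-- Without characters the U² norm is never diagonalised: its expansion keeps one autocorrelation as
-- a weight. What makes such weights manageable is that they are bounded, closed under products and
-- have nonnegative mean. The base point counts as slot 0, with the zero polynomial, so all m + 1
-- slots are alike and any of them may play the part of j or l. The characteristic has to be large
-- for two reasons: the integers that differencing produces in front of leading coefficients must be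
-- invertible, and so must the common denominator of an integral dual family, which turns
-- independence over ℚ into a spanning statement over the given field.

open import Defs
open import Level using (0ℓ)
open import Algebra.Bundles using (CommutativeRing)
import Algebra.Properties.CommutativeMonoid.Sum
import Algebra.Properties.Monoid.Mult.TCOptimised
import Algebra.Properties.Ring
import Algebra.Properties.Semiring.Mult
import Algebra.Properties.Semiring.Sum
import Algebra.Solver.Ring
import Algebra.Solver.Ring.AlmostCommutativeRing as ACR
open import Data.Bool using (Bool; true; false; _∧_; if_then_else_)
import Data.Bool.ListAction as BL
open import Data.Empty using (⊥; ⊥-elim)
open import Data.Fin using (Fin; zero; suc)
import Data.Fin.Permutation as Perm
import Data.Fin.Properties as FinP
open import Data.Integer as ℤ using (ℤ)
import Data.Integer.Properties as ℤP
import Data.Integer.Solver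
open import Data.List using (List; []; _∷_; length; map)
open import Data.List.Membership.Propositional using (_∈_; _∉_)
open import Data.List.Membership.Propositional.Properties using (∈-allFin)
import Data.List.Properties as ListP
open import Data.List.Relation.Unary.All as All using (All; []; _∷_)
open import Data.List.Relation.Unary.Any using (here; there)
open import Data.Maybe using (Maybe; just; nothing)
open import Data.Nat as ℕ using (ℕ; zero; suc; s≤s; z≤n)
import Data.Nat.ListAction as ℕL
import Data.Nat.Properties as ℕP
open import Data.Product using (Σ; _×_; _,_; proj₁; proj₂)
open import Data.Sum using (_⊎_; inj₁; inj₂)
open import Data.Unit using (⊤; tt)
open import Data.Vec as Vec using (Vec; []; _∷_)
import Data.Vec.Membership.Propositional as VM
import Data.Vec.Membership.Propositional.Properties as VMP
import Data.Vec.Properties as VecP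
import Data.Vec.Relation.Unary.Any as VA
open import Function using (_∘_)
open import Function.Bundles using (Bijection)
open import Relation.Nullary using (¬_; Dec; yes; no)
open import Relation.Binary.PropositionalEquality using (_≡_; _≢_; refl; sym; trans; cong; cong₂; subst; subst₂; module ≡-Reasoning)

-- The solver normalises with integer coefficients, since equality of the coefficients must compute while the ring stays abstract.
module IntSolver (R : CommutativeRing 0ℓ 0ℓ) where
  open import Data.Integer using (+_; -[1+_])
  open CommutativeRing R
    renaming (refl to ≈-refl; sym to ≈-sym; trans to ≈-trans)
  open Algebra.Properties.Ring ring using (-0#≈0#; -‿+-comm; -‿distribˡ-*; -‿distribʳ-*; -‿involutive)
  open Algebra.Properties.Semiring.Mult semiring using (×-homo-+; ×1-homo-*) renaming (_×_ to _×ᵘ_)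
  open Algebra.Properties.Monoid.Mult.TCOptimised +-monoid using (×ᵤ≈×) renaming (_×_ to _×′_)
  open import Relation.Binary.Reasoning.Setoid setoid

  ι : ℤ → Carrier
  ι (+ n)      = n ×ᵘ 1#
  ι -[1+ n ]   = - (suc n ×ᵘ 1#)

  private
    cancel : ∀ a b c → (c + a) - (c + b) ≈ a - b
    cancel a b c = begin
      (c + a) - (c + b)     ≈⟨ +-congˡ (-‿+-comm c b) ⟨
      (c + a) + (- c - b)   ≈⟨ +-congʳ (+-comm c a) ⟩
      (a + c) + (- c - b)   ≈⟨ +-assoc a c _ ⟩
      a + (c + (- c - b))   ≈⟨ +-congˡ (+-assoc c (- c) (- b)) ⟨
      a + ((c - c) - b)     ≈⟨ +-congˡ (+-congʳ (-‿inverseʳ c)) ⟩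
      a + (0# - b)          ≈⟨ +-congˡ (+-identityˡ _) ⟩
      a - b ∎

  ι-⊖ : ∀ m n → ι (m ℤ.⊖ n) ≈ m ×ᵘ 1# - n ×ᵘ 1#
  ι-⊖ m zero = ≈-trans (reflexive (cong ι (ℤP.⊖-≥ {m} ℕ.z≤n))) (≈-sym (≈-trans (+-congˡ -0#≈0#) (+-identityʳ _)))
  ι-⊖ zero (suc n) = ≈-sym (+-identityˡ _)
  ι-⊖ (suc m) (suc n) = begin
    ι (suc m ℤ.⊖ suc n)           ≈⟨ reflexive (cong ι (ℤP.[1+m]⊖[1+n]≡m⊖n m n)) ⟩
    ι (m ℤ.⊖ n)                   ≈⟨ ι-⊖ m n ⟩
    m ×ᵘ 1# - n ×ᵘ 1#               ≈⟨ cancel _ _ 1# ⟨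
    (1# + m ×ᵘ 1#) - (1# + n ×ᵘ 1#) ∎

  ι-+ : ∀ i j → ι (i ℤ.+ j) ≈ ι i + ι j
  ι-+ (+ m) (+ n) = ×-homo-+ 1# m n
  ι-+ (+ m) -[1+ n ] = ι-⊖ m (suc n)
  ι-+ -[1+ m ] (+ n) = ≈-trans (ι-⊖ n (suc m)) (+-comm _ _)
  ι-+ -[1+ m ] -[1+ n ] = begin
    - (suc (suc (m ℕ.+ n)) ×ᵘ 1#)      ≈⟨ -‿cong (reflexive (cong (λ k → suc k ×ᵘ 1#) (sym (ℕP.+-suc m n)))) ⟩
    - ((suc m ℕ.+ suc n) ×ᵘ 1#)        ≈⟨ -‿cong (×-homo-+ 1# (suc m) (suc n)) ⟩
    - (suc m ×ᵘ 1# + suc n ×ᵘ 1#)       ≈⟨ -‿+-comm _ _ ⟨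
    - (suc m ×ᵘ 1#) - (suc n ×ᵘ 1#) ∎
    where import Data.Nat.Properties as ℕP

  ι-neg : ∀ i → ι (ℤ.- i) ≈ - ι i
  ι-neg (+ zero) = ≈-sym -0#≈0#
  ι-neg (+ suc n) = ≈-refl
  ι-neg -[1+ n ] = ≈-sym (-‿involutive _)

  private
    ι-*⁺ : ∀ m j → ι (+ m ℤ.* j) ≈ ι (+ m) * ι j
    ι-*⁺ m (+ n) = ≈-trans (reflexive (cong ι (sym (ℤP.pos-* m n)))) (×1-homo-* m n)
    ι-*⁺ m -[1+ n ] = begin
      ι (+ m ℤ.* -[1+ n ])              ≈⟨ reflexive (cong ι (sym (ℤP.neg-distribʳ-* (+ m) (+ suc n)))) ⟩
      ι (ℤ.- (+ m ℤ.* + suc n))         ≈⟨ ι-neg (+ m ℤ.* + suc n) ⟩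
      - ι (+ m ℤ.* + suc n)             ≈⟨ -‿cong (ι-*⁺ m (+ suc n)) ⟩
      - (ι (+ m) * ι (+ suc n))         ≈⟨ -‿distribʳ-* _ _ ⟩
      ι (+ m) * ι -[1+ n ] ∎

  ι-* : ∀ i j → ι (i ℤ.* j) ≈ ι i * ι j
  ι-* (+ m) j = ι-*⁺ m j
  ι-* -[1+ m ] j = begin
    ι (-[1+ m ] ℤ.* j)            ≈⟨ reflexive (cong ι (sym (ℤP.neg-distribˡ-* (+ suc m) j))) ⟩
    ι (ℤ.- (+ suc m ℤ.* j))       ≈⟨ ι-neg (+ suc m ℤ.* j) ⟩
    - ι (+ suc m ℤ.* j)           ≈⟨ -‿cong (ι-*⁺ (suc m) j) ⟩
    - (ι (+ suc m) * ι j)         ≈⟨ -‿distribˡ-* _ _ ⟩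
    ι -[1+ m ] * ι j ∎

  -- `ι` follows the recursion of `natF`, whereas here the numeral 1 is `1#` itself and not
  -- `1# + 0#`: a constant 1 in a solved equation then agrees with the goal on the nose.
  ι′ : ℤ → Carrier
  ι′ (+ n)      = n ×′ 1#
  ι′ -[1+ n ]   = - (suc n ×′ 1#)

  ι≈ι′ : ∀ i → ι i ≈ ι′ i
  ι≈ι′ (+ n)      = ×ᵤ≈× n 1#
  ι≈ι′ -[1+ n ]   = -‿cong (×ᵤ≈× (suc n) 1#)

  private
    morph : ℤ.+-*-rawRing ACR.-Raw-AlmostCommutative⟶ ACR.fromCommutativeRing R
    morph = record
      { ⟦_⟧ = ι′
      ; +-homo = λ i j → ≈-trans (≈-sym (ι≈ι′ (i ℤ.+ j))) (≈-trans (ι-+ i j) (+-cong (ι≈ι′ i) (ι≈ι′ j)))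
      ; *-homo = λ i j → ≈-trans (≈-sym (ι≈ι′ (i ℤ.* j))) (≈-trans (ι-* i j) (*-cong (ι≈ι′ i) (ι≈ι′ j)))
      ; -‿homo = λ i → ≈-trans (≈-sym (ι≈ι′ (ℤ.- i))) (≈-trans (ι-neg i) (-‿cong (ι≈ι′ i)))
      ; 0-homo = ≈-refl ; 1-homo = ≈-refl }
    dec : ∀ i j → Maybe (ι′ i ≈ ι′ j)
    dec i j with i ℤ.≟ j
    ... | yes p = just (reflexive (cong ι′ p))
    ... | no _ = nothing

  open Algebra.Solver.Ring ℤ.+-*-rawRing (ACR.fromCommutativeRing R) morph dec public
    using (solve; prove; con; var; _:+_; _:*_; _:-_; :-_; _:=_)

-- Integer linear algebra

module Integers where
  open import Data.Integer using (_+_; _*_; -_; _-_; +_; -[1+_]; ∣_∣)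
  open import Data.Integer.Properties
  import Data.Integer.Solver
  open Data.Integer.Solver.+-*-Solver using () renaming (solve to zsolve; con to zcon; _:+_ to _:+ᶻ_; _:*_ to _:*ᶻ_; _:-_ to _:-ᶻ_; :-_ to :-ᶻ_; _:=_ to _:=ᶻ_)
  import Algebra.Properties.CommutativeMonoid.Sum as CS
  import Algebra.Properties.Semiring.Sum as SSum
  module Σᶻ = SSum (CommutativeRing.semiring +-*-commutativeRing)
  module Σᶜ = CS +-0-commutativeMonoid
  sumᶻ : ∀ {m} → (Fin m → ℤ) → ℤ
  sumᶻ = Σᶜ.sum

  dot : ℕ → (ℕ → ℤ) → (ℕ → ℤ) → ℤ
  dot zero a b = + 0
  dot (suc T) a b = dot T a b + a T * b T

  dot-linear : ∀ T a p q b b′ → dot T a (λ d → p * b d - q * b′ d) ≡ p * dot T a b - q * dot T a b′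
  dot-linear zero a p q b b′ = zsolve 2 (λ p q → zcon (+ 0) :=ᶻ p :*ᶻ zcon (+ 0) :-ᶻ q :*ᶻ zcon (+ 0)) refl p q
  dot-linear (suc T) a p q b b′ = trans (cong (_+ a T * (p * b T - q * b′ T)) (dot-linear T a p q b b′))
    (zsolve 7 (λ p q x x′ a y y′ → (p :*ᶻ x :-ᶻ q :*ᶻ x′) :+ᶻ a :*ᶻ (p :*ᶻ y :-ᶻ q :*ᶻ y′) :=ᶻ p :*ᶻ (x :+ᶻ a :*ᶻ y) :-ᶻ q :*ᶻ (x′ :+ᶻ a :*ᶻ y′)) refl
      p q (dot T a b) (dot T a b′) (a T) (b T) (b′ T))

  dot-sum : ∀ {m} T a (s : Fin m → ℤ) (b : Fin m → ℕ → ℤ) → dot T a (λ d → sumᶻ (λ i → s i * b i d)) ≡ sumᶻ (λ i → s i * dot T a (b i))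
  dot-sum {m} zero a s b = sym (trans (Σᶜ.sum-cong-≗ (λ i → *-zeroʳ (s i))) (Σᶜ.sum-replicate-zero m))
  dot-sum (suc T) a s b = trans (cong₂ _+_ (dot-sum T a s b) (Σᶻ.*-distribˡ-sum (a T) (λ i → s i * b i T)))
    (trans (sym (Σᶜ.∑-distrib-+ (λ i → s i * dot T a (b i)) (λ i → a T * (s i * b i T))))
      (Σᶜ.sum-cong-≗ (λ i → zsolve 4 (λ s x a y → s :*ᶻ x :+ᶻ a :*ᶻ (s :*ᶻ y) :=ᶻ s :*ᶻ (x :+ᶻ a :*ᶻ y)) refl (s i) (dot T a (b i)) (a T) (b i T))))

  unit : ℕ → ℕ → ℤ
  unit d e with d ℕP.≟ e
  ... | yes _ = + 1
  ... | no _ = + 0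

  unit-same : ∀ d → unit d d ≡ + 1
  unit-same d with d ℕP.≟ d
  ... | yes _ = refl
  ... | no n = ⊥-elim (n refl)

  unit-other : ∀ d e → d ≢ e → unit d e ≡ + 0
  unit-other d e n with d ℕP.≟ e
  ... | yes q = ⊥-elim (n q)
  ... | no _ = refl

  dot-unit-out : ∀ T a d → T ℕ.≤ d → dot T a (unit d) ≡ + 0
  dot-unit-out zero a d _ = refl
  dot-unit-out (suc T) a d l = trans (cong₂ (λ u v → u + a T * v) (dot-unit-out T a d (ℕP.<⇒≤ l)) (unit-other d T (λ e → ℕP.<⇒≢ l (sym e))))
    (cong (λ z → + 0 + z) (*-zeroʳ (a T)))

  dot-unit : ∀ T a d → d ℕ.< T → dot T a (unit d) ≡ a d
  dot-unit (suc T) a d l = go (d ℕP.≟ T)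
    where
    go : Dec (d ≡ T) → dot (suc T) a (unit d) ≡ a d
    go (yes refl) = trans (cong₂ (λ u v → u + a T * v) (dot-unit-out T a T ℕP.≤-refl) (unit-same T)) (trans (+-identityˡ _) (*-identityʳ (a T)))
    go (no n) = trans (cong₂ (λ u v → u + a T * v) (dot-unit T a d (ℕP.≤∧≢⇒< (ℕP.≤-pred l) n)) (unit-other d T n))
      (trans (cong (λ z → a d + z) (*-zeroʳ (a T))) (+-identityʳ _))

  search : ∀ T (a : ℕ → ℤ) → (∀ d → d ℕ.< T → a d ≡ + 0) ⊎ (Σ ℕ λ d → d ℕ.< T × a d ≢ + 0)
  search zero a = inj₁ λ d ()
  search (suc T) a with search T a | a T ≟ + 0
  ... | inj₂ (d , l , n) | _ = inj₂ (d , ℕP.m<n⇒m<1+n l , n)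
  ... | inj₁ z | no n = inj₂ (T , ℕP.≤-refl , n)
  ... | inj₁ z | yes e = inj₁ λ d l → at d l
    where
    at : ∀ d → d ℕ.< suc T → a d ≡ + 0
    at d l with d ℕP.≟ T
    ... | yes refl = e
    ... | no n = z d (ℕP.≤∧≢⇒< (ℕP.≤-pred l) n)

  δᶻ : ∀ {m} → Fin m → Fin m → ℤ
  δᶻ zero zero = + 1
  δᶻ zero (suc j) = + 0
  δᶻ (suc i) zero = + 0
  δᶻ (suc i) (suc j) = δᶻ i j

  sum-δ : ∀ {m} (s : Fin m → ℤ) N i → sumᶻ (λ j → s j * (N * δᶻ i j)) ≡ s i * N
  sum-δ {suc m} s N zero = trans (cong₂ _+_ (cong (s zero *_) (*-identityʳ N))
    (trans (Σᶜ.sum-cong-≗ (λ j → trans (cong (s (suc j) *_) (*-zeroʳ N)) (*-zeroʳ (s (suc j))))) (Σᶜ.sum-replicate-zero m))) (+-identityʳ _)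
  sum-δ {suc m} s N (suc i) = trans (cong₂ _+_ (trans (cong (s zero *_) (*-zeroʳ N)) (*-zeroʳ (s zero))) (sum-δ (s ∘ suc) N i)) (+-identityˡ _)

  -- Unlike linear independence over ℚ, these identities survive reduction: wherever `N` stays
  -- invertible they still exhibit a dual family.
  record Dual {m} (T : ℕ) (a : Fin m → ℕ → ℤ) : Set where
    field
      N : ℤ
      N≢0 : N ≢ + 0
      b : Fin m → ℕ → ℤ
      duality : ∀ i j → dot T (a i) (b j) ≡ N * δᶻ i j

  Dependence : ∀ {m} → ℕ → (Fin m → ℕ → ℤ) → Set
  Dependence {m} T a = Σ (Fin m → ℤ) λ s → Σ (Fin m) λ i → s i ≢ + 0 × (∀ d → d ℕ.< T → sumᶻ (λ i → s i * a i d) ≡ + 0)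

  -- Fraction-free elimination. A dual family of the tail projects `a zero` off the span of the
  -- tail: a vanishing projection is a dependence, with the nonzero coefficient `N` at `zero`, and a
  -- nonvanishing one supplies the missing dual vector.
  dual-or-dependent : ∀ {m} T (a : Fin m → ℕ → ℤ) → Dual T a ⊎ Dependence T a
  dual-or-dependent {zero} T a = inj₁ record { N = + 1 ; N≢0 = λ () ; b = λ () ; duality = λ () }
  dual-or-dependent {suc m} T a with dual-or-dependent T (a ∘ suc)
  ... | inj₂ (s , i , n , e) = inj₂ (s′ , suc i , n , λ d l → trans (+-identityˡ _) (e d l))
    where
    s′ : Fin (suc m) → ℤ
    s′ zero = + 0
    s′ (suc i) = s i
  ... | inj₁ du = decide (search T residual)
    where
    open Dual du
    t : Fin m → ℤ
    t j = dot T (a zero) (b j)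
    -- By construction the residual N a₀ - Σ (a₀ · b i) a i is orthogonal to every b j.
    residual : ℕ → ℤ
    residual d = N * a zero d - sumᶻ (λ i → a (suc i) d * t i)
    decide : (∀ d → d ℕ.< T → residual d ≡ + 0) ⊎ (Σ ℕ λ d → d ℕ.< T × residual d ≢ + 0) → Dual T a ⊎ Dependence T a
    decide (inj₁ z) = inj₂ (s , zero , N≢0 , λ d l → trans (cong (λ z → N * a zero d + z) (trans
        (Σᶜ.sum-cong-≗ (λ i → zsolve 2 (λ t x → (:-ᶻ t) :*ᶻ x :=ᶻ zcon -[1+ 0 ] :*ᶻ (x :*ᶻ t)) refl (t i) (a (suc i) d)))
        (trans (sym (Σᶻ.*-distribˡ-sum -[1+ 0 ] (λ i → a (suc i) d * t i))) (zsolve 1 (λ x → zcon -[1+ 0 ] :*ᶻ x :=ᶻ :-ᶻ x) refl (sumᶻ (λ i → a (suc i) d * t i))))))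
      (z d l))
      where
      s : Fin (suc m) → ℤ
      s zero = N
      s (suc i) = - t i
    decide (inj₂ (d , d<T , r≢0)) = inj₁ record
      { N = r * N
      ; N≢0 = λ e → either (i*j≡0⇒i≡0∨j≡0 r e)
      ; b = b′ ; duality = dual }
      where
      r = residual d
      either : r ≡ + 0 ⊎ N ≡ + 0 → ⊥
      either (inj₁ e) = r≢0 e
      either (inj₂ e) = N≢0 e
      -- The unit vector at `d`, multiplied by `N` and corrected to be orthogonal to the tail; its
      -- product with `a zero` is then the residual at `d`.
      v : ℕ → ℤ
      v k = N * unit d k - + 1 * sumᶻ (λ i → a (suc i) d * b i k)
      dot-v : ∀ x → dot T x v ≡ N * x d - sumᶻ (λ i → a (suc i) d * dot T x (b i))
      dot-v x = trans (dot-linear T x N (+ 1) (unit d) _) (cong₂ _-_ (cong (N *_) (dot-unit T x d d<T))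
        (trans (*-identityˡ _) (dot-sum T x (λ i → a (suc i) d) b)))
      v-0 : dot T (a zero) v ≡ r
      v-0 = dot-v (a zero)
      v-suc : ∀ i → dot T (a (suc i)) v ≡ + 0
      v-suc i = trans (dot-v (a (suc i))) (trans (cong (λ z → N * a (suc i) d - z)
          (trans (Σᶜ.sum-cong-≗ (λ j → cong (a (suc j) d *_) (duality i j))) (sum-δ (λ j → a (suc j) d) N i)))
        (zsolve 2 (λ n x → n :*ᶻ x :-ᶻ x :*ᶻ n :=ᶻ zcon (+ 0)) refl N (a (suc i) d)))
      b′ : Fin (suc m) → ℕ → ℤ
      -- The vacuous second term gives this the shape to which `dot-linear` applies.
      b′ zero k = N * v k - + 0 * v k
      b′ (suc j) k = r * b j k - t j * v k
      dual : ∀ i j → dot T (a i) (b′ j) ≡ (r * N) * δᶻ i j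
      dual zero zero = trans (dot-linear T (a zero) N (+ 0) v v) (trans (cong (λ x → N * x - + 0 * x) v-0)
        (zsolve 2 (λ n r → n :*ᶻ r :-ᶻ zcon (+ 0) :*ᶻ r :=ᶻ (r :*ᶻ n) :*ᶻ zcon (+ 1)) refl N r))
      dual (suc i) zero = trans (dot-linear T (a (suc i)) N (+ 0) v v) (trans (cong (λ x → N * x - + 0 * x) (v-suc i))
        (zsolve 2 (λ n r → n :*ᶻ zcon (+ 0) :-ᶻ zcon (+ 0) :*ᶻ zcon (+ 0) :=ᶻ (r :*ᶻ n) :*ᶻ zcon (+ 0)) refl N r))
      dual zero (suc j) = trans (dot-linear T (a zero) r (t j) (b j) v) (trans (cong (λ x → r * t j - t j * x) v-0)
        (zsolve 3 (λ n r t → r :*ᶻ t :-ᶻ t :*ᶻ r :=ᶻ (r :*ᶻ n) :*ᶻ zcon (+ 0)) refl N r (t j)))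
      dual (suc i) (suc j) = trans (dot-linear T (a (suc i)) r (t j) (b j) v) (trans (cong₂ (λ x y → r * x - t j * y) (duality i j) (v-suc i))
        (zsolve 4 (λ n r t δ → r :*ᶻ (n :*ᶻ δ) :-ᶻ t :*ᶻ zcon (+ 0) :=ᶻ (r :*ᶻ n) :*ᶻ δ) refl N r (t j) (δᶻ i j)))

  coeff-beyond : ∀ (P : List ℤ) j → length P ℕ.≤ j → coeff P j ≡ + 0
  coeff-beyond [] j _ = refl
  coeff-beyond (a ∷ P) (suc j) (s≤s l) = coeff-beyond P j l

open import Data.Rational
open import Data.Rational.Properties
import Data.Rational.Solver
open Data.Rational.Solver.+-*-Solver using (solve; con; _:+_; _:*_; _:-_; :-_; _:=_)
import Data.Rational.Unnormalised as ℚᵘ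
import Data.Rational.Unnormalised.Properties as ℚᵘP
open Algebra.Properties.CommutativeMonoid.Sum +-0-commutativeMonoid using (sum; sum-cong-≗; ∑-distrib-+; sum-permute)
module SS = Algebra.Properties.Semiring.Sum (CommutativeRing.semiring +-*-commutativeRing)

-- Powers and abstract means of rational-valued functions

2ℚ : ℚ
2ℚ = 1ℚ + 1ℚ

0≤1 : 0ℚ ≤ 1ℚ
0≤1 = nonNegative⁻¹ 1ℚ

≤-by : ∀ {a b d} → 0ℚ ≤ d → b ≡ a + d → a ≤ b
≤-by {a} {b} {d} 0≤d e = subst₂ _≤_ (+-identityʳ a) (sym e) (+-monoʳ-≤ a 0≤d)

≤⇒0≤- : ∀ {a b} → a ≤ b → 0ℚ ≤ b - a
≤⇒0≤- {a} {b} a≤b = subst (_≤ b - a) (+-inverseʳ a) (+-monoˡ-≤ (- a) a≤b)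

+-nn : ∀ {a b} → 0ℚ ≤ a → 0ℚ ≤ b → 0ℚ ≤ a + b
+-nn = +-mono-≤

*-monoL : ∀ {c a b} → 0ℚ ≤ c → a ≤ b → c * a ≤ c * b
*-monoL {c} 0≤c = *-monoˡ-≤-nonNeg c {{nonNegative 0≤c}}

*-monoR : ∀ {c a b} → 0ℚ ≤ c → a ≤ b → a * c ≤ b * c
*-monoR {c} 0≤c = *-monoʳ-≤-nonNeg c {{nonNegative 0≤c}}

*-nn : ∀ {a b} → 0ℚ ≤ a → 0ℚ ≤ b → 0ℚ ≤ a * b
*-nn {a} {b} 0≤a 0≤b = subst (_≤ a * b) (*-zeroʳ a) (*-monoL 0≤a 0≤b)

*-mono : ∀ {a b c d} → 0ℚ ≤ a → 0ℚ ≤ d → a ≤ b → c ≤ d → a * c ≤ b * d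
*-mono 0≤a 0≤d a≤b c≤d = ≤-trans (*-monoL 0≤a c≤d) (*-monoR 0≤d a≤b)

sq≥0 : ∀ x → 0ℚ ≤ x * x
sq≥0 x with ≤-total 0ℚ x
... | inj₁ p = *-nn p p
... | inj₂ p = subst (0ℚ ≤_) (solve 1 (λ x → (:- x) :* (:- x) := x :* x) refl x) (*-nn q q)
  where q = neg-antimono-≤ p

-- Absolute value at most 1, in the form that Cauchy-Schwarz consumes.
Bd : ℚ → Set
Bd c = c * c ≤ 1ℚ

Bd-1 : Bd 1ℚ
Bd-1 = ≤-refl

Bd-* : ∀ {a b} → Bd a → Bd b → Bd (a * b)
Bd-* {a} {b} p q = subst (_≤ 1ℚ) (solve 2 (λ a b → (a :* a) :* (b :* b) := (a :* b) :* (a :* b)) refl a b)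
  (*-mono (sq≥0 a) 0≤1 p q)

Bd⇒≤1 : ∀ {a} → Bd a → a ≤ 1ℚ
Bd⇒≤1 {a} p = ≤-by {d = ½ * ((1ℚ - a * a) + (1ℚ - a) * (1ℚ - a))}
  (*-nn (nonNegative⁻¹ ½) (+-nn (≤⇒0≤- p) (sq≥0 (1ℚ - a))))
  (solve 1 (λ a → con 1ℚ := a :+ con ½ :* ((con 1ℚ :- a :* a) :+ (con 1ℚ :- a) :* (con 1ℚ :- a))) refl a)

0≤≤1⇒Bd : ∀ {a} → 0ℚ ≤ a → a ≤ 1ℚ → Bd a
0≤≤1⇒Bd 0≤a a≤1 = *-mono 0≤a 0≤1 a≤1 a≤1

-- x^(2^N), with the squaring innermost: an inequality for x² can be fed into `pow2 N` to bound
-- `pow2 (suc N) x`.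
pow2 : ℕ → ℚ → ℚ
pow2 zero x = x
pow2 (suc N) x = pow2 N (x * x)

pow2-nn : ∀ N {x} → 0ℚ ≤ x → 0ℚ ≤ pow2 N x
pow2-nn zero p = p
pow2-nn (suc N) {x} _ = pow2-nn N (sq≥0 x)

pow2-mono : ∀ N {x y} → 0ℚ ≤ x → x ≤ y → pow2 N x ≤ pow2 N y
pow2-mono zero _ p = p
pow2-mono (suc N) {x} 0≤x p = pow2-mono N (sq≥0 x) (*-mono 0≤x (≤-trans 0≤x p) p p)

pow2-* : ∀ N x y → pow2 N (x * y) ≡ pow2 N x * pow2 N y
pow2-* zero x y = refl
pow2-* (suc N) x y = trans
  (cong (pow2 N) (solve 2 (λ x y → (x :* y) :* (x :* y) := (x :* x) :* (y :* y)) refl x y))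
  (pow2-* N (x * x) (y * y))

pow2-pow2 : ∀ N M x → pow2 N (pow2 M x) ≡ pow2 (M ℕ.+ N) x
pow2-pow2 N zero x = refl
pow2-pow2 N (suc M) x = pow2-pow2 N M (x * x)

pow2-1 : ∀ N → pow2 N 1ℚ ≡ 1ℚ
pow2-1 zero = refl
pow2-1 (suc N) = trans (cong (pow2 N) (*-identityʳ 1ℚ)) (pow2-1 N)

pow2≤1 : ∀ N {x} → Bd x → pow2 N x ≤ 1ℚ
pow2≤1 zero p = Bd⇒≤1 p
pow2≤1 (suc N) {x} p = subst (pow2 N (x * x) ≤_) (pow2-1 N) (pow2-mono N (sq≥0 x) p)

pow2-Bd : ∀ N {x} → Bd x → Bd (pow2 N x)
pow2-Bd zero p = p
pow2-Bd (suc N) {x} p = pow2-Bd N (Bd-* {x} {x} p p)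

pow2≤id : ∀ N {x} → 0ℚ ≤ x → x ≤ 1ℚ → pow2 N x ≤ x
pow2≤id zero _ _ = ≤-refl
pow2≤id (suc N) {x} p q = ≤-trans (pow2≤id N (sq≥0 x) (0≤≤1⇒Bd p q))
  (subst (x * x ≤_) (*-identityʳ x) (*-monoL p q))

K : ℕ → ℚ
K zero = 1ℚ
K (suc N) = K N * pow2 N 2ℚ

0≤2 : 0ℚ ≤ 2ℚ
0≤2 = nonNegative⁻¹ 2ℚ

K≥0 : ∀ N → 0ℚ ≤ K N
K≥0 zero = 0≤1
K≥0 (suc N) = *-nn (K≥0 N) (pow2-nn N 0≤2)

sq-+ : ∀ x y → (x + y) * (x + y) ≤ 2ℚ * (x * x) + 2ℚ * (y * y)
sq-+ x y = ≤-by (sq≥0 (x - y))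
  (solve 2 (λ x y → con 2ℚ :* (x :* x) :+ con 2ℚ :* (y :* y) := (x :+ y) :* (x :+ y) :+ (x :- y) :* (x :- y)) refl x y)

-- After one squaring the arguments are nonnegative, so no sign conditions remain; hence the mutual
-- recursion with `pow2-+`.
pow2-suc-+ : ∀ N x y → pow2 (suc N) (x + y) ≤ K (suc N) * (pow2 (suc N) x + pow2 (suc N) y)

pow2-+ : ∀ N {x y} → 0ℚ ≤ x → 0ℚ ≤ y → pow2 N (x + y) ≤ K N * (pow2 N x + pow2 N y)
pow2-+ zero {x} {y} _ _ = ≤-reflexive (sym (*-identityˡ (x + y)))
pow2-+ (suc N) {x} {y} _ _ = pow2-suc-+ N x y

pow2-suc-+ N x y = begin
  pow2 N ((x + y) * (x + y))                                ≤⟨ pow2-mono N (sq≥0 (x + y)) (sq-+ x y) ⟩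
  pow2 N (2ℚ * (x * x) + 2ℚ * (y * y))                      ≤⟨ pow2-+ N (*-nn 0≤2 (sq≥0 x)) (*-nn 0≤2 (sq≥0 y)) ⟩
  K N * (pow2 N (2ℚ * (x * x)) + pow2 N (2ℚ * (y * y)))
    ≡⟨ cong₂ (λ a b → K N * (a + b)) (pow2-* N 2ℚ (x * x)) (pow2-* N 2ℚ (y * y)) ⟩
  K N * (pow2 N 2ℚ * pow2 N (x * x) + pow2 N 2ℚ * pow2 N (y * y))
    ≡⟨ solve 4 (λ k t a b → k :* (t :* a :+ t :* b) := (k :* t) :* (a :+ b)) refl (K N) (pow2 N 2ℚ) (pow2 N (x * x)) (pow2 N (y * y)) ⟩
  K (suc N) * (pow2 N (x * x) + pow2 N (y * y)) ∎
  where open ≤-Reasoning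

domC : ℕ → ℚ → ℚ → ℚ
domC N C C′ = (pow2 N C * K N) * (C′ + 1ℚ)

domC≥0 : ∀ N {C C′} → 0ℚ ≤ C → 0ℚ ≤ C′ → 0ℚ ≤ domC N C C′
domC≥0 N p q = *-nn (*-nn (pow2-nn N p) (K≥0 N)) (+-nn q 0≤1)

-- Bounds up to ε compose, with exponents adding: the inner error ε lies in [0, 1], so its powers
-- are again at most ε.
dom-trans : ∀ {ε} → 0ℚ ≤ ε → ε ≤ 1ℚ → ∀ N N′ {C C′ x y z} → 0ℚ ≤ C → 0ℚ ≤ C′ →
  0ℚ ≤ x → 0ℚ ≤ y → 0ℚ ≤ z →
  pow2 N x ≤ C * (y + ε) → pow2 N′ y ≤ C′ * (z + ε) → pow2 (N ℕ.+ N′) x ≤ domC N′ C C′ * (z + ε)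
dom-trans {ε} 0≤ε ε≤1 N N′ {C} {C′} {x} {y} {z} 0≤C 0≤C′ 0≤x 0≤y 0≤z p q = begin
  pow2 (N ℕ.+ N′) x                            ≡⟨ sym (pow2-pow2 N′ N x) ⟩
  pow2 N′ (pow2 N x)                           ≤⟨ pow2-mono N′ (pow2-nn N 0≤x) p ⟩
  pow2 N′ (C * (y + ε))                        ≡⟨ pow2-* N′ C (y + ε) ⟩
  pow2 N′ C * pow2 N′ (y + ε)                  ≤⟨ *-monoL (pow2-nn N′ 0≤C) (pow2-+ N′ 0≤y 0≤ε) ⟩
  pow2 N′ C * (K N′ * (pow2 N′ y + pow2 N′ ε))
    ≤⟨ *-monoL (pow2-nn N′ 0≤C) (*-monoL (K≥0 N′) (+-mono-≤ q (pow2≤id N′ 0≤ε ε≤1))) ⟩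
  pow2 N′ C * (K N′ * (C′ * (z + ε) + ε))
    ≤⟨ *-monoL (pow2-nn N′ 0≤C) (*-monoL (K≥0 N′) (≤-by 0≤z
         (solve 3 (λ c z e → (c :+ con 1ℚ) :* (z :+ e) := (c :* (z :+ e) :+ e) :+ z) refl C′ z ε))) ⟩
  pow2 N′ C * (K N′ * ((C′ + 1ℚ) * (z + ε)))
    ≡⟨ solve 4 (λ a b c d → a :* (b :* (c :* d)) := ((a :* b) :* c) :* d) refl (pow2 N′ C) (K N′) (C′ + 1ℚ) (z + ε) ⟩
  domC N′ C C′ * (z + ε) ∎
  where open ≤-Reasoning
small-raise : ∀ {ε} → 0ℚ ≤ ε → ε ≤ 1ℚ → ∀ N k {C x} → 0ℚ ≤ C → 0ℚ ≤ x → pow2 N x ≤ C * ε → pow2 (N ℕ.+ k) x ≤ pow2 k C * ε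
small-raise {ε} 0≤ε ε≤1 N k {C} {x} 0≤C 0≤x p = begin
  pow2 (N ℕ.+ k) x        ≡⟨ sym (pow2-pow2 k N x) ⟩
  pow2 k (pow2 N x)       ≤⟨ pow2-mono k (pow2-nn N 0≤x) p ⟩
  pow2 k (C * ε)          ≡⟨ pow2-* k C ε ⟩
  pow2 k C * pow2 k ε     ≤⟨ *-monoL (pow2-nn k 0≤C) (pow2≤id k 0≤ε ε≤1) ⟩
  pow2 k C * ε ∎
  where open ≤-Reasoning

small-scale : ∀ {ε} N {C x} c → 0ℚ ≤ c → pow2 N x ≤ C * ε → pow2 N (c * x) ≤ (pow2 N c * C) * ε
small-scale {ε} N {C} {x} c 0≤c p = begin
  pow2 N (c * x)          ≡⟨ pow2-* N c x ⟩
  pow2 N c * pow2 N x     ≤⟨ *-monoL (pow2-nn N 0≤c) p ⟩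
  pow2 N c * (C * ε)      ≡⟨ sym (*-assoc (pow2 N c) C ε) ⟩
  (pow2 N c * C) * ε ∎
  where open ≤-Reasoning

sumC : ℕ → ℕ → ℚ → ℚ → ℚ
sumC N N′ C C′ = K (N ℕ.+ N′) * (pow2 N′ C + pow2 N C′)

sumC≥0 : ∀ N N′ {C C′} → 0ℚ ≤ C → 0ℚ ≤ C′ → 0ℚ ≤ sumC N N′ C C′
sumC≥0 N N′ p q = *-nn (K≥0 (N ℕ.+ N′)) (+-nn (pow2-nn N′ p) (pow2-nn N q))

-- Each summand is first raised to the common exponent N + N′, which costs only constants because
-- powers of ε stay below ε.
small-+ : ∀ {ε} → 0ℚ ≤ ε → ε ≤ 1ℚ → ∀ N N′ {C C′ x y} → 0ℚ ≤ C → 0ℚ ≤ C′ → 0ℚ ≤ x → 0ℚ ≤ y →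
  pow2 N x ≤ C * ε → pow2 N′ y ≤ C′ * ε → pow2 (N ℕ.+ N′) (x + y) ≤ sumC N N′ C C′ * ε
small-+ {ε} 0≤ε ε≤1 N N′ {C} {C′} {x} {y} 0≤C 0≤C′ 0≤x 0≤y p q = begin
  pow2 (N ℕ.+ N′) (x + y)                                   ≤⟨ pow2-+ (N ℕ.+ N′) 0≤x 0≤y ⟩
  K (N ℕ.+ N′) * (pow2 (N ℕ.+ N′) x + pow2 (N ℕ.+ N′) y)
    ≤⟨ *-monoL (K≥0 (N ℕ.+ N′)) (+-mono-≤ (small-raise 0≤ε ε≤1 N N′ 0≤C 0≤x p)
         (subst (λ n → pow2 n y ≤ pow2 N C′ * ε) (ℕP.+-comm N′ N) (small-raise 0≤ε ε≤1 N′ N 0≤C′ 0≤y q))) ⟩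
  K (N ℕ.+ N′) * (pow2 N′ C * ε + pow2 N C′ * ε)
    ≡⟨ solve 4 (λ k a b e → k :* (a :* e :+ b :* e) := (k :* (a :+ b)) :* e) refl (K (N ℕ.+ N′)) (pow2 N′ C) (pow2 N C′) ε ⟩
  sumC N N′ C C′ * ε ∎
  where open ≤-Reasoning

-- Positive normalised linear functionals: Jensen and Cauchy-Schwarz follow from these laws alone
-- and so hold at once for averages over pairs, vectors and boxes.
record Mean (X : Set) : Set where
  field
    E       : (X → ℚ) → ℚ
    E-cong  : ∀ {f g} → (∀ x → f x ≡ g x) → E f ≡ E g
    E-+     : ∀ f g → E (λ x → f x + g x) ≡ E f + E g
    E-*     : ∀ c f → E (λ x → c * f x) ≡ c * E f
    E-const : ∀ c → E (λ _ → c) ≡ c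
    E-mono  : ∀ {f g} → (∀ x → f x ≤ g x) → E f ≤ E g

  E-*ʳ : ∀ f c → E (λ x → f x * c) ≡ E f * c
  E-*ʳ f c = trans (E-cong (λ x → *-comm (f x) c)) (trans (E-* c f) (*-comm c (E f)))

  E-sub : ∀ f g → E (λ x → f x - g x) ≡ E f - E g
  E-sub f g = begin
    E (λ x → f x - g x)                  ≡⟨ E-cong (λ x → solve 2 (λ a b → a :- b := a :+ con (- 1ℚ) :* b) refl (f x) (g x)) ⟩
    E (λ x → f x + (- 1ℚ) * g x)         ≡⟨ E-+ f (λ x → (- 1ℚ) * g x) ⟩
    E f + E (λ x → (- 1ℚ) * g x)         ≡⟨ cong (E f +_) (E-* (- 1ℚ) g) ⟩
    E f + (- 1ℚ) * E g                   ≡⟨ solve 2 (λ a b → a :+ con (- 1ℚ) :* b := a :- b) refl (E f) (E g) ⟩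
    E f - E g ∎
    where open ≡-Reasoning

  E-nn : ∀ {f} → (∀ x → 0ℚ ≤ f x) → 0ℚ ≤ E f
  E-nn {f} p = subst (_≤ E f) (E-const 0ℚ) (E-mono p)

  E-≤const : ∀ {f c} → (∀ x → f x ≤ c) → E f ≤ c
  E-≤const {f} {c} p = subst (E f ≤_) (E-const c) (E-mono p)

  jensen : ∀ f → E f * E f ≤ E (λ x → f x * f x)
  jensen f = ≤-by (E-nn (λ x → sq≥0 (f x - m))) (sym (trans (cong (m * m +_) eq) (solve 2 (λ s m → m :* m :+ (s :- m :* m) := s) refl _ m)))
    where
    m = E f
    s = E (λ x → f x * f x)
    open ≡-Reasoning
    eq : E (λ x → (f x - m) * (f x - m)) ≡ s - m * m
    eq = begin
      E (λ x → (f x - m) * (f x - m))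
        ≡⟨ E-cong (λ x → solve 2 (λ a m → (a :- m) :* (a :- m) := a :* a :- (con 2ℚ :* m :* a :- m :* m)) refl (f x) m) ⟩
      E (λ x → f x * f x - (2ℚ * m * f x - m * m))   ≡⟨ E-sub _ _ ⟩
      s - E (λ x → 2ℚ * m * f x - m * m)             ≡⟨ cong (λ a → s - a) (E-sub _ _) ⟩
      s - (E (λ x → 2ℚ * m * f x) - E (λ _ → m * m)) ≡⟨ cong₂ (λ a b → s - (a - b)) (E-* (2ℚ * m) f) (E-const (m * m)) ⟩
      s - (2ℚ * m * m - m * m)                       ≡⟨ solve 2 (λ s m → s :- (con 2ℚ :* m :* m :- m :* m) := s :- m :* m) refl s m ⟩
      s - m * m ∎

  -- The form of Cauchy-Schwarz needed below: a bounded weight is discarded and the rest is squared.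
  cs : ∀ (b f : X → ℚ) → (∀ x → Bd (b x)) → E (λ x → b x * f x) * E (λ x → b x * f x) ≤ E (λ x → f x * f x)
  cs b f bd = ≤-trans (jensen (λ x → b x * f x)) (E-mono pointwise)
    where
    open ≤-Reasoning
    pointwise : ∀ x → (b x * f x) * (b x * f x) ≤ f x * f x
    pointwise x = begin
      (b x * f x) * (b x * f x) ≡⟨ solve 2 (λ a b → (a :* b) :* (a :* b) := (a :* a) :* (b :* b)) refl (b x) (f x) ⟩
      (b x * b x) * (f x * f x) ≤⟨ *-monoR (sq≥0 (f x)) (bd x) ⟩
      1ℚ * (f x * f x)          ≡⟨ *-identityˡ _ ⟩
      f x * f x ∎

  Bd-E : ∀ {f} → (∀ x → Bd (f x)) → Bd (E f)
  Bd-E {f} p = ≤-trans (jensen f) (E-≤const p)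

  pow2-jensen : ∀ N f → pow2 N (E f) ≤ E (λ x → pow2 N (f x))
  pow2-jensen zero f = ≤-refl
  pow2-jensen (suc N) f = ≤-trans (pow2-mono N (sq≥0 (E f)) (jensen f)) (pow2-jensen N (λ x → f x * f x))

-- Fubini is not a law of abstract means. Quantifying over every other mean makes the property pass
-- to products and vectors.
Commuting : {A : Set} → Mean A → Set₁
Commuting {A} m = ∀ {X : Set} (n : Mean X) (f : X → A → ℚ) → Mean.E n (λ x → Mean.E m (f x)) ≡ Mean.E m (λ a → Mean.E n (λ x → f x a))

E-prod : {A B : Set} (m : Mean A) (n : Mean B) (f : A → ℚ) (g : B → ℚ) →
  Mean.E m f * Mean.E n g ≡ Mean.E m (λ a → Mean.E n (λ b → f a * g b))
E-prod m n f g = trans (sym (Mean.E-*ʳ m f _)) (Mean.E-cong m (λ a → sym (Mean.E-* n (f a) g)))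

_×ᵐ_ : {A B : Set} → Mean A → Mean B → Mean (A × B)
m ×ᵐ n = record
  { E = λ f → m.E (λ a → n.E (λ b → f (a , b)))
  ; E-cong = λ p → m.E-cong (λ a → n.E-cong (λ b → p (a , b)))
  ; E-+ = λ f g → trans (m.E-cong (λ a → n.E-+ _ _)) (m.E-+ _ _)
  ; E-* = λ c f → trans (m.E-cong (λ a → n.E-* c _)) (m.E-* c _)
  ; E-const = λ c → trans (m.E-cong (λ a → n.E-const c)) (m.E-const c)
  ; E-mono = λ p → m.E-mono (λ a → n.E-mono (λ b → p (a , b))) }
  where
  module m = Mean m
  module n = Mean n

×ᵐ-comm : {A B : Set} (m : Mean A) (n : Mean B) → Commuting m → Commuting n → Commuting (m ×ᵐ n)
×ᵐ-comm m n p q r f = trans (p r _) (Mean.E-cong m (λ a → q r _))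

EVec : {A : Set} → Mean A → ∀ k → (Vec A k → ℚ) → ℚ
EVec m zero f = f []
EVec m (suc k) f = Mean.E m (λ a → EVec m k (λ v → f (a ∷ v)))

vecMean : {A : Set} → Mean A → ∀ k → Mean (Vec A k)
vecMean {A} m k = record { E = EVec m k ; E-cong = vcong k ; E-+ = vplus k ; E-* = vscale k ; E-const = vconst k ; E-mono = vmono k }
  where
  open Mean m
  vcong : ∀ k {f g : Vec A k → ℚ} → (∀ x → f x ≡ g x) → EVec m k f ≡ EVec m k g
  vcong zero p = p []
  vcong (suc k) p = E-cong (λ a → vcong k (λ v → p (a ∷ v)))
  vplus : ∀ k (f g : Vec A k → ℚ) → EVec m k (λ x → f x + g x) ≡ EVec m k f + EVec m k g
  vplus zero f g = refl
  vplus (suc k) f g = trans (E-cong (λ a → vplus k _ _)) (E-+ _ _)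
  vscale : ∀ k c (f : Vec A k → ℚ) → EVec m k (λ x → c * f x) ≡ c * EVec m k f
  vscale zero c f = refl
  vscale (suc k) c f = trans (E-cong (λ a → vscale k c _)) (E-* c _)
  vconst : ∀ k c → EVec m k (λ _ → c) ≡ c
  vconst zero c = refl
  vconst (suc k) c = trans (E-cong (λ a → vconst k c)) (E-const c)
  vmono : ∀ k {f g : Vec A k → ℚ} → (∀ x → f x ≤ g x) → EVec m k f ≤ EVec m k g
  vmono zero p = p []
  vmono (suc k) p = E-mono (λ a → vmono k (λ v → p (a ∷ v)))

vec-comm : {A : Set} (m : Mean A) → Commuting m → ∀ k → Commuting (vecMean m k)
vec-comm m p zero n f = refl
vec-comm m p (suc k) n f = trans (p n _) (Mean.E-cong m (λ a → vec-comm m p k n _))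

-- Natural numbers and finite sums in ℚ

natℚ : ℕ → ℚ
natℚ zero = 0ℚ
natℚ (suc n) = 1ℚ + natℚ n

natℚ≥0 : ∀ n → 0ℚ ≤ natℚ n
natℚ≥0 zero = ≤-refl
natℚ≥0 (suc n) = +-nn 0≤1 (natℚ≥0 n)

natℚ-suc>0 : ∀ n → 0ℚ < natℚ (suc n)
natℚ-suc>0 n = +-mono-<-≤ (positive⁻¹ 1ℚ) (natℚ≥0 n)

sum-mono : ∀ {n} {f g : Fin n → ℚ} → (∀ i → f i ≤ g i) → sum f ≤ sum g
sum-mono {zero} p = ≤-refl
sum-mono {suc n} p = +-mono-≤ (p zero) (sum-mono (λ i → p (suc i)))

sum-const : ∀ n c → sum {n} (λ _ → c) ≡ natℚ n * c
sum-const zero c = sym (*-zeroˡ c)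
sum-const (suc n) c = trans (cong (c +_) (sum-const n c)) (solve 2 (λ n c → c :+ n :* c := (con 1ℚ :+ n) :* c) refl (natℚ n) c)

boolℚ : ∀ {P : Set} → Dec P → ℚ
boolℚ (yes _) = 1ℚ
boolℚ (no _) = 0ℚ

boolℚ-≥0 : ∀ {P : Set} (d : Dec P) → 0ℚ ≤ boolℚ d
boolℚ-≥0 (yes _) = 0≤1
boolℚ-≥0 (no _) = ≤-refl

boolℚ-cong : ∀ {P Q : Set} (d : Dec P) (e : Dec Q) → (P → Q) → (Q → P) → boolℚ d ≡ boolℚ e
boolℚ-cong (yes _) (yes _) _ _ = refl
boolℚ-cong (yes p) (no q) f _ = ⊥-elim (q (f p))
boolℚ-cong (no p) (yes q) _ g = ⊥-elim (p (g q))
boolℚ-cong (no _) (no _) _ _ = refl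

sum-indicator : ∀ {n} (j : Fin n) → sum (λ i → boolℚ (i FinP.≟ j)) ≡ 1ℚ
sum-indicator {suc n} zero = trans (cong (1ℚ +_) (trans (sum-const n 0ℚ) (*-zeroʳ (natℚ n)))) (+-identityʳ 1ℚ)
sum-indicator {suc n} (suc j) = trans (+-identityˡ _)
  (trans (sum-cong-≗ (λ i → boolℚ-cong (suc i FinP.≟ suc j) (i FinP.≟ j) FinP.suc-injective (cong suc))) (sum-indicator j))

-- Averages over a finite field

module Field (F : FiniteField) where
  open FiniteField F public using (Carrier; _≟F_; 0≢1; size; enum)
    renaming (_+_ to _⊕_; _*_ to _⊗_; -_ to ⊖_; _-_ to _⊝_; 0# to 0F; 1# to 1F; inverse to F-inverse)

  FR : CommutativeRing 0ℓ 0ℓ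
  FR = record
    { Carrier = Carrier ; _≈_ = _≡_ ; _+_ = _⊕_ ; _*_ = _⊗_ ; -_ = ⊖_ ; 0# = 0F ; 1# = 1F
    ; isCommutativeRing = record
      { isRing = record
        { +-isAbelianGroup = record
          { isGroup = record
            { isMonoid = record
              { isSemigroup = record
                { isMagma = record { isEquivalence = Relation.Binary.PropositionalEquality.isEquivalence ; ∙-cong = cong₂ _⊕_ }
                ; assoc = λ x y z → e (G.+-assoc x y z) }
              ; identity = (λ x → e (G.+-identityˡ x)) , (λ x → e (G.+-identityʳ x)) }
            ; inverse = (λ x → e (G.-‿inverseˡ x)) , (λ x → e (G.-‿inverseʳ x))
            ; ⁻¹-cong = cong ⊖_ }
          ; comm = λ x y → e (G.+-comm x y) }
        ; *-cong = cong₂ _⊗_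
        ; *-assoc = λ x y z → e (G.*-assoc x y z)
        ; *-identity = (λ x → e (G.*-identityˡ x)) , (λ x → e (G.*-identityʳ x))
        ; distrib = (λ x y z → e (G.distribˡ x y z)) , (λ x y z → e (G.distribʳ x y z)) }
      ; *-comm = λ x y → e (G.*-comm x y) } }
    where
    module G = FiniteField F
    e = G.≈⇒≡

  open CommutativeRing FR public using ()
    renaming (+-comm to ⊕-comm; +-assoc to ⊕-assoc; +-identityʳ to ⊕-identityʳ; +-identityˡ to ⊕-identityˡ; -‿inverseʳ to ⊕-inverseʳ;
      zeroʳ to ⊗-zeroʳ; zeroˡ to ⊗-zeroˡ; *-comm to ⊗-comm; *-identityˡ to ⊗-identityˡ; *-identityʳ to ⊗-identityʳ)

  module S = IntSolver FR

  element : Fin size → Carrier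
  element = Bijection.to enum

  index : Carrier → Fin size
  index y = proj₁ (Bijection.surjective enum y)

  element-index : ∀ y → element (index y) ≡ y
  element-index y = proj₂ (Bijection.surjective enum y) refl

  index-element : ∀ i → index (element i) ≡ i
  index-element i = Bijection.injective enum (element-index (element i))

  0<size : 0ℚ < natℚ size
  0<size = go size (index 0F)
    where
    go : ∀ n → Fin n → 0ℚ < natℚ n
    go (suc n) _ = natℚ-suc>0 n

  qℚ : ℚ
  qℚ = natℚ size

  ε : ℚ
  ε = (1/ qℚ) {{pos⇒nonZero qℚ {{positive 0<size}}}}

  ε*q : ε * qℚ ≡ 1ℚ
  ε*q = *-inverseˡ qℚ {{pos⇒nonZero qℚ {{positive 0<size}}}}

  0≤ε : 0ℚ ≤ ε
  0≤ε = <⇒≤ (positive⁻¹ ε {{1/pos⇒pos qℚ {{positive 0<size}}}})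

  ε≤1 : ε ≤ 1ℚ
  ε≤1 = subst₂ _≤_ (*-identityʳ ε) ε*q (*-monoL 0≤ε (go size (index 0F)))
    where
    go : ∀ n → Fin n → 1ℚ ≤ natℚ n
    go (suc n) _ = ≤-by (natℚ≥0 n) refl

  opaque
    avg : (Carrier → ℚ) → ℚ
    avg f = ε * sum (λ i → f (element i))

    avg-def : ∀ f → avg f ≡ ε * sum (λ i → f (element i))
    avg-def f = refl

    avg-cong : ∀ {f g : Carrier → ℚ} → (∀ x → f x ≡ g x) → avg f ≡ avg g
    avg-cong p = cong (ε *_) (sum-cong-≗ (λ i → p (element i)))

    avg-+ : ∀ f g → avg (λ x → f x + g x) ≡ avg f + avg g
    avg-+ f g = trans (cong (ε *_) (∑-distrib-+ (f ∘ element) (g ∘ element))) (*-distribˡ-+ ε _ _)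

    avg-* : ∀ c f → avg (λ x → c * f x) ≡ c * avg f
    avg-* c f = trans (cong (ε *_) (sym (SS.*-distribˡ-sum c (f ∘ element))))
      (solve 3 (λ e c s → e :* (c :* s) := c :* (e :* s)) refl ε c (sum (f ∘ element)))

    avg-const : ∀ c → avg (λ _ → c) ≡ c
    avg-const c = trans (cong (ε *_) (sum-const size c)) (trans (sym (*-assoc ε qℚ c)) (trans (cong (_* c) ε*q) (*-identityˡ c)))

    avg-mono : ∀ {f g : Carrier → ℚ} → (∀ x → f x ≤ g x) → avg f ≤ avg g
    avg-mono p = *-monoL 0≤ε (sum-mono (λ i → p (element i)))

    avg-bij : ∀ (σ τ : Carrier → Carrier) → (∀ x → σ (τ x) ≡ x) → (∀ x → τ (σ x) ≡ x) → ∀ f → avg (λ x → f (σ x)) ≡ avg f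
    avg-bij σ τ στ τσ f = cong (ε *_) (sym (trans (sum-permute (f ∘ element) π)
      (sum-cong-≗ (λ i → cong f (element-index (σ (element i)))))))
      where
      π : Perm.Permutation size size
      π = Perm.permutation (λ i → index (σ (element i))) (λ i → index (τ (element i)))
        (λ i → trans (cong (index ∘ σ) (element-index (τ (element i)))) (trans (cong index (στ _)) (index-element i)))
        (λ i → trans (cong (index ∘ τ) (element-index (σ (element i)))) (trans (cong index (τσ _)) (index-element i)))

    avg-fubini : ∀ {X : Set} (m : Mean X) (f : X → Carrier → ℚ) → Mean.E m (λ x → avg (f x)) ≡ avg (λ a → Mean.E m (λ x → f x a))
    avg-fubini m f = trans (Mean.E-* m ε _) (cong (ε *_) (go size element))
      where
      go : ∀ n (e : Fin n → Carrier) → Mean.E m (λ x → sum (λ i → f x (e i))) ≡ sum (λ i → Mean.E m (λ x → f x (e i)))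
      go zero e = Mean.E-const m 0ℚ
      go (suc n) e = trans (Mean.E-+ m _ _) (cong (Mean.E m (λ x → f x (e zero)) +_) (go n (e ∘ suc)))

    avg-indicator : ∀ c → avg (λ h → boolℚ (h ≟F c)) ≡ ε
    avg-indicator c = trans (cong (ε *_) (trans (sum-cong-≗ (λ i → boolℚ-cong (element i ≟F c) (i FinP.≟ index c)
        (λ e → trans (sym (index-element i)) (cong index e)) (λ e → trans (cong element e) (element-index c))))
        (sum-indicator (index c)))) (*-identityʳ ε)

  meanF : Mean Carrier
  meanF = record { E = avg ; E-cong = avg-cong ; E-+ = avg-+ ; E-* = avg-* ; E-const = avg-const ; E-mono = avg-mono }

  module M = Mean meanF

  avg-shift : ∀ t f → avg (λ x → f (x ⊕ t)) ≡ avg f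
  avg-shift t = avg-bij (_⊕ t) (_⊝ t)
    (λ x → S.solve 2 (λ x t → (x S.:- t) S.:+ t S.:= x) refl x t)
    (λ x → S.solve 2 (λ x t → (x S.:+ t) S.:- t S.:= x) refl x t)

  avg-shiftˡ : ∀ t f → avg (λ x → f (t ⊕ x)) ≡ avg f
  avg-shiftˡ t f = trans (avg-cong (λ x → cong f (⊕-comm t x))) (avg-shift t f)

  avg-scale : ∀ a → a ≢ 0F → ∀ f → avg (λ x → f (a ⊗ x)) ≡ avg f
  avg-scale a a≢0 = avg-bij (a ⊗_) (b ⊗_)
    (λ x → trans (S.solve 3 (λ a b x → a S.:* (b S.:* x) S.:= (a S.:* b) S.:* x) refl a b x) (unit x))
    (λ x → trans (S.solve 3 (λ a b x → b S.:* (a S.:* x) S.:= (a S.:* b) S.:* x) refl a b x) (unit x))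
    where
    b = proj₁ (F-inverse a a≢0)
    unit : ∀ x → (a ⊗ b) ⊗ x ≡ x
    unit x = trans (cong (_⊗ x) (proj₂ (F-inverse a a≢0))) (⊗-identityˡ x)

  -- Each exceptional point has mass ε, and there the trivial bound suffices; this is how degenerate
  -- differencing parameters are paid for.
  avg-except : ∀ (bad : List Carrier) {f g : Carrier → ℚ} → (∀ h → f h ≤ g h + 1ℚ) → (∀ h → h ∉ bad → f h ≤ g h) →
    avg f ≤ avg g + natℚ (length bad) * ε
  avg-except bad {f} {g} p q = ≤-trans (avg-mono pointwise)
    (≤-reflexive (trans (avg-+ g (λ h → count bad h)) (cong (avg g +_) (avg-count bad))))
    where
    count : List Carrier → Carrier → ℚ
    count [] h = 0ℚ
    count (c ∷ cs) h = boolℚ (h ≟F c) + count cs h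
    avg-count : ∀ cs → avg (count cs) ≡ natℚ (length cs) * ε
    avg-count [] = trans (avg-const 0ℚ) (sym (*-zeroˡ ε))
    avg-count (c ∷ cs) = trans (avg-+ (λ h → boolℚ (h ≟F c)) (count cs)) (trans (cong₂ _+_ (avg-indicator c) (avg-count cs))
      (solve 2 (λ e n → e :+ n :* e := (con 1ℚ :+ n) :* e) refl ε (natℚ (length cs))))
    count≥0 : ∀ cs h → 0ℚ ≤ count cs h
    count≥0 [] h = ≤-refl
    count≥0 (c ∷ cs) h = +-nn (boolℚ-≥0 (h ≟F c)) (count≥0 cs h)
    either : ∀ cs h → (h ∉ cs) ⊎ (1ℚ ≤ count cs h)
    either [] h = inj₁ λ ()
    either (c ∷ cs) h with h ≟F c | either cs h
    ... | yes _ | _ = inj₂ (≤-by (count≥0 cs h) refl)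
    ... | no _ | inj₂ r = inj₂ (subst (1ℚ ≤_) (sym (+-identityˡ _)) r)
    ... | no h≢c | inj₁ r = inj₁ λ { (here e) → h≢c e ; (there m) → r m }
    pointwise : ∀ h → f h ≤ g h + count bad h
    pointwise h with either bad h
    ... | inj₁ r = ≤-trans (q h r) (≤-by (count≥0 bad h) refl)
    ... | inj₂ r = ≤-trans (p h) (+-monoʳ-≤ (g h) r)

  meanV : ∀ k → Mean (Vec Carrier k)
  meanV = vecMean meanF

  module V {k} = Mean (meanV k)

  meanV-comm : ∀ k → Commuting (meanV k)
  meanV-comm = vec-comm meanF avg-fubini

  meanFF : Mean (Carrier × Carrier)
  meanFF = meanF ×ᵐ meanF

  meanFF-comm : Commuting meanFF
  meanFF-comm = ×ᵐ-comm meanF meanF avg-fubini avg-fubini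

-- Uniformity norms and degree lowering

module Norms (F : FiniteField) where
  open Field F

  Fun : Set
  Fun = Carrier → ℚ

  _∙_ : Fun → Fun → Fun
  (f ∙ g) x = f x * g x

  sh : Carrier → Fun → Fun
  sh a f x = f (x ⊕ a)

  Bdd : Fun → Set
  Bdd f = ∀ x → Bd (f x)

  sumV : ∀ {k} → Vec Carrier k → Carrier
  sumV [] = 0F
  sumV (a ∷ h) = a ⊕ sumV h

  Δ : ∀ {k} → Vec Carrier k → Fun → Fun
  Δ [] f = f
  Δ (a ∷ h) f = Δ h (f ∙ sh a f)

  -- The Gowers norm raised to the power 2^k; rational values need no conjugation, and `U 0` is the
  -- mean.
  U : ℕ → Fun → ℚ
  U zero f = avg f
  U (suc k) f = avg (λ a → U k (f ∙ sh a f))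

  -- The autocorrelation of `f`; its mean square is `U 2 f`.
  ψ : Fun → Fun
  ψ f t = avg (λ z → f z * f (z ⊕ t))

  U-cong : ∀ k {f g} → (∀ x → f x ≡ g x) → U k f ≡ U k g
  U-cong zero p = avg-cong p
  U-cong (suc k) p = avg-cong (λ a → U-cong k (λ x → cong₂ _*_ (p x) (p (x ⊕ a))))

  U-Δ : ∀ k j f → U (k ℕ.+ j) f ≡ V.E {k} (λ h → U j (Δ h f))
  U-Δ zero j f = refl
  U-Δ (suc k) j f = avg-cong (λ a → U-Δ k j _)

  Δ-cong : ∀ {k} (h : Vec Carrier k) {f g} → (∀ x → f x ≡ g x) → ∀ x → Δ h f x ≡ Δ h g x
  Δ-cong [] p = p
  Δ-cong (a ∷ h) p = Δ-cong h (λ x → cong₂ _*_ (p x) (p (x ⊕ a)))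

  *-swap4 : ∀ a b c d → (a * b) * (c * d) ≡ (a * c) * (b * d)
  *-swap4 = solve 4 (λ a b c d → (a :* b) :* (c :* d) := (a :* c) :* (b :* d)) refl

  Δ-∙ : ∀ {k} (h : Vec Carrier k) f g x → Δ h (f ∙ g) x ≡ Δ h f x * Δ h g x
  Δ-∙ [] f g x = refl
  Δ-∙ (a ∷ h) f g x = trans (Δ-cong h (λ x → *-swap4 (f x) (g x) (f (x ⊕ a)) (g (x ⊕ a))) x) (Δ-∙ h _ _ x)

  ⊕-swap : ∀ x a b → (x ⊕ a) ⊕ b ≡ (x ⊕ b) ⊕ a
  ⊕-swap x a b = S.solve 3 (λ x a b → (x S.:+ a) S.:+ b S.:= (x S.:+ b) S.:+ a) refl x a b

  Δ-sh : ∀ {k} (h : Vec Carrier k) a f x → Δ h (sh a f) x ≡ Δ h f (x ⊕ a)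
  Δ-sh [] a f x = refl
  Δ-sh (b ∷ h) a f x = trans (Δ-cong h (λ x → cong (λ y → f (x ⊕ a) * f y) (⊕-swap x b a)) x) (Δ-sh h a _ x)

  Δ-∷ : ∀ {k} a (h : Vec Carrier k) f x → Δ (a ∷ h) f x ≡ Δ h f x * Δ h f (x ⊕ a)
  Δ-∷ a h f x = trans (Δ-∙ h f (sh a f) x) (cong (Δ h f x *_) (Δ-sh h a f x))

  Δ-Bd : ∀ {k} (h : Vec Carrier k) {f} → Bdd f → Bdd (Δ h f)
  Δ-Bd [] p = p
  Δ-Bd (a ∷ h) {f} p = Δ-Bd h (λ x → Bd-* {f x} (p x) (p (x ⊕ a)))

  -- The product over all vertices of the cube but the top one: the whole face at x, and the face at
  -- `x ⊕ a` without its top.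
  low : ∀ {k} → Vec Carrier k → Fun → Fun
  low [] f x = 1ℚ
  low (a ∷ h) f x = Δ h f x * low h f (x ⊕ a)

  Δ-top-low : ∀ {k} (h : Vec Carrier k) f x → Δ h f x ≡ f (x ⊕ sumV h) * low h f x
  Δ-top-low [] f x = trans (cong f (sym (⊕-identityʳ x))) (sym (*-identityʳ _))
  Δ-top-low (a ∷ h) f x = begin
    Δ (a ∷ h) f x                                               ≡⟨ Δ-∷ a h f x ⟩
    Δ h f x * Δ h f (x ⊕ a)                                     ≡⟨ cong (Δ h f x *_) (Δ-top-low h f (x ⊕ a)) ⟩
    Δ h f x * (f ((x ⊕ a) ⊕ sumV h) * low h f (x ⊕ a))          ≡⟨ cong (λ y → Δ h f x * (f y * low h f (x ⊕ a))) (⊕-assoc x a _) ⟩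
    Δ h f x * (f (x ⊕ (a ⊕ sumV h)) * low h f (x ⊕ a))          ≡⟨ solve 3 (λ a b c → a :* (b :* c) := b :* (a :* c)) refl (Δ h f x) (f (x ⊕ (a ⊕ sumV h))) (low h f (x ⊕ a)) ⟩
    f (x ⊕ (a ⊕ sumV h)) * (Δ h f x * low h f (x ⊕ a)) ∎
    where open ≡-Reasoning

  -- B is a product of bounded factors, the i-th of which does not depend on the i-th coordinate.
  Sep : ∀ k → (Vec Carrier k → ℚ) → Set
  Sep zero B = B [] ≡ 1ℚ
  Sep (suc k) B = Σ (Vec Carrier k → ℚ) λ b → Σ (Carrier → Vec Carrier k → ℚ) λ B′ →
    (∀ h → Bd (b h)) × (∀ a → Sep k (B′ a)) × (∀ a h → B (a ∷ h) ≡ b h * B′ a h)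

  Sep-* : ∀ k {B C} → Sep k B → Sep k C → Sep k (λ h → B h * C h)
  Sep-* zero p q = trans (cong₂ _*_ p q) (*-identityʳ 1ℚ)
  Sep-* (suc k) (b , B′ , bd , s , e) (c , C′ , cd , t , e′) =
    (λ h → b h * c h) , (λ a h → B′ a h * C′ a h) , (λ h → Bd-* {b h} (bd h) (cd h)) , (λ a → Sep-* k (s a) (t a)) ,
    λ a h → trans (cong₂ _*_ (e a h) (e′ a h)) (*-swap4 (b h) (B′ a h) (c h) (C′ a h))

  Sep-low : ∀ k {f} → Bdd f → ∀ x → Sep k (λ h → low h f x)
  Sep-low zero p x = refl
  Sep-low (suc k) {f} p x = (λ h → Δ h f x) , (λ a h → low h f (x ⊕ a)) , (λ h → Δ-Bd h p x) , (λ a → Sep-low k p (x ⊕ a)) , λ a h → refl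

  -- The 2^k-th power of the Gowers box norm of a function of k separate variables.
  Box : ∀ k → (Vec Carrier k → ℚ) → ℚ
  Box zero Γ = Γ []
  Box (suc k) Γ = avg (λ a → avg (λ b → Box k (λ h → Γ (a ∷ h) * Γ (b ∷ h))))

  Box-cong : ∀ k {Γ Γ′} → (∀ h → Γ h ≡ Γ′ h) → Box k Γ ≡ Box k Γ′
  Box-cong zero p = p []
  Box-cong (suc k) p = avg-cong (λ a → avg-cong (λ b → Box-cong k (λ h → cong₂ _*_ (p _) (p _))))

  -- Cauchy–Schwarz in each coordinate in turn removes the factors of B.
  Box-cs : ∀ k Γ B → Sep k B → pow2 k (V.E {k} (λ h → Γ h * B h)) ≤ Box k Γ
  Box-cs zero Γ B p = ≤-reflexive (trans (cong (Γ [] *_) p) (*-identityʳ _))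
  Box-cs (suc k) Γ B (b , B′ , bd , s , e) = begin
    pow2 k (X * X)                                      ≤⟨ pow2-mono k (sq≥0 X) XX≤ ⟩
    pow2 k (avg (λ a → avg (λ c → Y a c)))              ≤⟨ M.pow2-jensen k _ ⟩
    avg (λ a → pow2 k (avg (λ c → Y a c)))              ≤⟨ avg-mono (λ a → M.pow2-jensen k _) ⟩
    avg (λ a → avg (λ c → pow2 k (Y a c)))
      ≤⟨ avg-mono (λ a → avg-mono (λ c → Box-cs k _ _ (Sep-* k (s a) (s c)))) ⟩
    Box (suc k) Γ ∎
    where
    open ≤-Reasoning
    X = V.E {suc k} (λ h → Γ h * B h)
    W : Carrier → Vec Carrier k → ℚ
    W a h = Γ (a ∷ h) * B′ a h
    Y : Carrier → Carrier → ℚ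
    Y a c = V.E {k} (λ h → (Γ (a ∷ h) * Γ (c ∷ h)) * (B′ a h * B′ c h))
    X-eq : X ≡ V.E {k} (λ h → b h * avg (λ a → W a h))
    X-eq = trans (meanV-comm k meanF _) (V.E-cong (λ h → trans
      (avg-cong (λ a → trans (cong (Γ (a ∷ h) *_) (e a h))
        (solve 3 (λ g b c → g :* (b :* c) := b :* (g :* c)) refl (Γ (a ∷ h)) (b h) (B′ a h))))
      (avg-* (b h) _)))
    YY-eq : V.E {k} (λ h → avg (λ a → W a h) * avg (λ a → W a h)) ≡ avg (λ a → avg (λ c → Y a c))
    YY-eq = trans (V.E-cong {k} (λ h → E-prod meanF meanF (λ a → W a h) (λ a → W a h))) (trans (avg-fubini (meanV k) _)
      (avg-cong (λ a → trans (avg-fubini (meanV k) _) (avg-cong (λ c → V.E-cong (λ h →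
        *-swap4 (Γ (a ∷ h)) (B′ a h) (Γ (c ∷ h)) (B′ c h)))))))
    XX≤ : X * X ≤ avg (λ a → avg (λ c → Y a c))
    XX≤ = subst₂ _≤_ (sym (cong₂ _*_ X-eq X-eq)) YY-eq (V.cs {k} b _ bd)

  Pair : Set
  Pair = Carrier × Carrier

  meanP : ∀ k → Mean (Vec Pair k)
  meanP = vecMean meanFF

  module P {k} = Mean (meanP k)

  meanP-comm : ∀ k → Commuting (meanP k)
  meanP-comm = vec-comm meanFF meanFF-comm

  Π : ∀ {k} → Vec Pair k → (Vec Carrier k → ℚ) → ℚ
  Π [] Γ = Γ []
  Π ((a , b) ∷ p) Γ = Π p (λ h → Γ (a ∷ h) * Γ (b ∷ h))

  Box-Π : ∀ k Γ → Box k Γ ≡ P.E {k} (λ p → Π p Γ)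
  Box-Π zero Γ = refl
  Box-Π (suc k) Γ = avg-cong (λ a → avg-cong (λ b → Box-Π k _))

  Π-cong : ∀ {k} (p : Vec Pair k) {Γ Γ′} → (∀ h → Γ h ≡ Γ′ h) → Π p Γ ≡ Π p Γ′
  Π-cong [] e = e []
  Π-cong ((a , b) ∷ p) e = Π-cong p (λ h → cong₂ _*_ (e _) (e _))

  Π-* : ∀ {k} (p : Vec Pair k) Γ Γ′ → Π p (λ h → Γ h * Γ′ h) ≡ Π p Γ * Π p Γ′
  Π-* [] Γ Γ′ = refl
  Π-* ((a , b) ∷ p) Γ Γ′ = trans (Π-cong p (λ h → *-swap4 (Γ (a ∷ h)) (Γ′ (a ∷ h)) (Γ (b ∷ h)) (Γ′ (b ∷ h)))) (Π-* p _ _)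

  Π-Bd : ∀ {k} (p : Vec Pair k) Γ → (∀ h → Bd (Γ h)) → Bd (Π p Γ)
  Π-Bd [] Γ q = q []
  Π-Bd ((a , b) ∷ p) Γ q = Π-Bd p _ (λ h → Bd-* {Γ (a ∷ h)} (q (a ∷ h)) (q (b ∷ h)))

  -- In the product over the vertices of a box, the factors other than the one at h: each omits some coordinate of h.
  residue : ∀ {k} → (Vec Carrier k → ℚ) → Vec Carrier k → Vec Carrier k → ℚ
  residue ψ [] [] = 1ℚ
  residue ψ (b ∷ h′) (a ∷ h) = ψ (b ∷ h) * residue (λ v → ψ (a ∷ v) * ψ (b ∷ v)) h′ h

  -- With the opposite corner `h′` frozen, one corner value `ψ h` is singled out, against a weight
  -- that `Box-cs` can remove.
  Box-residue : ∀ k ψ → Box k ψ ≡ V.E {k} (λ h′ → V.E {k} (λ h → ψ h * residue ψ h′ h))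
  Box-residue zero ψ = sym (*-identityʳ _)
  Box-residue (suc k) ψ = begin
    avg (λ a → avg (λ b → Box k (ψ₂ a b)))
      ≡⟨ avg-cong (λ a → avg-cong (λ b → Box-residue k (ψ₂ a b))) ⟩
    avg (λ a → avg (λ b → V.E {k} (λ h′ → V.E {k} (λ h → ψ₂ a b h * residue (ψ₂ a b) h′ h))))
      ≡⟨ avg-fubini meanF _ ⟩
    avg (λ b → avg (λ a → V.E {k} (λ h′ → V.E {k} (λ h → ψ₂ a b h * residue (ψ₂ a b) h′ h))))
      ≡⟨ avg-cong (λ b → meanV-comm k meanF _) ⟩
    avg (λ b → V.E {k} (λ h′ → avg (λ a → V.E {k} (λ h → ψ₂ a b h * residue (ψ₂ a b) h′ h))))
      ≡⟨ avg-cong (λ b → V.E-cong {k} (λ h′ → avg-cong (λ a → V.E-cong {k} (λ h → *-assoc (ψ (a ∷ h)) (ψ (b ∷ h)) (residue (ψ₂ a b) h′ h))))) ⟩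
    V.E {suc k} (λ h′ → V.E {suc k} (λ h → ψ h * residue ψ h′ h)) ∎
    where
    open ≡-Reasoning
    ψ₂ : Carrier → Carrier → Vec Carrier k → ℚ
    ψ₂ a b v = ψ (a ∷ v) * ψ (b ∷ v)

  Sep-residue : ∀ k ψ → (∀ h → Bd (ψ h)) → ∀ h′ → Sep k (residue ψ h′)
  Sep-residue zero ψ p [] = refl
  Sep-residue (suc k) ψ p (b ∷ h′) = (λ h → ψ (b ∷ h)) , (λ a h → residue (λ v → ψ (a ∷ v) * ψ (b ∷ v)) h′ h) ,
    (λ h → p (b ∷ h)) , (λ a → Sep-residue k _ (λ h → Bd-* {ψ (a ∷ h)} (p (a ∷ h)) (p (b ∷ h))) h′) , λ a h → refl

  U1 : ∀ f → U 1 f ≡ avg f * avg f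
  U1 f = begin
    avg (λ a → avg (λ x → f x * f (x ⊕ a)))   ≡⟨ avg-fubini meanF _ ⟩
    avg (λ x → avg (λ a → f x * f (x ⊕ a)))   ≡⟨ avg-cong (λ x → trans (avg-* (f x) _) (cong (f x *_) (avg-shiftˡ x f))) ⟩
    avg (λ x → f x * avg f)                   ≡⟨ M.E-*ʳ f (avg f) ⟩
    avg f * avg f ∎
    where open ≡-Reasoning

  U1≥0 : ∀ f → 0ℚ ≤ U 1 f
  U1≥0 f = subst (0ℚ ≤_) (sym (U1 f)) (sq≥0 (avg f))

  U≥0 : ∀ k f → 0ℚ ≤ U (suc k) f
  U≥0 zero f = U1≥0 f
  U≥0 (suc k) f = M.E-nn (λ a → U≥0 k (f ∙ sh a f))

  U-Bd : ∀ k {f} → Bdd f → Bd (U k f)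
  U-Bd zero p = M.Bd-E p
  U-Bd (suc k) {f} p = M.Bd-E (λ a → U-Bd k (λ x → Bd-* {f x} (p x) (p (x ⊕ a))))

  -- One autocorrelation is left unexpanded. It becomes a weight on the difference x′ - x, in the
  -- place where Fourier analysis would put characters.
  U2 : ∀ G → U 2 G ≡ avg (λ x → avg (λ x′ → (G x * G x′) * ψ G (x′ ⊝ x)))
  U2 G = begin
    avg (λ a → U 1 (G ∙ sh a G))                            ≡⟨ avg-cong (λ a → U1 (G ∙ sh a G)) ⟩
    avg (λ a → ψ G a * ψ G a)                               ≡⟨ avg-cong (λ a → sym (M.E-*ʳ _ (ψ G a))) ⟩
    avg (λ a → avg (λ x → (G x * G (x ⊕ a)) * ψ G a))       ≡⟨ avg-fubini meanF _ ⟩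
    avg (λ x → avg (λ a → (G x * G (x ⊕ a)) * ψ G a))
      ≡⟨ avg-cong (λ x → avg-cong (λ a → cong (λ t → (G x * G (x ⊕ a)) * ψ G t)
           (S.solve 2 (λ x a → a S.:= (x S.:+ a) S.:- x) refl x a))) ⟩
    avg (λ x → avg (λ a → (G x * G (x ⊕ a)) * ψ G ((x ⊕ a) ⊝ x)))
      ≡⟨ avg-cong (λ x → avg-shiftˡ x (λ x′ → (G x * G x′) * ψ G (x′ ⊝ x))) ⟩
    avg (λ x → avg (λ x′ → (G x * G x′) * ψ G (x′ ⊝ x))) ∎
    where open ≡-Reasoning

  -- In each direction the corners `a` and `b` enter only through the base point and the step b - a,
  -- so a box of coordinate sums is a cube.
  U-Box : ∀ k G → U k G ≡ avg (λ z → Box k (λ h → G (z ⊕ sumV h)))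
  U-Box zero G = avg-cong (λ z → cong G (sym (⊕-identityʳ z)))
  U-Box (suc k) G = sym (begin
    avg (λ z → avg (λ a → avg (λ b → Box k (λ h → G (z ⊕ (a ⊕ sumV h)) * G (z ⊕ (b ⊕ sumV h))))))
      ≡⟨ avg-cong (λ z → avg-cong (λ a → avg-cong (λ b → Box-cong k (λ h → cong₂ (λ s t → G s * G t)
           (sym (⊕-assoc z a _))
           (S.solve 4 (λ z a b s → z S.:+ (b S.:+ s) S.:= ((z S.:+ a) S.:+ s) S.:+ (b S.:- a)) refl z a b (sumV h)))))) ⟩
    avg (λ z → avg (λ a → avg (λ b → T (z ⊕ a) (b ⊝ a))))   ≡⟨ avg-cong (λ z → avg-cong (λ a → avg-shift (⊖ a) _)) ⟩
    avg (λ z → avg (λ a → avg (λ b → T (z ⊕ a) b)))         ≡⟨ avg-cong (λ z → avg-shiftˡ z (λ y → avg (T y))) ⟩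
    avg (λ z → avg (λ a → avg (λ b → T a b)))               ≡⟨ avg-const _ ⟩
    avg (λ a → avg (λ b → T a b))                           ≡⟨ avg-fubini meanF _ ⟩
    avg (λ b → avg (λ a → T a b))                           ≡⟨ avg-cong (λ b → sym (U-Box k (G ∙ sh b G))) ⟩
    U (suc k) G ∎)
    where
    open ≡-Reasoning
    T : Carrier → Carrier → ℚ
    T z d = Box k (λ h → G (z ⊕ sumV h) * G ((z ⊕ sumV h) ⊕ d))

  -- Averages of convolutions. With R = _≡_ these are the positive-definite functions,
  -- with the trivial R a substitute for functions with absolutely summable Fourier coefficients.
  data Conv (R : Fun → Fun → Set) : Fun → Set where
    conv : ∀ {D} u v → Bdd u → Bdd v → R u v → (∀ x → D x ≡ avg (λ z → u z * v (z ⊕ x))) → Conv R D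
    mean : ∀ {D} (D′ : Carrier → Fun) → (∀ w → Conv R (D′ w)) → (∀ x → D x ≡ avg (λ w → D′ w x)) → Conv R D

  PD : Fun → Set
  PD = Conv _≡_

  Wiener : Fun → Set
  Wiener = Conv (λ _ _ → ⊤)

  Conv-Bd : ∀ {R D} → Conv R D → Bdd D
  Conv-Bd (conv u v p q _ e) x = subst Bd (sym (e x)) (M.Bd-E (λ z → Bd-* {u z} (p z) (q (z ⊕ x))))
  Conv-Bd (mean D′ c e) x = subst Bd (sym (e x)) (M.Bd-E (λ w → Conv-Bd (c w) x))

  -- Writing the second integration variable as z + w turns a product of two convolutions into an
  -- average over w of convolutions of products; `cl` says that `R` survives this.
  Conv-∙ : ∀ {R} → (∀ {u v u′ v′} w → R u v → R u′ v′ → R (u ∙ sh w u′) (v ∙ sh w v′)) →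
    ∀ {D D′} → Conv R D → Conv R D′ → Conv R (D ∙ D′)
  Conv-∙ cl {D} {D′} (mean E c e) d = mean (λ w → E w ∙ D′) (λ w → Conv-∙ cl (c w) d)
    (λ x → trans (cong (_* D′ x) (e x)) (sym (M.E-*ʳ _ (D′ x))))
  Conv-∙ cl {D} {D′} c@(conv _ _ _ _ _ _) (mean E d e) = mean (λ w → D ∙ E w) (λ w → Conv-∙ cl c (d w))
    (λ x → trans (cong (D x *_) (e x)) (sym (avg-* (D x) _)))
  Conv-∙ {R} cl {D} {D′} (conv u v ub vb r e) (conv u′ v′ ub′ vb′ r′ e′) =
    mean (λ w x → avg (λ z → (u ∙ sh w u′) z * (v ∙ sh w v′) (z ⊕ x)))
      (λ w → conv (u ∙ sh w u′) (v ∙ sh w v′) (λ z → Bd-* {u z} (ub z) (ub′ (z ⊕ w))) (λ z → Bd-* {v z} (vb z) (vb′ (z ⊕ w))) (cl w r r′) (λ _ → refl))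
      λ x → begin
        D x * D′ x ≡⟨ cong₂ _*_ (e x) (e′ x) ⟩
        avg (λ z → u z * v (z ⊕ x)) * avg (λ z → u′ z * v′ (z ⊕ x))
          ≡⟨ E-prod meanF meanF _ _ ⟩
        avg (λ z → avg (λ y → (u z * v (z ⊕ x)) * (u′ y * v′ (y ⊕ x))))
          ≡⟨ avg-cong (λ z → sym (avg-shiftˡ z _)) ⟩
        avg (λ z → avg (λ w → (u z * v (z ⊕ x)) * (u′ (z ⊕ w) * v′ ((z ⊕ w) ⊕ x))))
          ≡⟨ avg-cong (λ z → avg-cong (λ w → trans (cong (λ y → (u z * v (z ⊕ x)) * (u′ (z ⊕ w) * v′ y)) (⊕-swap z w x))
               (*-swap4 (u z) (v (z ⊕ x)) (u′ (z ⊕ w)) (v′ ((z ⊕ x) ⊕ w))))) ⟩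
        avg (λ z → avg (λ w → (u z * u′ (z ⊕ w)) * (v (z ⊕ x) * v′ ((z ⊕ x) ⊕ w))))
          ≡⟨ avg-fubini meanF _ ⟩
        avg (λ w → avg (λ z → (u ∙ sh w u′) z * (v ∙ sh w v′) (z ⊕ x))) ∎
    where open ≡-Reasoning

  PD-∙ : ∀ {D D′} → PD D → PD D′ → PD (D ∙ D′)
  PD-∙ = Conv-∙ (λ w p q → cong₂ (λ u u′ → u ∙ sh w u′) p q)

  Wiener-∙ : ∀ {D D′} → Wiener D → Wiener D′ → Wiener (D ∙ D′)
  Wiener-∙ = Conv-∙ (λ _ _ _ → tt)

  Wiener-sh : ∀ a {D} → Wiener D → Wiener (sh a D)
  Wiener-sh a (conv u v p q _ e) = conv u (sh a v) p (λ x → q (x ⊕ a)) tt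
    (λ x → trans (e (x ⊕ a)) (avg-cong (λ z → cong (λ y → u z * v y) (sym (⊕-assoc z x a)))))
  Wiener-sh a (mean D′ c e) = mean (λ w → sh a (D′ w)) (λ w → Wiener-sh a (c w)) (λ x → e (x ⊕ a))

  Wiener-const : ∀ {c} → Bd c → Wiener (λ _ → c)
  Wiener-const {c} b = conv (λ _ → c) (λ _ → 1ℚ) (λ _ → b) (λ _ → Bd-1) tt (λ x → sym (trans (avg-const (c * 1ℚ)) (*-identityʳ c)))

  -- The mean of an autocorrelation is the square of a mean.
  PD-avg≥0 : ∀ {D} → PD D → 0ℚ ≤ avg D
  PD-avg≥0 (conv u .u p _ refl e) = subst (0ℚ ≤_) (sym (trans (avg-cong e) (U1 u))) (sq≥0′ u)
    where
    sq≥0′ : ∀ u → 0ℚ ≤ avg u * avg u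
    sq≥0′ u = sq≥0 (avg u)
  PD-avg≥0 (mean D′ c e) = subst (0ℚ ≤_) (sym (trans (avg-cong e) (avg-fubini meanF _))) (M.E-nn (λ w → PD-avg≥0 (c w)))

  PD-ψ : ∀ {f} → Bdd f → PD (ψ f)
  PD-ψ {f} p = conv f f p p refl (λ _ → refl)

  Conv-Π : ∀ {R} → (∀ {D D′} → Conv R D → Conv R D′ → Conv R (D ∙ D′)) →
    ∀ {k} (p : Vec Pair k) (Φ : Vec Carrier k → Fun) → (∀ h → Conv R (Φ h)) → Conv R (λ t → Π p (λ h → Φ h t))
  Conv-Π cl [] Φ c = c []
  Conv-Π cl ((a , b) ∷ p) Φ c = Conv-Π cl p (λ h → Φ (a ∷ h) ∙ Φ (b ∷ h)) (λ h → cl (c (a ∷ h)) (c (b ∷ h)))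

  -- The average over t of the box norms in h of the correlations of Δ h f is a U (k+1) norm in disguise.
  ψ-Box : ∀ k {f} → Bdd f → pow2 k (avg (λ t → Box k (λ h → ψ (Δ h f) t))) ≤ U (suc k) f
  ψ-Box k {f} fb = begin
    pow2 k (avg (λ t → Box k (λ h → ψ (Δ h f) t)))
      ≡⟨ cong (pow2 k) (avg-cong rewrite-t) ⟩
    pow2 k (avg (λ t → V.E {k} (λ h′ → avg (λ z → V.E {k} (λ h → Γ t z h * B t h′ z h)))))
      ≤⟨ M.pow2-jensen k _ ⟩
    avg (λ t → pow2 k (V.E {k} (λ h′ → avg (λ z → V.E {k} (λ h → Γ t z h * B t h′ z h)))))
      ≤⟨ avg-mono (λ t → V.pow2-jensen {k} k _) ⟩
    avg (λ t → V.E {k} (λ h′ → pow2 k (avg (λ z → V.E {k} (λ h → Γ t z h * B t h′ z h)))))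
      ≤⟨ avg-mono (λ t → V.E-mono {k} (λ h′ → M.pow2-jensen k _)) ⟩
    avg (λ t → V.E {k} (λ h′ → avg (λ z → pow2 k (V.E {k} (λ h → Γ t z h * B t h′ z h)))))
      ≤⟨ avg-mono (λ t → V.E-mono {k} (λ h′ → avg-mono (λ z → Box-cs k (Γ t z) (B t h′ z) (Sep-B t h′ z)))) ⟩
    avg (λ t → V.E {k} (λ h′ → avg (λ z → Box k (Γ t z))))
      ≡⟨ avg-cong (λ t → V.E-const {k} _) ⟩
    avg (λ t → avg (λ z → Box k (Γ t z)))
      ≡⟨ avg-cong (λ t → trans (avg-cong (λ z → Box-cong k (λ h → cong (λ y → f (z ⊕ sumV h) * f y) (⊕-swap z t (sumV h)))))
           (sym (U-Box k (f ∙ sh t f)))) ⟩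
    U (suc k) f ∎
    where
    open ≤-Reasoning
    Γ : Carrier → Carrier → Vec Carrier k → ℚ
    Γ t z h = f (z ⊕ sumV h) * f ((z ⊕ t) ⊕ sumV h)
    ψ′ : Carrier → Vec Carrier k → ℚ
    ψ′ t h = ψ (Δ h f) t
    -- What is left once the two top vertices are taken out: a product of bounded factors each of
    -- which omits a coordinate of `h`.
    B : Carrier → Vec Carrier k → Carrier → Vec Carrier k → ℚ
    B t h′ z h = (low h f z * low h f (z ⊕ t)) * residue (ψ′ t) h′ h
    Sep-B : ∀ t h′ z → Sep k (B t h′ z)
    Sep-B t h′ z = Sep-* k (Sep-* k (Sep-low k fb z) (Sep-low k fb (z ⊕ t)))
      (Sep-residue k (ψ′ t) (λ h → Conv-Bd (PD-ψ {Δ h f} (Δ-Bd h {f} fb)) t) h′)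
    pointwise : ∀ t h′ h → ψ′ t h * residue (ψ′ t) h′ h ≡ avg (λ z → Γ t z h * B t h′ z h)
    pointwise t h′ h = trans (sym (M.E-*ʳ _ r)) (avg-cong (λ z → trans
      (cong₂ (λ a b → (a * b) * r) (Δ-top-low h f z) (Δ-top-low h f (z ⊕ t)))
      (solve 5 (λ a b c d r → ((a :* b) :* (c :* d)) :* r := (a :* c) :* ((b :* d) :* r)) refl
        (f (z ⊕ sumV h)) (low h f z) (f ((z ⊕ t) ⊕ sumV h)) (low h f (z ⊕ t)) r)))
      where r = residue (ψ′ t) h′ h
    rewrite-t : ∀ t → Box k (ψ′ t) ≡ V.E {k} (λ h′ → avg (λ z → V.E {k} (λ h → Γ t z h * B t h′ z h)))
    rewrite-t t = trans (Box-residue k (ψ′ t)) (V.E-cong {k} (λ h′ → trans (V.E-cong {k} (pointwise t h′))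
      (sym (meanV-comm k meanF _))))

  module Dual (g : Carrier → Fun) (gb : ∀ y → Bdd (g y)) where
    f : Fun
    f x = avg (λ y → g y x)

    fb : Bdd f
    fb x = M.Bd-E (λ y → gb y x)

    gᵖ : ∀ {k} → Vec Pair k → Carrier → Fun
    gᵖ p y x = Π p (λ h → g y (x ⊕ sumV h))

    Wᵖ : ∀ {k} → Vec Pair k → Fun
    Wᵖ p x = avg (λ y → gᵖ p y x)

    Ψᵖ : ∀ {k} → Vec Pair k → Fun
    Ψᵖ p t = Π p (λ h → ψ (Δ h f) t)

    form : Fun → Fun → ℚ
    form W Ψ = avg (λ x → avg (λ x′ → (W x * W x′) * Ψ (x′ ⊝ x)))

    -- Only the top vertices of the two cubes are expanded as averages over y; the other vertices
    -- omit a coordinate and disappear under `Box-cs`. What survives is again of dual type, since in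
    -- `Wᵖ` all vertices of the box share the same y.
    U-form : ∀ k → pow2 k (U (k ℕ.+ 2) f) ≤ P.E {k} (λ p → form (Wᵖ p) (Ψᵖ p))
    U-form k = begin
      pow2 k (U (k ℕ.+ 2) f)
        ≡⟨ cong (pow2 k) (trans (U-Δ k 2 f) (trans (V.E-cong {k} pointwise) (sym (meanV-comm k m4 _)))) ⟩
      pow2 k (m4.E (λ θ → V.E {k} (λ h → Γ θ h * B θ h)))
        ≤⟨ m4.pow2-jensen k _ ⟩
      m4.E (λ θ → pow2 k (V.E {k} (λ h → Γ θ h * B θ h)))
        ≤⟨ m4.E-mono (λ θ → Box-cs k (Γ θ) (B θ) (Sep-B θ)) ⟩
      m4.E (λ θ → Box k (Γ θ))
        ≡⟨ m4.E-cong (λ θ → Box-Π k (Γ θ)) ⟩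
      m4.E (λ θ → P.E {k} (λ p → Π p (Γ θ)))
        ≡⟨ meanP-comm k m4 _ ⟩
      P.E {k} (λ p → m4.E (λ θ → Π p (Γ θ)))
        ≡⟨ P.E-cong {k} collect ⟩
      P.E {k} (λ p → form (Wᵖ p) (Ψᵖ p)) ∎
      where
      open ≤-Reasoning
      m4 = meanFF ×ᵐ meanFF
      module m4 = Mean m4
      Γ : Pair × Pair → Vec Carrier k → ℚ
      Γ ((x , x′) , (y , y′)) h = (g y (x ⊕ sumV h) * g y′ (x′ ⊕ sumV h)) * ψ (Δ h f) (x′ ⊝ x)
      B : Pair × Pair → Vec Carrier k → ℚ
      B ((x , x′) , _) h = low h f x * low h f x′
      Sep-B : ∀ θ → Sep k (B θ)
      Sep-B ((x , x′) , _) = Sep-* k (Sep-low k fb x) (Sep-low k fb x′)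
      split : ∀ (F G : Fun) c → (avg F * avg G) * c ≡ avg (λ y → avg (λ y′ → (F y * G y′) * c))
      split F G c = trans (cong (_* c) (E-prod meanF meanF F G))
        (trans (sym (M.E-*ʳ _ c)) (avg-cong (λ y → sym (M.E-*ʳ _ c))))
      pointwise : ∀ h → U 2 (Δ h f) ≡ m4.E (λ θ → Γ θ h * B θ h)
      pointwise h = trans (U2 (Δ h f)) (avg-cong (λ x → avg-cong (λ x′ → let c = ψ (Δ h f) (x′ ⊝ x) in trans
        (cong₂ (λ a b → (a * b) * c) (Δ-top-low h f x) (Δ-top-low h f x′))
        (trans (solve 5 (λ a b c d e → ((a :* b) :* (c :* d)) :* e := (a :* c) :* (e :* (b :* d))) refl
            (f (x ⊕ sumV h)) (low h f x) (f (x′ ⊕ sumV h)) (low h f x′) c)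
          (trans (split (λ y → g y (x ⊕ sumV h)) (λ y → g y (x′ ⊕ sumV h)) (c * (low h f x * low h f x′)))
            (avg-cong (λ y → avg-cong (λ y′ → sym (*-assoc (g y (x ⊕ sumV h) * g y′ (x′ ⊕ sumV h)) c (low h f x * low h f x′))))))))))
      collect : ∀ p → m4.E (λ θ → Π p (Γ θ)) ≡ form (Wᵖ p) (Ψᵖ p)
      collect p = avg-cong (λ x → avg-cong (λ x′ → trans
        (avg-cong (λ y → avg-cong (λ y′ → trans (Π-* p _ _) (cong (_* Ψᵖ p (x′ ⊝ x)) (Π-* p _ _)))))
        (sym (split (λ y → gᵖ p y x) (λ y → gᵖ p y x′) (Ψᵖ p (x′ ⊝ x))))))

    Wᵖ-Bd : ∀ {k} (p : Vec Pair k) → Bdd (Wᵖ p)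
    Wᵖ-Bd p x = M.Bd-E (λ y → Π-Bd p _ (λ h → gb y (x ⊕ sumV h)))

    err : Fun → Fun → ℚ
    err W Ψ = form W Ψ - (avg W * avg W) * avg Ψ

    -- The input from the induction on slots: as far as `form` can tell, each `Wᵖ` may be replaced
    -- by its mean.
    Decorrelated : ℕ → ℚ → Set
    Decorrelated N C = ∀ {k} (p : Vec Pair k) Ψ → PD Ψ → pow2 N (err (Wᵖ p) Ψ * err (Wᵖ p) Ψ) ≤ C * ε

    -- Up to `err` the form is (avg W)² avg Ψ, and positivity of avg Ψ allows (avg W)² to be
    -- replaced by 1. The averages of Ψ that remain assemble to the box norms in `ψ-Box`, hence to
    -- the next lower norm.
    U-lower : ∀ k N C → 0ℚ ≤ C → Decorrelated N C →
      pow2 ((k ℕ.+ suc N) ℕ.+ k) (U (k ℕ.+ 2) f) ≤ domC k (K (suc N) * (C + 1ℚ)) 1ℚ * (U (suc k) f + ε)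
    U-lower k N C 0≤C dec = dom-trans 0≤ε ε≤1 (k ℕ.+ suc N) k
      (*-nn (K≥0 (suc N)) (+-nn 0≤C 0≤1)) 0≤1 x≥0 (sq-nn) (U≥0 k f) first second
      where
      open ≤-Reasoning
      x = U (k ℕ.+ 2) f
      x≥0 : 0ℚ ≤ x
      x≥0 = subst (λ n → 0ℚ ≤ U n f) (ℕP.+-comm 2 k) (U≥0 (suc k) f)
      e : Vec Pair k → ℚ
      e p = err (Wᵖ p) (Ψᵖ p)
      s = P.E {k} e
      r = avg (λ t → Box k (λ h → ψ (Δ h f) t))
      PD-Ψ : ∀ (p : Vec Pair k) → PD (Ψᵖ p)
      PD-Ψ p = Conv-Π PD-∙ p (λ h → ψ (Δ h f)) (λ h → PD-ψ {Δ h f} (Δ-Bd h {f} fb))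
      r-eq : r ≡ P.E {k} (λ p → avg (Ψᵖ p))
      r-eq = trans (avg-cong (λ t → Box-Π k _)) (meanP-comm k meanF _)
      r≥0 : 0ℚ ≤ r
      r≥0 = subst (0ℚ ≤_) (sym r-eq) (P.E-nn {k} (λ p → PD-avg≥0 (PD-Ψ p)))
      r≤1 : r ≤ 1ℚ
      r≤1 = subst (_≤ 1ℚ) (sym r-eq) (P.E-≤const {k} (λ p → Bd⇒≤1 (M.Bd-E (Conv-Bd (PD-Ψ p)))))
      sq-nn : 0ℚ ≤ pow2 (suc N) r
      sq-nn = pow2-nn (suc N) r≥0
      x≤ : pow2 k x ≤ s + r
      x≤ = begin
        pow2 k x                                        ≤⟨ U-form k ⟩
        P.E {k} (λ p → form (Wᵖ p) (Ψᵖ p))              ≤⟨ P.E-mono {k} each ⟩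
        P.E {k} (λ p → e p + avg (Ψᵖ p))                ≡⟨ P.E-+ {k} e (λ p → avg (Ψᵖ p)) ⟩
        s + P.E {k} (λ p → avg (Ψᵖ p))                  ≡⟨ cong (s +_) (sym r-eq) ⟩
        s + r ∎
        where
        each : ∀ p → form (Wᵖ p) (Ψᵖ p) ≤ e p + avg (Ψᵖ p)
        each p = ≤-by (*-nn (≤⇒0≤- (M.Bd-E (Wᵖ-Bd p))) (PD-avg≥0 (PD-Ψ p)))
          (solve 3 (λ F w z → (F :- (w :* w) :* z) :+ z := F :+ (con 1ℚ :- w :* w) :* z) refl
            (form (Wᵖ p) (Ψᵖ p)) (avg (Wᵖ p)) (avg (Ψᵖ p)))
      s-small : pow2 N (s * s) ≤ C * ε
      s-small = begin
        pow2 N (s * s)                        ≤⟨ pow2-mono N (sq≥0 s) (P.jensen {k} e) ⟩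
        pow2 N (P.E {k} (λ p → e p * e p))    ≤⟨ P.pow2-jensen {k} N _ ⟩
        P.E {k} (λ p → pow2 N (e p * e p))    ≤⟨ P.E-≤const {k} (λ p → dec p (Ψᵖ p) (PD-Ψ p)) ⟩
        C * ε ∎
      first : pow2 (k ℕ.+ suc N) x ≤ (K (suc N) * (C + 1ℚ)) * (pow2 (suc N) r + ε)
      first = begin
        pow2 (k ℕ.+ suc N) x                        ≡⟨ sym (pow2-pow2 (suc N) k x) ⟩
        pow2 (suc N) (pow2 k x)                     ≤⟨ pow2-mono (suc N) (pow2-nn k x≥0) x≤ ⟩
        pow2 (suc N) (s + r)                        ≤⟨ pow2-suc-+ N s r ⟩
        K (suc N) * (pow2 (suc N) s + pow2 (suc N) r)
          ≤⟨ *-monoL (K≥0 (suc N)) (+-monoˡ-≤ (pow2 (suc N) r) s-small) ⟩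
        K (suc N) * (C * ε + pow2 (suc N) r)
          ≤⟨ *-monoL (K≥0 (suc N)) (≤-by (+-nn (*-nn 0≤C sq-nn) 0≤ε)
               (solve 3 (λ c e y → (c :+ con 1ℚ) :* (y :+ e) := (c :* e :+ y) :+ (c :* y :+ e)) refl C ε (pow2 (suc N) r))) ⟩
        K (suc N) * ((C + 1ℚ) * (pow2 (suc N) r + ε)) ≡⟨ sym (*-assoc (K (suc N)) (C + 1ℚ) _) ⟩
        (K (suc N) * (C + 1ℚ)) * (pow2 (suc N) r + ε) ∎
      -- The `suc N` extra squarings only decrease a number in [0, 1]; they are present because `s`
      -- is controlled only after as many.
      second : pow2 k (pow2 (suc N) r) ≤ 1ℚ * (U (suc k) f + ε)
      second = begin
        pow2 k (pow2 (suc N) r)    ≡⟨ trans (pow2-pow2 k (suc N) r) (trans (cong (λ n → pow2 n r) (ℕP.+-comm (suc N) k)) (sym (pow2-pow2 (suc N) k r))) ⟩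
        pow2 (suc N) (pow2 k r)    ≤⟨ pow2≤id (suc N) (pow2-nn k r≥0) (pow2≤1 k (0≤≤1⇒Bd r≥0 r≤1)) ⟩
        pow2 k r                   ≤⟨ ψ-Box k fb ⟩
        U (suc k) f                ≤⟨ ≤-by 0≤ε (*-identityˡ _) ⟩
        1ℚ * (U (suc k) f + ε) ∎

-- Stated outside the modules over `F`, since the exponent and the constant have to be fixed before
-- the field.
degree-lowering : ∀ N C → 0ℚ ≤ C → ∀ k → Σ ℕ λ M → Σ ℚ λ C′ → 0ℚ ≤ C′ ×
  (∀ F → let open Field F in let open Norms F in ∀ g gb → let open Dual g gb in Decorrelated N C → pow2 M (U (suc k) f) ≤ C′ * (U 1 f + ε))
degree-lowering N C 0≤C zero = 0 , 1ℚ , 0≤1 , λ F g gb _ →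
  ≤-by (Field.0≤ε F) (*-identityˡ _)
degree-lowering N C 0≤C (suc k) with degree-lowering N C 0≤C k
... | M , C′ , 0≤C′ , ih = (stepN k) ℕ.+ M , domC M C₁ C′ , domC≥0 M 0≤C₁ 0≤C′ , λ F g gb dec →
  let open Field F in let open Norms F in let open Dual g gb in
  dom-trans 0≤ε ε≤1 (stepN k) M 0≤C₁ 0≤C′ (U≥0 (suc k) f) (U≥0 k f) (U1≥0 f)
    (subst (λ n → pow2 (stepN k) (U n f) ≤ C₁ * (U (suc k) f + ε)) (ℕP.+-comm k 2) (U-lower k N C 0≤C dec)) (ih F g gb dec)
  where
  stepN : ℕ → ℕ
  stepN k = (k ℕ.+ suc N) ℕ.+ k
  C₁ = domC k (K (suc N) * (C + 1ℚ)) 1ℚ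
  0≤C₁ : 0ℚ ≤ C₁
  0≤C₁ = domC≥0 k (*-nn (K≥0 (suc N)) (+-nn 0≤C 0≤1)) 0≤1

natℚ-mono : ∀ {m n} → m ℕ.≤ n → natℚ m ≤ natℚ n
natℚ-mono {n = n} z≤n = natℚ≥0 n
natℚ-mono (s≤s p) = +-monoʳ-≤ 1ℚ (natℚ-mono p)

-- PET induction

module Polynomials (F : FiniteField) where
  open Field F

  0⊕h0 : ∀ h → 0F ⊕ h ⊗ 0F ≡ 0F
  0⊕h0 h = trans (⊕-identityˡ _) (⊗-zeroʳ h)

  ⊝-injective : ∀ {a b} c → a ⊝ c ≡ b ⊝ c → a ≡ b
  ⊝-injective {a} {b} c e = trans (S.solve 2 (λ a c → a S.:= (a S.:- c) S.:+ c) refl a c)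
    (trans (cong (_⊕ c) e) (S.solve 2 (λ b c → (b S.:- c) S.:+ c S.:= b) refl b c))

  ⊝-self : ∀ a → a ⊝ a ≡ 0F
  ⊝-self a = S.solve 1 (λ a → a S.:- a S.:= S.con (ℤ.+ 0)) refl a

  ⊝≢0 : ∀ {a b} → a ≢ b → a ⊝ b ≢ 0F
  ⊝≢0 {a} {b} a≢b e = a≢b (⊝-injective b (trans e (sym (⊝-self b))))

  ⊗≢0 : ∀ {a b} → a ≢ 0F → b ≢ 0F → a ⊗ b ≢ 0F
  ⊗≢0 {a} {b} p q e = q (trans (S.solve 1 (λ b → b S.:= S.con (ℤ.+ 1) S.:* b) refl b)
    (trans (cong (_⊗ b) (sym (trans (⊗-comm a⁻¹ a) (proj₂ (F-inverse a p)))))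
      (trans (S.solve 3 (λ i a b → (i S.:* a) S.:* b S.:= i S.:* (a S.:* b)) refl a⁻¹ a b) (trans (cong (a⁻¹ ⊗_) e) (⊗-zeroʳ _)))))
    where a⁻¹ = proj₁ (F-inverse a p)

  Poly : ℕ → Set
  Poly = Vec Carrier

  cf : ∀ {n} → Poly n → ℕ → Carrier
  cf [] _ = 0F
  cf (a ∷ p) zero = a
  cf (a ∷ p) (suc j) = cf p j

  ev : ∀ {n} → Poly n → Carrier → Carrier
  ev [] y = 0F
  ev (a ∷ p) y = a ⊕ y ⊗ ev p y

  pw : ℕ → Carrier → Carrier
  pw zero y = 1F
  pw (suc e) y = y ⊗ pw e y

  -- the coefficients of a + (y + h) s(y)
  mul : ∀ {n} → Carrier → Carrier → Poly n → Poly (suc n)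
  mul a h [] = a ∷ []
  mul a h (s₀ ∷ s) = (a ⊕ h ⊗ s₀) ∷ mul s₀ h s

  -- the coefficients of p(y + h)
  tr : ∀ {n} → Carrier → Poly n → Poly n
  tr h [] = []
  tr h (a ∷ p) = mul a h (tr h p)

  -- the coefficients of p(y) - c y^e (for e below the length of p)
  sub : ∀ {n} → ℕ → Carrier → Poly n → Poly n
  sub e c [] = []
  sub zero c (a ∷ p) = (a ⊝ c) ∷ p
  sub (suc e) c (a ∷ p) = a ∷ sub e c p

  ev-mul : ∀ {n} a h (s : Poly n) y → ev (mul a h s) y ≡ a ⊕ (y ⊕ h) ⊗ ev s y
  ev-mul a h [] y = S.solve 3 (λ a h y → a S.:+ y S.:* S.con (ℤ.+ 0) S.:= a S.:+ (y S.:+ h) S.:* S.con (ℤ.+ 0)) refl a h y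
  ev-mul a h (s₀ ∷ s) y = trans (cong (λ z → (a ⊕ h ⊗ s₀) ⊕ y ⊗ z) (ev-mul s₀ h s y))
    (S.solve 5 (λ a h s y z → (a S.:+ h S.:* s) S.:+ y S.:* (s S.:+ (y S.:+ h) S.:* z) S.:= a S.:+ (y S.:+ h) S.:* (s S.:+ y S.:* z)) refl a h s₀ y (ev s y))

  ev-tr : ∀ {n} h (p : Poly n) y → ev (tr h p) y ≡ ev p (y ⊕ h)
  ev-tr h [] y = refl
  ev-tr h (a ∷ p) y = trans (ev-mul a h (tr h p) y) (cong (λ z → a ⊕ (y ⊕ h) ⊗ z) (ev-tr h p y))

  ev-sub : ∀ {n} e c (p : Poly n) y → e ℕ.< n → ev (sub e c p) y ≡ ev p y ⊝ c ⊗ pw e y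
  ev-sub zero c (a ∷ p) y _ = S.solve 4 (λ a c y z → (a S.:- c) S.:+ y S.:* z S.:= (a S.:+ y S.:* z) S.:- c S.:* S.con (ℤ.+ 1)) refl a c y (ev p y)
  ev-sub (suc e) c (a ∷ p) y (s≤s l) = trans (cong (λ z → a ⊕ y ⊗ z) (ev-sub e c p y l))
    (S.solve 5 (λ a c y z w → a S.:+ y S.:* (z S.:- c S.:* w) S.:= (a S.:+ y S.:* z) S.:- c S.:* (y S.:* w)) refl a c y (ev p y) (pw e y))

  cf-mul-suc : ∀ {n} a h (s : Poly n) j → cf (mul a h s) (suc j) ≡ cf s j ⊕ h ⊗ cf s (suc j)
  cf-mul-zero : ∀ {n} a h (s : Poly n) → cf (mul a h s) zero ≡ a ⊕ h ⊗ cf s zero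
  cf-mul-zero a h [] = sym (trans (cong (a ⊕_) (⊗-zeroʳ h)) (⊕-identityʳ a))
  cf-mul-zero a h (x ∷ s) = refl
  cf-mul-suc a h [] j = sym (0⊕h0 h)
  cf-mul-suc a h (s₀ ∷ s) zero = cf-mul-zero s₀ h s
  cf-mul-suc a h (s₀ ∷ s) (suc j) = cf-mul-suc s₀ h s j

  cf-sub-at : ∀ {n} e c (p : Poly n) → e ℕ.< n → cf (sub e c p) e ≡ cf p e ⊝ c
  cf-sub-at zero c (a ∷ p) _ = refl
  cf-sub-at (suc e) c (a ∷ p) (s≤s l) = cf-sub-at e c p l

  cf-sub-off : ∀ {n} e c (p : Poly n) i → i ≢ e → cf (sub e c p) i ≡ cf p i
  cf-sub-off e c [] i _ = refl
  cf-sub-off zero c (a ∷ p) zero ne = ⊥-elim (ne refl)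
  cf-sub-off zero c (a ∷ p) (suc i) ne = refl
  cf-sub-off (suc e) c (a ∷ p) zero ne = refl
  cf-sub-off (suc e) c (a ∷ p) (suc i) ne = cf-sub-off e c p i (λ q → ne (cong suc q))

  sub-injective : ∀ {n} e c (p r : Poly n) i → cf (sub e c p) i ≡ cf (sub e c r) i → cf p i ≡ cf r i
  sub-injective e c [] [] i q = refl
  sub-injective zero c (a ∷ p) (b ∷ r) zero q = ⊝-injective c q
  sub-injective zero c (a ∷ p) (b ∷ r) (suc i) q = q
  sub-injective (suc e) c (a ∷ p) (b ∷ r) zero q = q
  sub-injective (suc e) c (a ∷ p) (b ∷ r) (suc i) q = sub-injective e c p r i q

  -- Zero above `e`: degree at most `e`, with no claim about the leading coefficient.
  Zab : ∀ {n} → ℕ → Poly n → Set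
  Zab e p = ∀ i → e ℕ.< i → cf p i ≡ 0F

  tr-zero : ∀ {n} h (p : Poly n) → (∀ i → cf p i ≡ 0F) → ∀ i → cf (tr h p) i ≡ 0F
  tr-zero h [] z i = refl
  tr-zero h (a ∷ p) z zero = trans (cf-mul-zero a h (tr h p))
    (trans (cong₂ (λ u v → u ⊕ h ⊗ v) (z 0) (tr-zero h p (λ i → z (suc i)) 0)) (0⊕h0 h))
  tr-zero h (a ∷ p) z (suc i) = trans (cf-mul-suc a h (tr h p) i)
    (trans (cong₂ (λ u v → u ⊕ h ⊗ v) (tr-zero h p (λ i → z (suc i)) i) (tr-zero h p (λ i → z (suc i)) (suc i))) (0⊕h0 h))

  tr-top : ∀ {n} h (p : Poly n) j → Zab j p → Zab j (tr h p) × cf (tr h p) j ≡ cf p j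
  tr-top h [] j z = (λ _ _ → refl) , refl
  tr-top h (a ∷ p) zero z = (λ { (suc i) _ → trans (cf-mul-suc a h (tr h p) i) (trans (cong₂ (λ u v → u ⊕ h ⊗ v) (zs i) (zs (suc i))) (0⊕h0 h)) }) ,
    trans (cf-mul-zero a h (tr h p)) (trans (cong (λ v → a ⊕ h ⊗ v) (zs 0)) (trans (cong (a ⊕_) (⊗-zeroʳ h)) (⊕-identityʳ a)))
    where
    zs : ∀ i → cf (tr h p) i ≡ 0F
    zs = tr-zero h p (λ i → z (suc i) (s≤s z≤n))
  tr-top h (a ∷ p) (suc j) z = (λ { (suc i) (s≤s l) → trans (cf-mul-suc a h (tr h p) i)
      (trans (cong₂ (λ u v → u ⊕ h ⊗ v) (proj₁ ih i l) (proj₁ ih (suc i) (ℕP.m<n⇒m<1+n l))) (0⊕h0 h)) }) ,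
    trans (cf-mul-suc a h (tr h p) j) (trans (cong₂ (λ u v → u ⊕ h ⊗ v) (proj₂ ih) (proj₁ ih (suc j) ℕP.≤-refl))
      (trans (cong (cf p j ⊕_) (⊗-zeroʳ h)) (⊕-identityʳ _)))
    where ih = tr-top h p j (λ i l → z (suc i) (s≤s l))

  -- The source of distinctness: just below the top, translation moves the coefficient affinely in
  -- `h`. In large characteristic and with nonzero leading coefficient the slope is nonzero, so each
  -- forbidden value excludes a single `h`.
  tr-second : ∀ {n} h (p : Poly n) j → Zab (suc j) p → cf (tr h p) j ≡ cf p j ⊕ natF F (suc j) ⊗ (h ⊗ cf p (suc j))
  tr-second h [] j z = S.solve 2 (λ n h → S.con (ℤ.+ 0) S.:= S.con (ℤ.+ 0) S.:+ n S.:* (h S.:* S.con (ℤ.+ 0))) refl (natF F (suc j)) h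
  tr-second h (a ∷ p) zero z = trans (cf-mul-zero a h (tr h p)) (trans (cong (λ v → a ⊕ h ⊗ v) (proj₂ (tr-top h p 0 (λ i l → z (suc i) (s≤s l)))))
    (S.solve 3 (λ a h v → a S.:+ h S.:* v S.:= a S.:+ (S.con (ℤ.+ 1) S.:+ S.con (ℤ.+ 0)) S.:* (h S.:* v)) refl a h (cf p 0)))
  tr-second h (a ∷ p) (suc j) z = trans (cf-mul-suc a h (tr h p) j) (trans
    (cong₂ (λ u v → u ⊕ h ⊗ v) (tr-second h p j z′) (proj₂ (tr-top h p (suc j) z′)))
    (S.solve 4 (λ c n h v → (c S.:+ n S.:* (h S.:* v)) S.:+ h S.:* v S.:= c S.:+ (S.con (ℤ.+ 1) S.:+ n) S.:* (h S.:* v)) refl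
      (cf p j) (natF F (suc j)) h (cf p (suc j))))
    where
    z′ : Zab (suc j) p
    z′ i l = z (suc i) (s≤s l)

  -- The difference is not constant. This is the distinctness that PET induction preserves, as a
  -- constant difference merely translates a function.
  NC : ∀ {n} → Poly n → Poly n → Set
  NC p r = ¬ (∀ j → cf p (suc j) ≡ cf r (suc j))

  -- Descending from the top coefficient, each equation determines the next lower entry.
  ladder-injective : ∀ {n} h (s t : Poly n) → (∀ j → cf s j ⊕ h ⊗ cf s (suc j) ≡ cf t j ⊕ h ⊗ cf t (suc j)) → ∀ j → cf s j ≡ cf t j
  ladder-injective h [] [] e j = refl
  ladder-injective h (a ∷ s) (b ∷ t) e = λ { zero → a≡b ; (suc j) → ih j }
    where
    ih = ladder-injective h s t (λ j → e (suc j))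
    a≡b : a ≡ b
    a≡b = trans (S.solve 2 (λ a c → a S.:= (a S.:+ c) S.:- c) refl a (h ⊗ cf s 0))
      (trans (cong₂ _⊝_ (e 0) (cong (h ⊗_) (ih 0))) (S.solve 2 (λ b c → (b S.:+ c) S.:- c S.:= b) refl b (h ⊗ cf t 0)))

  tr-injective : ∀ {n} h (p r : Poly n) → (∀ j → cf (tr h p) j ≡ cf (tr h r) j) → ∀ j → cf p j ≡ cf r j
  tr-tail-injective : ∀ {n} h (p r : Poly n) → (∀ j → cf (tr h p) (suc j) ≡ cf (tr h r) (suc j)) → ∀ j → cf p (suc j) ≡ cf r (suc j)
  tr-tail-injective h [] [] e j = refl
  tr-tail-injective h (a ∷ p) (b ∷ r) e = tr-injective h p r (ladder-injective h (tr h p) (tr h r)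
    (λ j → trans (sym (cf-mul-suc a h (tr h p) j)) (trans (e j) (cf-mul-suc b h (tr h r) j))))
  tr-injective h [] [] e j = refl
  tr-injective h (a ∷ p) (b ∷ r) e (suc j) = tr-tail-injective h (a ∷ p) (b ∷ r) (λ j → e (suc j)) j
  tr-injective h (a ∷ p) (b ∷ r) e zero = trans (S.solve 2 (λ a c → a S.:= (a S.:+ c) S.:- c) refl a (h ⊗ cf s 0))
      (trans (cong₂ _⊝_ (trans (sym (cf-mul-zero a h s)) (trans (e 0) (cf-mul-zero b h t))) (cong (h ⊗_) s≡t))
        (S.solve 2 (λ b c → (b S.:+ c) S.:- c S.:= b) refl b (h ⊗ cf t 0)))
    where
    s = tr h p
    t = tr h r
    s≡t : cf s 0 ≡ cf t 0
    s≡t = ladder-injective h s t (λ j → trans (sym (cf-mul-suc a h s j)) (trans (e (suc j)) (cf-mul-suc b h t j))) 0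

  NC-tr : ∀ {n} h (p r : Poly n) → NC p r → NC (tr h p) (tr h r)
  NC-tr h p r nc e = nc (tr-tail-injective h p r e)

  NC-sub : ∀ {n} e c (p r : Poly n) → NC p r → NC (sub e c p) (sub e c r)
  NC-sub e c p r nc q = nc (λ j → sub-injective e c p r (suc j) (q j))

  ev-const : ∀ {n} (p : Poly n) → Zab 0 p → ∀ y → ev p y ≡ cf p 0
  ev-zero : ∀ {n} (p : Poly n) → (∀ i → cf p i ≡ 0F) → ∀ y → ev p y ≡ 0F
  ev-zero [] z y = refl
  ev-zero (a ∷ p) z y = trans (cong₂ (λ u v → u ⊕ y ⊗ v) (z 0) (ev-zero p (λ i → z (suc i)) y)) (0⊕h0 y)
  ev-const [] z y = refl
  ev-const (a ∷ p) z y = trans (cong (λ v → a ⊕ y ⊗ v) (ev-zero p (λ i → z (suc i) (s≤s z≤n)) y))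
    (trans (cong (a ⊕_) (⊗-zeroʳ y)) (⊕-identityʳ a))

  ev-linear : ∀ {n} (p : Poly n) → Zab 1 p → ∀ y → ev p y ≡ cf p 0 ⊕ cf p 1 ⊗ y
  ev-linear [] z y = S.solve 1 (λ y → S.con (ℤ.+ 0) S.:= S.con (ℤ.+ 0) S.:+ S.con (ℤ.+ 0) S.:* y) refl y
  ev-linear (a ∷ p) z y = cong (a ⊕_) (trans (cong (y ⊗_) (ev-const p (λ i l → z (suc i) (s≤s l)) y)) (⊗-comm y _))

  Zab-sub : ∀ {n} e c (p : Poly n) j → e ℕ.≤ j → Zab j p → Zab j (sub e c p)
  Zab-sub e c p j e≤j z i l = trans (cf-sub-off e c p i (λ { refl → ℕP.<-irrefl refl (ℕP.<-≤-trans l e≤j) })) (z i l)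

  Zab-lower : ∀ {n} e c (p : Poly n) → suc e ℕ.< n → Zab (suc e) p → cf p (suc e) ≡ c → Zab e (sub (suc e) c p)
  Zab-lower e c p l z q i e<i with i ℕP.≟ suc e
  ... | yes refl = trans (cf-sub-at (suc e) c p l) (trans (cong (_⊝ c) q) (⊝-self c))
  ... | no i≢ = trans (cf-sub-off (suc e) c p i i≢) (z i (ℕP.≤∧≢⇒< e<i (λ r → i≢ (sym r))))

-- Systems of polynomials and van der Corput differencing

module Systems (F : FiniteField) (T : ℕ) where
  open Field F
  open Norms F
  open Polynomials F

  Item : Set
  Item = Poly T × Fun

  prodI : List Item → Carrier → Carrier → ℚ
  prodI [] x y = 1ℚ
  prodI ((R , f) ∷ is) x y = f (x ⊕ ev R y) * prodI is x y

  BddI : List Item → Set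
  BddI = All (λ it → Bdd (proj₂ it))

  prodI-Bd : ∀ {is} → BddI is → ∀ x y → Bd (prodI is x y)
  prodI-Bd [] x y = Bd-1
  prodI-Bd {(R , f) ∷ is} (b ∷ bs) x y = Bd-* {f (x ⊕ ev R y)} (b _) (prodI-Bd bs x y)

  Λ : Fun → Poly T → Fun → List Item → ℚ
  Λ f₀ P f is = avg (λ x → avg (λ y → f₀ x * (f (x ⊕ ev P y) * prodI is x y)))

  Λ-Bd : ∀ {f₀ f is} P → Bdd f₀ → Bdd f → BddI is → Bd (Λ f₀ P f is)
  Λ-Bd {f₀} {f} P b c d = M.Bd-E (λ x → M.Bd-E (λ y → Bd-* {f₀ x} (b x) (Bd-* {f (x ⊕ ev P y)} (c _) (prodI-Bd d x y))))

  -- Cauchy-Schwarz in x discards `f₀`. For fixed y and h the average over x is then free to be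
  -- translated by Q(y), which subtracts Q from every polynomial at once.
  van-der-Corput : ∀ (f₀ : Fun) (w : Carrier → Carrier → ℚ) (Q : Carrier → Carrier) → Bdd f₀ →
    avg (λ x → avg (λ y → f₀ x * w x y)) * avg (λ x → avg (λ y → f₀ x * w x y)) ≤
    avg (λ h → avg (λ x → avg (λ y → w (x ⊝ Q y) y * w (x ⊝ Q y) (y ⊕ h))))
  van-der-Corput f₀ w Q b = begin
    X * X                                                       ≡⟨ cong₂ _*_ X-eq X-eq ⟩
    avg (λ x → f₀ x * avg (w x)) * avg (λ x → f₀ x * avg (w x)) ≤⟨ M.cs f₀ (λ x → avg (w x)) b ⟩
    avg (λ x → avg (w x) * avg (w x))                           ≡⟨ avg-cong (λ x → E-prod meanF meanF (w x) (w x)) ⟩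
    avg (λ x → avg (λ y → avg (λ y′ → w x y * w x y′)))         ≡⟨ avg-cong (λ x → avg-cong (λ y → sym (avg-shiftˡ y _))) ⟩
    avg (λ x → avg (λ y → avg (λ h → w x y * w x (y ⊕ h))))     ≡⟨ avg-cong (λ x → avg-fubini meanF _) ⟩
    avg (λ x → avg (λ h → avg (λ y → w x y * w x (y ⊕ h))))     ≡⟨ avg-fubini meanF _ ⟩
    avg (λ h → avg (λ x → avg (λ y → w x y * w x (y ⊕ h))))     ≡⟨ avg-cong (λ h → avg-fubini meanF _) ⟩
    avg (λ h → avg (λ y → avg (λ x → w x y * w x (y ⊕ h))))
      ≡⟨ avg-cong (λ h → avg-cong (λ y → sym (avg-shift (⊖ (Q y)) (λ x → w x y * w x (y ⊕ h))))) ⟩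
    avg (λ h → avg (λ y → avg (λ x → w (x ⊝ Q y) y * w (x ⊝ Q y) (y ⊕ h)))) ≡⟨ avg-cong (λ h → avg-fubini meanF _) ⟩
    avg (λ h → avg (λ x → avg (λ y → w (x ⊝ Q y) y * w (x ⊝ Q y) (y ⊕ h)))) ∎
    where
    open ≤-Reasoning
    X = avg (λ x → avg (λ y → f₀ x * w x y))
    X-eq : X ≡ avg (λ x → f₀ x * avg (w x))
    X-eq = avg-cong (λ x → avg-* (f₀ x) (w x))

  double : ℕ → Carrier → Carrier → List Item → List Item
  double e c h [] = []
  double e c h ((R , f) ∷ is) = (sub e c R , f) ∷ (sub e c (tr h R) , f) ∷ double e c h is

  length-double : ∀ e c h is → length (double e c h is) ≡ length is ℕ.+ length is
  length-double e c h [] = refl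
  length-double e c h (_ ∷ is) = cong suc (trans (cong suc (length-double e c h is)) (sym (ℕP.+-suc (length is) (length is))))

  module Recentre (e : ℕ) (c : Carrier) (e<T : e ℕ.< T) where
    Q : Carrier → Carrier
    Q y = c ⊗ pw e y

    at-sub : ∀ R x y → (x ⊝ Q y) ⊕ ev R y ≡ x ⊕ ev (sub e c R) y
    at-sub R x y = trans (S.solve 3 (λ x q r → (x S.:- q) S.:+ r S.:= x S.:+ (r S.:- q)) refl x (Q y) (ev R y))
      (cong (x ⊕_) (sym (ev-sub e c R y e<T)))

    at-sub-tr : ∀ R h x y → (x ⊝ Q y) ⊕ ev R (y ⊕ h) ≡ x ⊕ ev (sub e c (tr h R)) y
    at-sub-tr R h x y = trans (cong ((x ⊝ Q y) ⊕_) (sym (ev-tr h R y))) (at-sub (tr h R) x y)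

    prodI-double : ∀ h is x y → prodI is (x ⊝ Q y) y * prodI is (x ⊝ Q y) (y ⊕ h) ≡ prodI (double e c h is) x y
    prodI-double h [] x y = *-identityʳ 1ℚ
    prodI-double h ((R , f) ∷ is) x y = trans
      (cong₂ (λ s t → (f s * prodI is (x ⊝ Q y) y) * (f t * prodI is (x ⊝ Q y) (y ⊕ h))) (at-sub R x y) (at-sub-tr R h x y))
      (trans (solve 4 (λ a b c d → (a :* b) :* (c :* d) := a :* (c :* (b :* d))) refl
          (f (x ⊕ ev (sub e c R) y)) (prodI is (x ⊝ Q y) y) (f (x ⊕ ev (sub e c (tr h R)) y)) (prodI is (x ⊝ Q y) (y ⊕ h)))
        (cong (λ z → f (x ⊕ ev (sub e c R) y) * (f (x ⊕ ev (sub e c (tr h R)) y) * z)) (prodI-double h is x y)))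

    -- The translated copy of `f` stays distinguished and its untranslated copy becomes one more
    -- item; both hold the same function, so the final bound still refers to `f`.
    next : Poly T → Fun → Carrier → List Item → List Item
    next P f h is = (sub e c P , f) ∷ double e c h is

    Λ-step : ∀ f₀ P f is → Bdd f₀ → Λ f₀ P f is * Λ f₀ P f is ≤
      avg (λ h → Λ (λ _ → 1ℚ) (sub e c (tr h P)) f (next P f h is))
    Λ-step f₀ P f is b = ≤-trans (van-der-Corput f₀ (λ x y → f (x ⊕ ev P y) * prodI is x y) Q b)
      (≤-reflexive (avg-cong (λ h → avg-cong (λ x → avg-cong (λ y → trans
        (cong₂ (λ s t → (f s * prodI is (x ⊝ Q y) y) * (f t * prodI is (x ⊝ Q y) (y ⊕ h))) (at-sub P x y) (at-sub-tr P h x y))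
        (trans (solve 4 (λ a b c d → (a :* b) :* (c :* d) := con 1ℚ :* (c :* (a :* (b :* d)))) refl
            (f (x ⊕ ev (sub e c P) y)) (prodI is (x ⊝ Q y) y) (f (x ⊕ ev (sub e c (tr h P)) y)) (prodI is (x ⊝ Q y) (y ⊕ h)))
          (cong (λ z → 1ℚ * (f (x ⊕ ev (sub e c (tr h P)) y) * (f (x ⊕ ev (sub e c P) y) * z))) (prodI-double h is x y))))))))

  All-double : ∀ {P Q : Item → Set} e c h → (∀ R f → P (R , f) → Q (sub e c R , f) × Q (sub e c (tr h R) , f)) →
    ∀ {is} → All P is → All Q (double e c h is)
  All-double e c h t [] = []
  All-double e c h t (_∷_ {R , f} p ps) = proj₁ (t R f p) ∷ proj₂ (t R f p) ∷ All-double e c h t ps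

  -- Items with constant polynomials only multiply the function at the base point.
  record Absorbed (X : Item → Set) (f₀ : Fun) (is : List Item) : Set where
    field
      g₀   : Fun
      js   : List Item
      g₀-Bd : Bdd g₀
      js-Bd : BddI js
      js-X : All X js
      js-length : length js ℕ.≤ length is
      same : ∀ x y z → f₀ x * (z * prodI is x y) ≡ g₀ x * (z * prodI js x y)

  absorb : ∀ {X : Item → Set} {f₀ is} → Bdd f₀ → BddI is → All (λ it → X it ⊎ Zab 0 (proj₁ it)) is → Absorbed X f₀ is
  absorb {f₀ = f₀} b [] [] = record { g₀ = f₀ ; js = [] ; g₀-Bd = b ; js-Bd = [] ; js-X = [] ; js-length = z≤n ; same = λ _ _ _ → refl }
  absorb {X} {f₀} {(R , f) ∷ is} b (c ∷ cs) (inj₁ p ∷ ps) = record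
    { g₀ = A.g₀ ; js = (R , f) ∷ A.js ; g₀-Bd = A.g₀-Bd ; js-Bd = c ∷ A.js-Bd ; js-X = p ∷ A.js-X ; js-length = s≤s A.js-length
    ; same = λ x y z → let r = f (x ⊕ ev R y) in
        trans (cong (f₀ x *_) (sym (*-assoc z r _))) (trans (A.same x y (z * r)) (cong (A.g₀ x *_) (*-assoc z r _))) }
    where module A = Absorbed (absorb {X} {f₀} b cs ps)
  absorb {X} {f₀} {(R , f) ∷ is} b (c ∷ cs) (inj₂ z₀ ∷ ps) = record
    { g₀ = A.g₀ ; js = A.js ; g₀-Bd = A.g₀-Bd ; js-Bd = A.js-Bd ; js-X = A.js-X ; js-length = ℕP.m≤n⇒m≤1+n A.js-length
    ; same = λ x y z → trans (cong (λ r → f₀ x * (z * (f (x ⊕ r) * prodI is x y))) (ev-const R z₀ y))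
        (trans (solve 4 (λ a z r p → a :* (z :* (r :* p)) := (a :* r) :* (z :* p)) refl (f₀ x) z (f (x ⊕ cf R 0)) (prodI is x y))
          (A.same x y z)) }
    where
    module A = Absorbed (absorb {X} {λ x → f₀ x * f (x ⊕ cf R 0)} (λ x → Bd-* {f₀ x} (b x) (c _)) cs ps)

  Λ-absorbed : ∀ {X f₀ is} (a : Absorbed X f₀ is) P f → Λ f₀ P f is ≡ Λ (Absorbed.g₀ a) P f (Absorbed.js a)
  Λ-absorbed a P f = avg-cong (λ x → avg-cong (λ y → Absorbed.same a x y (f (x ⊕ ev P y))))

  ∈-∷⊝ : ∀ {k} {c x : Carrier} {L : Vec Carrier k} → x VM.∈ (c ∷ L) → x ≡ c ⊎ ((x ⊝ c) VM.∈ Vec.map (_⊝ c) L)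
  ∈-∷⊝ (VA.here p) = inj₁ p
  ∈-∷⊝ {c = c} {L = L} (VA.there p) = inj₂ (VMP.∈-map⁺ (_⊝ c) p)

  ∉-⊝ : ∀ {k} {c x : Carrier} {L : Vec Carrier k} → x VM.∉ L → (x ⊝ c) VM.∉ Vec.map (_⊝ c) L
  ∉-⊝ {L = a ∷ L} n (VA.here p) = n (VA.here (⊝-injective _ p))
  ∉-⊝ {L = a ∷ L} n (VA.there p) = ∉-⊝ (λ q → n (VA.there q)) p

  no-items : ∀ {is : List Item} → All (λ it → cf (proj₁ it) 1 VM.∈ []) is → is ≡ []
  no-items [] = refl
  no-items (() ∷ _)

  -- `L` lists the slopes of the other items. Recentring at one of them makes its items constant,
  -- hence absorbed into the base point, while in the distinguished slot the two copies differ by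
  -- the constant `a ⊗ h` and merge into a derivative of `f`. With no slopes left, x and x + P(y)
  -- are independent.
  linear-control : 1 ℕ.< T → ∀ k (L : Vec Carrier k) f₀ P f is → Bdd f₀ → Bdd f → BddI is → Zab 1 P → cf P 1 ≢ 0F → cf P 1 VM.∉ L →
    All (λ it → (Zab 1 (proj₁ it) × cf (proj₁ it) 1 VM.∈ L) ⊎ Zab 0 (proj₁ it)) is →
    pow2 (suc k) (Λ f₀ P f is) ≤ U (suc k) f
  linear-control 1<T zero [] f₀ P f is b₀ b bs zP a≢0 a∉ xs = begin
    Λ f₀ P f is * Λ f₀ P f is     ≡⟨ cong₂ _*_ Λ-eq Λ-eq ⟩
    (avg g₀ * avg f) * (avg g₀ * avg f) ≡⟨ *-swap4 (avg g₀) (avg f) (avg g₀) (avg f) ⟩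
    (avg g₀ * avg g₀) * (avg f * avg f) ≤⟨ *-monoR (sq≥0 (avg f)) (M.Bd-E g₀-Bd) ⟩
    1ℚ * (avg f * avg f)                ≡⟨ trans (*-identityˡ _) (sym (U1 f)) ⟩
    U 1 f ∎
    where
    open ≤-Reasoning
    A = absorb {λ it → Zab 1 (proj₁ it) × cf (proj₁ it) 1 VM.∈ []} {f₀} {is} b₀ bs xs
    open Absorbed A
    Λ-eq : Λ f₀ P f is ≡ avg g₀ * avg f
    Λ-eq = trans (Λ-absorbed A P f) (trans
      (avg-cong (λ x → trans (avg-cong (λ y → cong (g₀ x *_) (trans
          (cong (λ js → f (x ⊕ ev P y) * prodI js x y) (no-items (All.map proj₂ js-X)))
          (trans (*-identityʳ _) (cong f (trans (cong (x ⊕_) (ev-linear P zP y)) (sym (⊕-assoc x _ _))))))))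
        (trans (avg-* (g₀ x) _) (cong (g₀ x *_) (trans (avg-scale (cf P 1) a≢0 (λ z → f ((x ⊕ cf P 0) ⊕ z))) (avg-shiftˡ _ f))))))
      (M.E-*ʳ g₀ (avg f)))
  linear-control 1<T (suc k) (c ∷ L) f₀ P f is b₀ b bs zP a≢0 a∉ xs = begin
    pow2 (suc k) (Λ₀ * Λ₀)                                         ≤⟨ pow2-mono (suc k) (sq≥0 Λ₀) step ⟩
    pow2 (suc k) (avg (λ h → Λ one P′ (f ∙ sh (a ⊗ h) f) (items h)))   ≤⟨ M.pow2-jensen (suc k) _ ⟩
    avg (λ h → pow2 (suc k) (Λ one P′ (f ∙ sh (a ⊗ h) f) (items h)))   ≤⟨ avg-mono bound ⟩
    avg (λ h → U (suc k) (f ∙ sh (a ⊗ h) f))                       ≡⟨ avg-scale a a≢0 (λ h → U (suc k) (f ∙ sh h f)) ⟩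
    U (suc (suc k)) f ∎
    where
    open ≤-Reasoning
    A = absorb {λ it → Zab 1 (proj₁ it) × cf (proj₁ it) 1 VM.∈ (c ∷ L)} {f₀} {is} b₀ bs xs
    open Absorbed A
    open Recentre 1 c 1<T
    a = cf P 1
    Λ₀ = Λ f₀ P f is
    one : Fun
    one _ = 1ℚ
    P′ = sub 1 c P
    items : Carrier → List Item
    items h = double 1 c h js
    L′ = Vec.map (_⊝ c) L
    shift-P : ∀ h x y → (x ⊝ Q y) ⊕ ev P (y ⊕ h) ≡ (x ⊕ ev P′ y) ⊕ a ⊗ h
    shift-P h x y = trans (cong ((x ⊝ Q y) ⊕_) (trans (ev-linear P zP (y ⊕ h))
        (trans (S.solve 4 (λ b a y h → b S.:+ a S.:* (y S.:+ h) S.:= (b S.:+ a S.:* y) S.:+ a S.:* h) refl (cf P 0) a y h)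
          (cong (_⊕ a ⊗ h) (sym (ev-linear P zP y))))))
      (trans (sym (⊕-assoc (x ⊝ Q y) (ev P y) (a ⊗ h))) (cong (_⊕ a ⊗ h) (at-sub P x y)))
    step : Λ₀ * Λ₀ ≤ avg (λ h → Λ one P′ (f ∙ sh (a ⊗ h) f) (items h))
    step = ≤-trans (≤-reflexive (cong₂ _*_ (Λ-absorbed A P f) (Λ-absorbed A P f)))
      (≤-trans (van-der-Corput g₀ (λ x y → f (x ⊕ ev P y) * prodI js x y) Q g₀-Bd)
        (≤-reflexive (avg-cong (λ h → avg-cong (λ x → avg-cong (λ y → trans
          (cong₂ (λ s t → (f s * prodI js (x ⊝ Q y) y) * (f t * prodI js (x ⊝ Q y) (y ⊕ h))) (at-sub P x y) (shift-P h x y))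
          (trans (solve 4 (λ a b c d → (a :* b) :* (c :* d) := con 1ℚ :* ((a :* c) :* (b :* d))) refl
              (f (x ⊕ ev P′ y)) (prodI js (x ⊝ Q y) y) (f ((x ⊕ ev P′ y) ⊕ a ⊗ h)) (prodI js (x ⊝ Q y) (y ⊕ h)))
            (cong (λ z → 1ℚ * ((f (x ⊕ ev P′ y) * f ((x ⊕ ev P′ y) ⊕ a ⊗ h)) * z)) (prodI-double h js x y)))))))))
    each : ∀ (R : Poly T) → Zab 1 R → cf R 1 VM.∈ (c ∷ L) → (Zab 1 (sub 1 c R) × cf (sub 1 c R) 1 VM.∈ L′) ⊎ Zab 0 (sub 1 c R)
    each R z m with ∈-∷⊝ m
    ... | inj₁ e = inj₂ (Zab-lower 0 c R 1<T z e)
    ... | inj₂ m′ = inj₁ (Zab-sub 1 c R 1 ℕP.≤-refl z , subst (VM._∈ L′) (sym (cf-sub-at 1 c R 1<T)) m′)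
    bound : ∀ h → pow2 (suc k) (Λ one P′ (f ∙ sh (a ⊗ h) f) (items h)) ≤ U (suc k) (f ∙ sh (a ⊗ h) f)
    bound h = linear-control 1<T k L′ one P′ (f ∙ sh (a ⊗ h) f) (items h) (λ _ → Bd-1)
      (λ x → Bd-* {f x} (b x) (b _)) (All-double 1 c h (λ _ _ q → q , q) js-Bd) (Zab-sub 1 c P 1 ℕP.≤-refl zP)
      (λ e → ⊝≢0 (λ q → a∉ (VA.here q)) (trans (sym (cf-sub-at 1 c P 1<T)) e))
      (λ m → ∉-⊝ (λ q → a∉ (VA.there q)) (subst (VM._∈ L′) (cf-sub-at 1 c P 1<T) m))
      (All-double 1 c h (λ R _ q → each R (proj₁ q) (proj₂ q) ,
        each (tr h R) (proj₁ (tr-top h R 1 (proj₁ q))) (subst (VM._∈ (c ∷ L)) (sym (proj₂ (tr-top h R 1 (proj₁ q)))) (proj₂ q))) js-X)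

  advance : ∀ N s C e c (e<T : e ℕ.< T) f₀ P f is (bad : List Carrier) → 0ℚ ≤ C → Bdd f₀ → Bdd f → BddI is →
    (∀ h → h ∉ bad → pow2 N (Λ (λ _ → 1ℚ) (sub e c (tr h P)) f (Recentre.next e c e<T P f h is)) ≤ U (suc s) f + C * ε) →
    pow2 (suc N) (Λ f₀ P f is) ≤ U (suc s) f + (C + natℚ (length bad)) * ε
  advance N s C e c e<T f₀ P f is bad 0≤C b₀ b bs good = begin
    pow2 N (Λ f₀ P f is * Λ f₀ P f is)          ≤⟨ pow2-mono N (sq≥0 (Λ f₀ P f is)) (Λ-step f₀ P f is b₀) ⟩
    pow2 N (avg Λ₁)                             ≤⟨ M.pow2-jensen N Λ₁ ⟩
    avg (λ h → pow2 N (Λ₁ h))                   ≤⟨ avg-except bad (λ h → ≤-trans (pow2≤1 N (Λ₁-Bd h)) (≤-by nn (+-comm (U (suc s) f + C * ε) 1ℚ))) good ⟩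
    avg (λ _ → U (suc s) f + C * ε) + natℚ (length bad) * ε   ≡⟨ cong (_+ natℚ (length bad) * ε) (avg-const _) ⟩
    U (suc s) f + C * ε + natℚ (length bad) * ε
      ≡⟨ solve 4 (λ u c e n → u :+ c :* e :+ n :* e := u :+ (c :+ n) :* e) refl (U (suc s) f) C ε (natℚ (length bad)) ⟩
    U (suc s) f + (C + natℚ (length bad)) * ε ∎
    where
    open ≤-Reasoning
    open Recentre e c e<T
    Λ₁ : Carrier → ℚ
    Λ₁ h = Λ (λ _ → 1ℚ) (sub e c (tr h P)) f (next P f h is)
    Λ₁-Bd : ∀ h → Bd (Λ₁ h)
    Λ₁-Bd h = Λ-Bd {λ _ → 1ℚ} {f} {next P f h is} (sub e c (tr h P)) (λ _ → Bd-1) b (b ∷ All-double e c h (λ _ _ q → q , q) bs)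
    nn : 0ℚ ≤ U (suc s) f + C * ε
    nn = +-nn (U≥0 s f) (*-nn 0≤C 0≤ε)

-- A class of systems, uniform in the field: conditions on the distinguished polynomial, and on the other ones relative to it.
record Class (T : ℕ) : Set₁ where
  field
    I  : FiniteField → Set
    PX : ∀ F → I F → Vec (Field.Carrier F) T → Set
    X  : ∀ F → I F → Vec (Field.Carrier F) T → Vec (Field.Carrier F) T → Set

module _ {T : ℕ} (D c n : ℕ) (𝒳 : Class T) where
  open Class 𝒳

  record System (F : FiniteField) : Set where
    open Field F
    open Norms F
    open Polynomials F
    open Systems F T
    field
      char : CharAtLeast F c
      i    : I F
      f₀   : Fun
      P    : Poly T
      f    : Fun
      is   : List Item
      f₀-Bd : Bdd f₀
      f-Bd  : Bdd f
      is-Bd : BddI is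
      few   : length is ℕ.≤ n
      P-deg : Zab D P
      P-lead : cf P D ≢ 0F
      P-X   : PX F i P
      is-X  : All (λ it → X F i P (proj₁ it)) is
      is-NC : All (λ it → NC P (proj₁ it)) is

  record Controlled : Set₁ where
    field
      N s : ℕ
      C : ℚ
      0≤C : 0ℚ ≤ C
      control : ∀ F (σ : System F) → let open System σ in let open Field F in let open Norms F in let open Systems F T in
        pow2 N (Λ f₀ P f is) ≤ U (suc s) f + C * ε

module _ {T : ℕ} where

  _∪Z_ : Class T → ℕ → Class T
  𝒳 ∪Z e = record { I = I ; PX = PX ; X = λ F i P R → X F i P R ⊎ Polynomials.Zab F e R }
    where open Class 𝒳

  -- Recentring at monomials of degree at most `e` preserves the conditions of the class; thus
  -- additional items of low degree can be cleared away first, leaving a system in `𝒳`.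
  Stable : ℕ → ℕ → Class T → Set₁
  Stable D e 𝒳 = ∀ F i → let open Field F in let open Polynomials F in let open Class 𝒳 in ∀ h c e′ P → e′ ℕ.≤ e → Zab D P → PX F i P →
    PX F i (sub e′ c (tr h P)) × X F i (sub e′ c (tr h P)) (sub e′ c P) ×
    (∀ R → X F i P R → X F i (sub e′ c (tr h P)) (sub e′ c R) × X F i (sub e′ c (tr h P)) (sub e′ c (tr h R)))

  -- Recentring at a monomial sends systems of the class 𝒳 to systems of the class 𝒴 of degree D′, for all but few h.
  record Transition (D D′ c : ℕ) (𝒳 𝒴 : Class T) : Set₁ where
    field
      e : ℕ
      e<T : e ℕ.< T
      at : ∀ F → Class.I 𝒳 F → Vec (Field.Carrier F) T → Field.Carrier F
      to : ∀ F → Class.I 𝒳 F → Vec (Field.Carrier F) T → Class.I 𝒴 F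
      move : ∀ F i → let open Field F in let open Polynomials F in ∀ P → Zab (suc (suc D)) P → cf P (suc (suc D)) ≢ 0F → Class.PX 𝒳 F i P → ∀ h →
        cf (tr h P) (suc D) ≢ 0F →
        let P′ = sub e (at F i P) (tr h P) in let j = to F i P in let open Class in
        (Zab D′ P′ × cf P′ D′ ≢ 0F) × PX 𝒴 F j P′ × X 𝒴 F j P′ (sub e (at F i P) P) ×
        (∀ R → X 𝒳 F i P R → X 𝒴 F j P′ (sub e (at F i P) R) × X 𝒴 F j P′ (sub e (at F i P) (tr h R)))

  -- The n items become at most 2n + 1, the extra one being the untranslated copy of `f`. Translated
  -- items stay distinct from P(y + h) for every h; untranslated ones do so for all but one value of
  -- h each.
  transfer : ∀ {D D′ c 𝒳 𝒴} n → suc (suc D) ℕ.< c → Transition D D′ c 𝒳 𝒴 →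
    Controlled D′ c (suc (n ℕ.+ n)) 𝒴 → Controlled (suc (suc D)) c n 𝒳
  transfer {D} {D′} {c} {𝒳} {𝒴} n D<c t con𝒴 = record
    { N = suc N ; s = s ; C = C + natℚ (suc (suc n)) ; 0≤C = +-nn 0≤C (natℚ≥0 (suc (suc n)))
    ; control = λ F σ → let open Go F σ in result }
    where
    open Controlled con𝒴
    open Transition t
    module Go (F : FiniteField) (σ : System (suc (suc D)) c n 𝒳 F) where
      open System σ
      open Field F
      open Norms F
      open Polynomials F
      open Systems F T
      a = cf P (suc (suc D))
      b = at F i P
      m = natF F (suc (suc D)) ⊗ a
      m≢0 : m ≢ 0F
      m≢0 = ⊗≢0 (char (suc (suc D)) (s≤s z≤n) D<c) P-lead
      m⁻¹ = proj₁ (F-inverse m m≢0)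
      -- The only `h` at which the coefficient of y^(D+1) in P(y + h) equals `t`.
      exception : Carrier → Carrier
      exception t = (t ⊝ cf P (suc D)) ⊗ m⁻¹
      -- The value 0 would destroy the new leading coefficient if the degree drops; the value of `P`
      -- could merge P(y + h) with P(y), and the others could merge it with untranslated items.
      bad : List Carrier
      bad = map exception (0F ∷ cf P (suc D) ∷ map (λ it → cf (proj₁ it) (suc D)) is)
      avoid : ∀ h t → h ≢ exception t → cf (tr h P) (suc D) ≢ t
      avoid h t h≢ q = h≢ (trans
        (trans (S.solve 1 (λ h → h S.:= h S.:* S.con (ℤ.+ 1)) refl h) (trans (cong (h ⊗_) (sym (proj₂ (F-inverse m m≢0))))
          (S.solve 5 (λ h n a i p → h S.:* ((n S.:* a) S.:* i) S.:= ((p S.:+ n S.:* (h S.:* a)) S.:- p) S.:* i) refl h (natF F (suc (suc D))) a m⁻¹ (cf P (suc D)))))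
        (cong (λ z → (z ⊝ cf P (suc D)) ⊗ m⁻¹) (trans (sym (tr-second h P (suc D) P-deg)) q)))
      NC-of : ∀ h R → cf (tr h P) (suc D) ≢ cf R (suc D) → NC (tr h P) R
      NC-of h R ne q = ne (q D)
      length-bad : length bad ℕ.≤ suc (suc n)
      length-bad = s≤s (s≤s (subst (ℕ._≤ n) (sym (trans (ListP.length-map exception (map (λ it → cf (proj₁ it) (suc D)) is)) (ListP.length-map (λ it → cf (proj₁ it) (suc D)) is))) few))
      not-here : ∀ {h x : Carrier} {xs} → h ∉ (x ∷ xs) → h ≢ x
      not-here n e = n (here e)
      not-there : ∀ {h x : Carrier} {xs} → h ∉ (x ∷ xs) → h ∉ xs
      not-there n e = n (there e)
      avoid-items : ∀ h js → h ∉ map exception (map (λ it → cf (proj₁ it) (suc D)) js) → All (λ it → NC P (proj₁ it)) js →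
        All (λ it → NC (tr h P) (proj₁ it) × NC P (proj₁ it)) js
      avoid-items h [] _ [] = []
      avoid-items h ((R , _) ∷ js) h∉ (q ∷ qs) = (NC-of h R (avoid h _ (not-here h∉)) , q) ∷ avoid-items h js (not-there h∉) qs
      good : ∀ h → h ∉ bad → pow2 N (Λ (λ _ → 1ℚ) (sub e b (tr h P)) f (Recentre.next e b e<T P f h is)) ≤ U (suc s) f + C * ε
      good h h∉ = control F record
        { char = char ; i = to F i P ; f₀ = λ _ → 1ℚ ; P = sub e b (tr h P) ; f = f ; is = Recentre.next e b e<T P f h is
        ; f₀-Bd = λ _ → Bd-1 ; f-Bd = f-Bd ; is-Bd = f-Bd ∷ All-double e b h (λ _ _ q → q , q) is-Bd
        ; few = s≤s (subst (ℕ._≤ n ℕ.+ n) (sym (length-double e b h is)) (ℕP.+-mono-≤ few few))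
        ; P-deg = proj₁ (proj₁ mv) ; P-lead = proj₂ (proj₁ mv) ; P-X = proj₁ (proj₂ mv)
        ; is-X = proj₁ (proj₂ (proj₂ mv)) ∷ All-double e b h (λ R _ → proj₂ (proj₂ (proj₂ mv)) R) is-X
        ; is-NC = NC-sub e b (tr h P) P (NC-of h P (avoid h _ (not-here (not-there h∉)))) ∷
            All-double e b h (λ R _ q → NC-sub e b (tr h P) R (proj₁ q) , NC-sub e b (tr h P) (tr h R) (NC-tr h P R (proj₂ q)))
              (avoid-items h is (not-there (not-there h∉)) is-NC) }
        where mv = move F i P P-deg P-lead P-X h (avoid h 0F (not-here h∉))
      result : pow2 (suc N) (Λ f₀ P f is) ≤ U (suc s) f + (C + natℚ (suc (suc n))) * ε
      result = ≤-trans (advance N s C e b e<T f₀ P f is bad 0≤C f₀-Bd f-Bd is-Bd good)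
        (+-monoʳ-≤ (U (suc s) f) (*-monoR 0≤ε (+-monoʳ-≤ C (natℚ-mono length-bad))))

  -- Adding polynomials of degree ≤ e to a class that is stable under recentring at lower monomials:
  -- each recentring removes one of the at most n coefficients of y^e.
  module _ (D c : ℕ) (D<c : suc (suc D) ℕ.< c) (D<T : suc (suc D) ℕ.< T) where

    private
      Ctl : ℕ → Class T → Set₁
      Ctl = Controlled (suc (suc D)) c

    drop-constants : ∀ 𝒳 n → Ctl n 𝒳 → Ctl n (𝒳 ∪Z 0)
    drop-constants 𝒳 n ctl = record { N = N ; s = s ; C = C ; 0≤C = 0≤C ; control = λ F σ → let open Go F σ in result }
      where
      open Controlled ctl
      module Go (F : FiniteField) (σ : System (suc (suc D)) c n (𝒳 ∪Z 0) F) where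
        open System σ
        open Field F
        open Norms F
        open Systems F T
        A = absorb {λ it → Class.X 𝒳 F i P (proj₁ it) × Polynomials.NC F P (proj₁ it)} {f₀} {is} f₀-Bd is-Bd (zip is-X is-NC)
          where
          zip : ∀ {js} → All (λ it → Class.X 𝒳 F i P (proj₁ it) ⊎ Polynomials.Zab F 0 (proj₁ it)) js → All (λ it → Polynomials.NC F P (proj₁ it)) js →
            All (λ it → (Class.X 𝒳 F i P (proj₁ it) × Polynomials.NC F P (proj₁ it)) ⊎ Polynomials.Zab F 0 (proj₁ it)) js
          zip [] [] = []
          zip (inj₁ p ∷ ps) (q ∷ qs) = inj₁ (p , q) ∷ zip ps qs
          zip (inj₂ z ∷ ps) (q ∷ qs) = inj₂ z ∷ zip ps qs
        open Absorbed A
        result : pow2 N (Λ f₀ P f is) ≤ U (suc s) f + C * ε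
        result = subst (λ z → pow2 N z ≤ U (suc s) f + C * ε) (sym (Λ-absorbed A P f)) (control F record
          { char = char ; i = i ; f₀ = g₀ ; P = P ; f = f ; is = js ; f₀-Bd = g₀-Bd ; f-Bd = f-Bd ; is-Bd = js-Bd
          ; few = ℕP.≤-trans js-length few ; P-deg = P-deg ; P-lead = P-lead ; P-X = P-X
          ; is-X = All.map proj₁ js-X ; is-NC = All.map proj₂ js-X })

    include : ∀ {n} 𝒳 𝒴 (to : ∀ F (σ : System (suc (suc D)) c n 𝒴 F) → Class.I 𝒳 F) →
      (∀ F (σ : System (suc (suc D)) c n 𝒴 F) → let open System σ in
        Class.PX 𝒳 F (to F σ) P × All (λ it → Class.X 𝒳 F (to F σ) P (proj₁ it)) is) → Ctl n 𝒳 → Ctl n 𝒴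
    include 𝒳 𝒴 to inc ctl = record { N = N ; s = s ; C = C ; 0≤C = 0≤C ; control = λ F σ → let open System σ in control F record
        { char = char ; i = to F σ ; f₀ = f₀ ; P = P ; f = f ; is = is ; f₀-Bd = f₀-Bd ; f-Bd = f-Bd ; is-Bd = is-Bd
        ; few = few ; P-deg = P-deg ; P-lead = P-lead ; P-X = proj₁ (inc F σ) ; is-X = proj₂ (inc F σ) ; is-NC = is-NC } }
      where open Controlled ctl

    leads : ∀ F → let open Field F in let open Polynomials F in ∀ e n (js : List (Poly T × Norms.Fun F)) → length js ℕ.≤ n →
      Σ (Vec Carrier n) λ L → All (λ it → cf (proj₁ it) e VM.∈ L) js
    -- Padding with 0 keeps the length at `n`, so that the number of rounds does not depend on the
    -- system.
    leads F e n [] _ = Vec.replicate n (Field.0F F) , []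
    leads F e (suc n) ((R , _) ∷ js) (s≤s l) = (Polynomials.cf F R e ∷ proj₁ r) , VA.here refl ∷ All.map VA.there (proj₂ r)
      where r = leads F e n js l

    _∪L_of-degree_ : Class T → ℕ → ℕ → Class T
    𝒳 ∪L k of-degree e = record
      { I = λ F → I F × Vec (Field.Carrier F) k ; PX = λ F i → PX F (proj₁ i)
      ; X = λ F i P R → X F (proj₁ i) P R ⊎ (Polynomials.Zab F e R × Polynomials.cf F R e VM.∈ proj₂ i) }
      where open Class 𝒳

    stable-L : ∀ 𝒳 k e → suc e ℕ.≤ suc (suc D) → Stable (suc (suc D)) (suc e) 𝒳 → Stable (suc (suc D)) e (𝒳 ∪L k of-degree suc e)
    stable-L 𝒳 k e e≤ st F (i , L) h c e′ P e′≤e zP pP = proj₁ base , inj₁ (proj₁ (proj₂ base)) , each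
      where
      open Polynomials F
      base = st F i h c e′ P (ℕP.m≤n⇒m≤1+n e′≤e) zP pP
      keep : ∀ R → Zab (suc e) R → cf R (suc e) VM.∈ L → Zab (suc e) (sub e′ c R) × cf (sub e′ c R) (suc e) VM.∈ L
      keep R z m = Zab-sub e′ c R (suc e) (ℕP.m≤n⇒m≤1+n e′≤e) z ,
        subst (VM._∈ L) (sym (cf-sub-off e′ c R (suc e) (λ q → ℕP.<⇒≢ (s≤s e′≤e) (sym q)))) m
      each : ∀ R → Class.X 𝒳 F i P R ⊎ (Zab (suc e) R × cf R (suc e) VM.∈ L) → _
      each R (inj₁ x) = inj₁ (proj₁ (proj₂ (proj₂ base) R x)) , inj₁ (proj₂ (proj₂ (proj₂ base) R x))
      each R (inj₂ (z , m)) = inj₂ (keep R z m) ,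
        inj₂ (keep (tr h R) (proj₁ (tr-top h R (suc e) z)) (subst (VM._∈ L) (sym (proj₂ (tr-top h R (suc e) z))) m))

    -- Recursion on the degree and, inside it, on the number of coefficients occurring in that
    -- degree: clearing one coefficient lowers the degree of its items, and the smaller degree is
    -- handled over the class that includes the coefficients still to be cleared.
    add-lower : ∀ e → e ℕ.< suc (suc D) → ∀ 𝒳 → Stable (suc (suc D)) e 𝒳 → (∀ n → Ctl n 𝒳) → ∀ n → Ctl n (𝒳 ∪Z e)
    add-lower zero _ 𝒳 st ctl n = drop-constants 𝒳 n (ctl n)
    add-lower (suc e) e<D 𝒳 st ctl n = include (𝒳 ∪L n of-degree suc e) (𝒳 ∪Z suc e)
      (λ F σ → System.i σ , proj₁ (L F σ)) (λ F σ → System.P-X σ , combine F σ (System.is-X σ) (proj₂ (L F σ))) (layers n n)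
      where
      L : ∀ F (σ : System (suc (suc D)) c n (𝒳 ∪Z suc e) F) → _
      L F σ = leads F (suc e) n (System.is σ) (System.few σ)
      combine : ∀ F (σ : System (suc (suc D)) c n (𝒳 ∪Z suc e) F) {js} →
        All (λ it → Class.X (𝒳 ∪Z suc e) F (System.i σ) (System.P σ) (proj₁ it)) js →
        All (λ it → Polynomials.cf F (proj₁ it) (suc e) VM.∈ proj₁ (L F σ)) js →
        All (λ it → Class.X (𝒳 ∪L n of-degree suc e) F (System.i σ , proj₁ (L F σ)) (System.P σ) (proj₁ it)) js
      combine F σ [] [] = []
      combine F σ (inj₁ x ∷ xs) (_ ∷ ms) = inj₁ x ∷ combine F σ xs ms
      combine F σ (inj₂ z ∷ xs) (m ∷ ms) = inj₂ (z , m) ∷ combine F σ xs ms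
      layers : ∀ k n → Ctl n (𝒳 ∪L k of-degree suc e)
      layers zero n = include 𝒳 (𝒳 ∪L 0 of-degree suc e) (λ F σ → proj₁ (System.i σ))
        (λ F σ → System.P-X σ , All.map (λ { (inj₁ x) → x ; (inj₂ (_ , m)) → ⊥-elim (none (proj₂ (System.i σ)) m) }) (System.is-X σ)) (ctl n)
        where
        none : ∀ {A : Set} {x : A} (L : Vec A 0) → x VM.∉ L
        none [] ()
      layers (suc k) n = transfer n D<c (record
          { e = suc e ; e<T = ℕP.<-trans e<D D<T ; at = λ F i P → Vec.head (proj₂ i)
          ; to = λ F i P → proj₁ i , Vec.map (λ a → Field._⊝_ F a (Vec.head (proj₂ i))) (Vec.tail (proj₂ i))
          ; move = move })
        (add-lower e (ℕP.<-trans (ℕP.n<1+n e) e<D) (𝒳 ∪L k of-degree suc e) (stable-L 𝒳 k e (ℕP.<⇒≤ e<D) st) (layers k) (suc (n ℕ.+ n)))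
        where
        move : ∀ F i → let open Field F in let open Polynomials F in ∀ P → Zab (suc (suc D)) P → cf P (suc (suc D)) ≢ 0F → Class.PX 𝒳 F (proj₁ i) P → ∀ h → _ → _
        move F (i , a ∷ L) P zP lead pP h _ =
          (Zab-sub (suc e) a (tr h P) _ (ℕP.<⇒≤ e<D) (proj₁ top) ,
            λ q → lead (trans (sym (proj₂ top)) (trans (sym (cf-sub-off (suc e) a (tr h P) _ (λ r → ℕP.<⇒≢ e<D (sym r)))) q))) ,
          proj₁ base , inj₁ (inj₁ (proj₁ (proj₂ base))) , each
          where
          open Field F
          open Polynomials F
          open Systems F T using (∈-∷⊝)
          top = tr-top h P (suc (suc D)) zP
          base = st F i h a (suc e) P ℕP.≤-refl zP pP
          L′ = Vec.map (_⊝ a) L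
          P′ = sub (suc e) a (tr h P)
          lower : ∀ R → Zab (suc e) R → cf R (suc e) VM.∈ (a ∷ L) →
            (Class.X 𝒳 F i P′ (sub (suc e) a R) ⊎ (Zab (suc e) (sub (suc e) a R) × cf (sub (suc e) a R) (suc e) VM.∈ L′)) ⊎ Zab e (sub (suc e) a R)
          lower R z m with ∈-∷⊝ m
          ... | inj₁ q = inj₂ (Zab-lower e a R (ℕP.<-trans e<D D<T) z q)
          ... | inj₂ m′ = inj₁ (inj₂ (Zab-sub (suc e) a R (suc e) ℕP.≤-refl z , subst (VM._∈ L′) (sym (cf-sub-at (suc e) a R (ℕP.<-trans e<D D<T))) m′))
          each : ∀ R → Class.X 𝒳 F i P R ⊎ (Zab (suc e) R × cf R (suc e) VM.∈ (a ∷ L)) → _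
          each R (inj₁ x) = inj₁ (inj₁ (proj₁ (proj₂ (proj₂ base) R x))) , inj₁ (inj₁ (proj₂ (proj₂ (proj₂ base) R x)))
          each R (inj₂ (z , m)) = lower R z m ,
            lower (tr h R) (proj₁ (tr-top h R (suc e) z)) (subst (VM._∈ (a ∷ L)) (sym (proj₂ (tr-top h R (suc e) z))) m)

module _ {T : ℕ} where
  ofDegree≤ : ℕ → Class T
  ofDegree≤ D = record { I = λ _ → ⊤ ; PX = λ _ _ _ → ⊤ ; X = λ F _ _ R → Polynomials.Zab F D R }

  other-leads : ∀ F → let open Field F in let open Polynomials F in ∀ e n a → a ≢ 0F → (js : List (Poly T × Norms.Fun F)) → length js ℕ.≤ n →
    Σ (Vec Carrier n) λ L → a VM.∉ L × All (λ it → cf (proj₁ it) e ≡ a ⊎ cf (proj₁ it) e VM.∈ L) js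
  -- Padding with 0 is safe because `a` is nonzero and has to stay outside the list.
  other-leads F e n a a≢0 [] _ = Vec.replicate n 0F , avoid n , []
    where
    open Field F
    avoid : ∀ n → a VM.∉ Vec.replicate n 0F
    avoid (suc n) (VA.here q) = a≢0 q
    avoid (suc n) (VA.there m) = avoid n m
  other-leads F e (suc n) a a≢0 ((R , _) ∷ js) (s≤s l) with other-leads F e n a a≢0 js l | Field._≟F_ F (Polynomials.cf F R e) a
  ... | L , a∉ , xs | yes q = (Field.0F F ∷ L) , (λ { (VA.here r) → a≢0 r ; (VA.there m) → a∉ m }) ,
        (inj₁ q ∷ All.map (λ { (inj₁ r) → inj₁ r ; (inj₂ m) → inj₂ (VA.there m) }) xs)
  ... | L , a∉ , xs | no q = (Polynomials.cf F R e ∷ L) , (λ { (VA.here r) → q (sym r) ; (VA.there m) → a∉ m }) ,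
        (inj₂ (VA.here refl) ∷ All.map (λ { (inj₁ r) → inj₁ r ; (inj₂ m) → inj₂ (VA.there m) }) xs)

  NC⇒slopes : ∀ F → let open Field F in let open Polynomials F in ∀ (P R : Poly T) → Zab 1 P → Zab 1 R → NC P R → cf P 1 ≢ cf R 1
  NC⇒slopes F P R zP zR nc q = nc λ { zero → q ; (suc j) → trans (zP (suc (suc j)) (s≤s (s≤s z≤n))) (sym (zR (suc (suc j)) (s≤s (s≤s z≤n)))) }

  linear-controlled : ∀ c n → 1 ℕ.< T → Controlled 1 c n (ofDegree≤ 1)
  linear-controlled c n 1<T = record { N = suc n ; s = n ; C = 0ℚ ; 0≤C = ≤-refl ; control = λ F σ → let open Go F σ in result }
    where
    module Go (F : FiniteField) (σ : System 1 c n (ofDegree≤ 1) F) where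
      open System σ
      open Field F
      open Norms F
      open Polynomials F
      open Systems F T
      L = other-leads F 1 n (cf P 1) P-lead is few
      combine : ∀ {js} → All (λ it → Zab 1 (proj₁ it)) js → All (λ it → NC P (proj₁ it)) js →
        All (λ it → cf (proj₁ it) 1 ≡ cf P 1 ⊎ cf (proj₁ it) 1 VM.∈ proj₁ L) js →
        All (λ it → (Zab 1 (proj₁ it) × cf (proj₁ it) 1 VM.∈ proj₁ L) ⊎ Zab 0 (proj₁ it)) js
      combine [] [] [] = []
      combine {(R , _) ∷ _} (z ∷ zs) (q ∷ qs) (inj₁ e ∷ ms) = ⊥-elim (NC⇒slopes F P R P-deg z q (sym e))
      combine (z ∷ zs) (q ∷ qs) (inj₂ m ∷ ms) = inj₁ (z , m) ∷ combine zs qs ms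
      result : pow2 (suc n) (Λ f₀ P f is) ≤ U (suc n) f + 0ℚ * ε
      result = ≤-trans (linear-control 1<T n (proj₁ L) f₀ P f is f₀-Bd f-Bd is-Bd P-deg P-lead (proj₁ (proj₂ L)) (combine is-X is-NC (proj₂ (proj₂ L))))
        (≤-reflexive (sym (trans (cong (U (suc n) f +_) (*-zeroˡ ε)) (+-identityʳ _))))

  -- In `layer k` the number `k` counts leading coefficients different from that of `P`. Recentring
  -- at one of them lowers the degree of its items, which are left to `add-lower`; when none is
  -- left, recentring at the leading term of `P` lowers the degree of the whole system.
  controlled : ∀ D c n → suc D ℕ.< c → suc D ℕ.< T → Controlled (suc D) c n (ofDegree≤ (suc D))
  controlled zero c n _ D<T = linear-controlled c n D<T
  controlled (suc D) c n D<c D<T = include D c D<c D<T (layer n) (ofDegree≤ D₂) (λ F σ → proj₁ (L F σ))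
      (λ F σ → proj₁ (proj₂ (L F σ)) , combine F σ (System.is-X σ) (proj₂ (proj₂ (L F σ)))) (layers n n)
    where
    D₂ = suc (suc D)
    layer : ℕ → Class T
    layer k = record
      { I = λ F → Vec (Field.Carrier F) k
      ; PX = λ F L P → Polynomials.cf F P D₂ VM.∉ L
      ; X = λ F L P R → let open Polynomials F in Zab D₂ R × (cf R D₂ ≡ cf P D₂ ⊎ cf R D₂ VM.∈ L) }
    L : ∀ F (σ : System D₂ c n (ofDegree≤ D₂) F) → _
    L F σ = other-leads F D₂ n (Polynomials.cf F (System.P σ) D₂) (System.P-lead σ) (System.is σ) (System.few σ)
    combine : ∀ F (σ : System D₂ c n (ofDegree≤ D₂) F) {js} → All (λ it → Polynomials.Zab F D₂ (proj₁ it)) js →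
      All (λ it → Polynomials.cf F (proj₁ it) D₂ ≡ Polynomials.cf F (System.P σ) D₂ ⊎ Polynomials.cf F (proj₁ it) D₂ VM.∈ proj₁ (L F σ)) js →
      All (λ it → Class.X (layer n) F (proj₁ (L F σ)) (System.P σ) (proj₁ it)) js
    combine F σ [] [] = []
    combine F σ (z ∷ zs) (m ∷ ms) = (z , m) ∷ combine F σ zs ms
    module Top F (P : Vec (Field.Carrier F) T) (zP : Polynomials.Zab F D₂ P) (h : Field.Carrier F) where
      open Field F public
      open Polynomials F public
      open Systems F T public using (∈-∷⊝; ∉-⊝)
      tr-lead : ∀ R → Zab D₂ R → Zab D₂ (tr h R) × cf (tr h R) D₂ ≡ cf R D₂
      tr-lead R z = tr-top h R D₂ z
    stable : ∀ k → Stable D₂ (suc D) (layer k)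
    stable k F L h c e P e≤ zP P∉ = subst (VM._∉ L) (sym P′-lead) P∉ ,
      (Zab-sub e c P D₂ e≤′ zP , inj₁ (trans (off P) (sym P′-lead))) ,
      λ R (z , m) → (Zab-sub e c R D₂ e≤′ z , keep R R (off R) m) ,
        (Zab-sub e c (tr h R) D₂ e≤′ (proj₁ (tr-lead R z)) , keep R (tr h R) (trans (off (tr h R)) (proj₂ (tr-lead R z))) m)
      where
      open Top F P zP h
      e≤′ : e ℕ.≤ D₂
      e≤′ = ℕP.m≤n⇒m≤1+n e≤
      off : ∀ (R : Poly T) → cf (sub e c R) D₂ ≡ cf R D₂
      off R = cf-sub-off e c R D₂ (λ q → ℕP.<⇒≢ (s≤s e≤) (sym q))
      P′-lead : cf (sub e c (tr h P)) D₂ ≡ cf P D₂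
      P′-lead = trans (off (tr h P)) (proj₂ (tr-lead P zP))
      keep : ∀ (R R′ : Poly T) → cf (sub e c R′) D₂ ≡ cf R D₂ → cf R D₂ ≡ cf P D₂ ⊎ cf R D₂ VM.∈ L →
        cf (sub e c R′) D₂ ≡ cf (sub e c (tr h P)) D₂ ⊎ cf (sub e c R′) D₂ VM.∈ L
      keep R R′ q (inj₁ r) = inj₁ (trans q (trans r (sym P′-lead)))
      keep R R′ q (inj₂ m) = inj₂ (subst (VM._∈ L) (sym q) m)
    lower-degree : Transition D (suc D) c (layer 0) (ofDegree≤ (suc D))
    lower-degree = record { e = D₂ ; e<T = D<T ; at = λ F L P → Polynomials.cf F P D₂ ; to = λ _ _ _ → tt ; move = move }
      where
      move : ∀ F L → let open Field F in let open Polynomials F in ∀ P → Zab D₂ P → cf P D₂ ≢ 0F → cf P D₂ VM.∉ L → ∀ h → cf (tr h P) (suc D) ≢ 0F → _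
      move F [] P zP lead P∉ h sec = (low (tr h P) (proj₁ (tr-lead P zP)) (proj₂ (tr-lead P zP)) ,
          λ q → sec (trans (sym (cf-sub-off D₂ a (tr h P) (suc D) (ℕP.<⇒≢ (ℕP.n<1+n (suc D))))) q)) ,
        tt , low P zP refl , each
        where
        open Top F P zP h
        a = cf P D₂
        low : ∀ R → Zab D₂ R → cf R D₂ ≡ a → Zab (suc D) (sub D₂ a R)
        low R z q = Zab-lower (suc D) a R D<T z q
        each : ∀ R → Zab D₂ R × (cf R D₂ ≡ a ⊎ cf R D₂ VM.∈ []) → _
        each R (z , inj₁ q) = low R z q , low (tr h R) (proj₁ (tr-lead R z)) (trans (proj₂ (tr-lead R z)) q)
        each R (z , inj₂ ())
    lower-layer : ∀ k → Transition D D₂ c (layer (suc k)) (layer k ∪Z suc D)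
    lower-layer k = record { e = D₂ ; e<T = D<T ; at = λ F L P → Vec.head L
        ; to = λ F L P → Vec.map (λ a → Field._⊝_ F a (Vec.head L)) (Vec.tail L) ; move = move }
      where
      move : ∀ F L → let open Field F in let open Polynomials F in ∀ P → Zab D₂ P → cf P D₂ ≢ 0F → cf P D₂ VM.∉ L → ∀ h → cf (tr h P) (suc D) ≢ 0F → _
      move F (a ∷ L) P zP lead P∉ h _ = (Zab-sub D₂ a (tr h P) D₂ ℕP.≤-refl (proj₁ (tr-lead P zP)) ,
          λ q → ⊝≢0 (λ r → P∉ (VA.here r)) (trans (sym P′-lead) q)) ,
        (λ m → ∉-⊝ (λ q → P∉ (VA.there q)) (subst (VM._∈ L′) P′-lead m)) ,
        inj₁ (Zab-sub D₂ a P D₂ ℕP.≤-refl zP , inj₁ (trans (cf-sub-at D₂ a P D<T) (sym P′-lead))) ,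
        λ R (z , m) → each R z m , each (tr h R) (proj₁ (tr-lead R z)) (subst (λ x → x ≡ cf P D₂ ⊎ x VM.∈ (a ∷ L)) (sym (proj₂ (tr-lead R z))) m)
        where
        open Top F P zP h
        L′ = Vec.map (_⊝ a) L
        P′ = sub D₂ a (tr h P)
        P′-lead : cf P′ D₂ ≡ cf P D₂ ⊝ a
        P′-lead = trans (cf-sub-at D₂ a (tr h P) D<T) (cong (_⊝ a) (proj₂ (tr-lead P zP)))
        each : ∀ R → Zab D₂ R → cf R D₂ ≡ cf P D₂ ⊎ cf R D₂ VM.∈ (a ∷ L) →
          (Zab D₂ (sub D₂ a R) × (cf (sub D₂ a R) D₂ ≡ cf P′ D₂ ⊎ cf (sub D₂ a R) D₂ VM.∈ L′)) ⊎ Zab (suc D) (sub D₂ a R)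
        each R z (inj₁ q) = inj₁ (Zab-sub D₂ a R D₂ ℕP.≤-refl z , inj₁ (trans (cf-sub-at D₂ a R D<T) (trans (cong (_⊝ a) q) (sym P′-lead))))
        each R z (inj₂ m) with ∈-∷⊝ m
        ... | inj₁ q = inj₂ (Zab-lower (suc D) a R D<T z q)
        ... | inj₂ m′ = inj₁ (Zab-sub D₂ a R D₂ ℕP.≤-refl z , inj₂ (subst (VM._∈ L′) (sym (cf-sub-at D₂ a R D<T)) m′))
    layers : ∀ k n → Controlled D₂ c n (layer k)
    layers zero n = transfer n D<c lower-degree (controlled D c (suc (n ℕ.+ n)) (ℕP.<-trans (ℕP.n<1+n (suc D)) D<c) (ℕP.<-trans (ℕP.n<1+n (suc D)) D<T))
    layers (suc k) n = transfer n D<c (lower-layer k)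
      (add-lower D c D<c D<T (suc D) ℕP.≤-refl (layer k) (stable k) (layers k) (suc (n ℕ.+ n)))

-- Families with one entry replaced, and products over families

upd : ∀ {m} {A : Set} → (Fin m → A) → Fin m → A → Fin m → A
upd f zero a zero = a
upd f zero a (suc i) = f (suc i)
upd f (suc j) a zero = f zero
upd f (suc j) a (suc i) = upd (f ∘ suc) j a i

upd-same : ∀ {m} {A : Set} (f : Fin m → A) j a → upd f j a j ≡ a
upd-same f zero a = refl
upd-same f (suc j) a = upd-same (f ∘ suc) j a

upd-other : ∀ {m} {A : Set} (f : Fin m → A) j a i → i ≢ j → upd f j a i ≡ f i
upd-other f zero a zero n = ⊥-elim (n refl)
upd-other f zero a (suc i) n = refl
upd-other f (suc j) a zero n = refl
upd-other f (suc j) a (suc i) n = upd-other (f ∘ suc) j a i (λ q → n (cong suc q))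

upd-all : ∀ {m} {A : Set} (Q : A → Set) (f : Fin m → A) j a → Q a → (∀ i → i ≢ j → Q (f i)) → ∀ i → Q (upd f j a i)
upd-all Q f zero a q r zero = q
upd-all Q f zero a q r (suc i) = r (suc i) (λ ())
upd-all Q f (suc j) a q r zero = r zero (λ ())
upd-all Q f (suc j) a q r (suc i) = upd-all Q (f ∘ suc) j a q (λ i n → r (suc i) (λ e → n (FinP.suc-injective e))) i

prodF : ∀ {m} → (Fin m → ℚ) → ℚ
prodF {zero} f = 1ℚ
prodF {suc m} f = f zero * prodF (f ∘ suc)

prodF-cong : ∀ {m} {f g : Fin m → ℚ} → (∀ i → f i ≡ g i) → prodF f ≡ prodF g
prodF-cong {zero} p = refl
prodF-cong {suc m} p = cong₂ _*_ (p zero) (prodF-cong (λ i → p (suc i)))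

prodF-* : ∀ {m} (f g : Fin m → ℚ) → prodF (λ i → f i * g i) ≡ prodF f * prodF g
prodF-* {zero} f g = sym (*-identityʳ 1ℚ)
prodF-* {suc m} f g = trans (cong (f zero * g zero *_) (prodF-* (f ∘ suc) (g ∘ suc)))
  (solve 4 (λ a b c d → (a :* b) :* (c :* d) := (a :* c) :* (b :* d)) refl (f zero) (g zero) (prodF (f ∘ suc)) (prodF (g ∘ suc)))

prodF-Bd : ∀ {m} {f : Fin m → ℚ} → (∀ i → Bd (f i)) → Bd (prodF f)
prodF-Bd {zero} p = Bd-1
prodF-Bd {suc m} {f} p = Bd-* {f zero} (p zero) (prodF-Bd (λ i → p (suc i)))

-- Equidistribution by Weyl differencing

module Equidistribution (F : FiniteField) where
  open Field F
  open Norms F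
  open Polynomials F

  -- "s is a polynomial of degree d whose coefficient of y^d is a", expressed by differencing
  SP : ℕ → Carrier → (Carrier → Carrier) → Set
  SP zero a s = ∀ y → s y ≡ a
  SP (suc d) a s = ∀ h → SP d (natF F (suc d) ⊗ (h ⊗ a)) (λ y → s (y ⊕ h) ⊝ s y)

  SP-cong : ∀ d {a b s t} → a ≡ b → (∀ y → s y ≡ t y) → SP d a s → SP d b t
  SP-cong zero p q r y = trans (sym (q y)) (trans (r y) p)
  SP-cong (suc d) p q r h = SP-cong d (cong (λ a → natF F (suc d) ⊗ (h ⊗ a)) p) (λ y → cong₂ _⊝_ (q _) (q y)) (r h)

  SP-+ : ∀ d {a b s t} → SP d a s → SP d b t → SP d (a ⊕ b) (λ y → s y ⊕ t y)
  SP-+ zero p q y = cong₂ _⊕_ (p y) (q y)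
  SP-+ (suc d) {a} {b} {s} {t} p q h = SP-cong d
    (S.solve 4 (λ n h a b → n S.:* (h S.:* a) S.:+ n S.:* (h S.:* b) S.:= n S.:* (h S.:* (a S.:+ b))) refl (natF F (suc d)) h a b)
    (λ y → S.solve 4 (λ s′ s t′ t → (s′ S.:- s) S.:+ (t′ S.:- t) S.:= (s′ S.:+ t′) S.:- (s S.:+ t)) refl (s (y ⊕ h)) (s y) (t (y ⊕ h)) (t y))
    (SP-+ d (p h) (q h))

  SP-scale : ∀ d c {a s} → SP d a s → SP d (c ⊗ a) (λ y → c ⊗ s y)
  SP-scale zero c p y = cong (c ⊗_) (p y)
  SP-scale (suc d) c {a} {s} p h = SP-cong d
    (S.solve 4 (λ n h c a → c S.:* (n S.:* (h S.:* a)) S.:= n S.:* (h S.:* (c S.:* a))) refl (natF F (suc d)) h c a)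
    (λ y → S.solve 3 (λ c s′ s → c S.:* (s′ S.:- s) S.:= c S.:* s′ S.:- c S.:* s) refl c (s (y ⊕ h)) (s y))
    (SP-scale d c (p h))

  SP-shift : ∀ d k {a s} → SP d a s → SP d a (λ y → s (y ⊕ k))
  SP-shift zero k p y = p (y ⊕ k)
  SP-shift (suc d) k {a} {s} p h = SP-cong d refl (λ y → cong (λ z → s z ⊝ s (y ⊕ k)) (⊕-swap y k h)) (SP-shift d k (p h))

  SP-raise : ∀ d {a s} → SP d a s → SP (suc d) 0F s
  SP-raise zero {a} p h y = trans (cong₂ _⊝_ (p _) (p y))
    (S.solve 2 (λ a h → a S.:- a S.:= (S.con (ℤ.+ 1) S.:+ S.con (ℤ.+ 0)) S.:* (h S.:* S.con (ℤ.+ 0))) refl a h)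
  SP-raise (suc d) p h = SP-cong (suc d)
    (S.solve 2 (λ n h → S.con (ℤ.+ 0) S.:= n S.:* (h S.:* S.con (ℤ.+ 0))) refl (natF F (suc (suc d))) h) (λ _ → refl) (SP-raise d (p h))

  SP-mul : ∀ d {a s} → SP d a s → SP (suc d) a (λ y → y ⊗ s y)
  SP-mul zero {a} {s} p h y = trans (cong₂ (λ u v → (y ⊕ h) ⊗ u ⊝ y ⊗ v) (p _) (p y))
    (S.solve 3 (λ a y h → (y S.:+ h) S.:* a S.:- y S.:* a S.:= (S.con (ℤ.+ 1) S.:+ S.con (ℤ.+ 0)) S.:* (h S.:* a)) refl a y h)
  SP-mul (suc d) {a} {s} p h = SP-cong (suc d)
    (S.solve 3 (λ n h a → n S.:* (h S.:* a) S.:+ h S.:* a S.:= (S.con (ℤ.+ 1) S.:+ n) S.:* (h S.:* a)) refl (natF F (suc d)) h a)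
    (λ y → S.solve 4 (λ y h s′ s → y S.:* (s′ S.:- s) S.:+ h S.:* s′ S.:= (y S.:+ h) S.:* s′ S.:- y S.:* s) refl y h (s (y ⊕ h)) (s y))
    (SP-+ (suc d) (SP-mul d (p h)) (SP-scale (suc d) h (SP-shift (suc d) h p)))

  SP-pw : ∀ d → SP d 1F (pw d)
  SP-pw zero y = refl
  SP-pw (suc d) = SP-mul d (SP-pw d)

  infixl 6 _⊞_
  _⊞_ : ∀ {m} → Vec Carrier m → (Fin m → Carrier) → Vec Carrier m
  [] ⊞ φ = []
  (a ∷ z) ⊞ φ = (a ⊕ φ zero) ∷ (z ⊞ (φ ∘ suc))

  ⊞-cong : ∀ {m} (z : Vec Carrier m) {φ χ} → (∀ i → φ i ≡ χ i) → z ⊞ φ ≡ z ⊞ χ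
  ⊞-cong [] p = refl
  ⊞-cong (a ∷ z) p = cong₂ _∷_ (cong (a ⊕_) (p zero)) (⊞-cong z (λ i → p (suc i)))

  ⊞-assoc : ∀ {m} (z : Vec Carrier m) φ χ → z ⊞ φ ⊞ χ ≡ z ⊞ (λ i → φ i ⊕ χ i)
  ⊞-assoc [] φ χ = refl
  ⊞-assoc (a ∷ z) φ χ = cong₂ _∷_ (⊕-assoc a _ _) (⊞-assoc z _ _)

  ⊞-0 : ∀ {m} (z : Vec Carrier m) {φ} → (∀ i → φ i ≡ 0F) → z ⊞ φ ≡ z
  ⊞-0 [] p = refl
  ⊞-0 (a ∷ z) p = cong₂ _∷_ (trans (cong (a ⊕_) (p zero)) (⊕-identityʳ a)) (⊞-0 z (λ i → p (suc i)))

  ⊞-comm : ∀ {m} (z w : Vec Carrier m) → z ⊞ Vec.lookup w ≡ w ⊞ Vec.lookup z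
  ⊞-comm [] [] = refl
  ⊞-comm (a ∷ z) (b ∷ w) = cong₂ _∷_ (⊕-comm a b) (⊞-comm z w)

  E-⊞ : ∀ {m} (φ : Fin m → Carrier) (G : Vec Carrier m → ℚ) → V.E {m} (λ z → G (z ⊞ φ)) ≡ V.E {m} G
  E-⊞ {zero} φ G = refl
  E-⊞ {suc m} φ G = trans (avg-cong (λ a → E-⊞ (φ ∘ suc) (λ z → G ((a ⊕ φ zero) ∷ z)))) (avg-shift (φ zero) (λ a → V.E {m} (λ z → G (a ∷ z))))

  Bd-half-difference : ∀ {a b} → Bd a → Bd b → Bd (½ * (a - b))
  Bd-half-difference {a} {b} p q = ≤-by
    (*-nn (nonNegative⁻¹ ½) (+-nn (+-nn (≤⇒0≤- p) (≤⇒0≤- q)) (*-nn (nonNegative⁻¹ ½) (sq≥0 (a + b)))))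
    (solve 2 (λ a b → con 1ℚ := (con ½ :* (a :- b)) :* (con ½ :* (a :- b)) :+
      con ½ :* (((con 1ℚ :- a :* a) :+ (con 1ℚ :- b :* b)) :+ con ½ :* ((a :+ b) :* (a :+ b)))) refl a b)

  module _ {m : ℕ} where
    Tensor : Set
    Tensor = Vec Carrier m → ℚ

    energy : Tensor → (Carrier → Fin m → Carrier) → ℚ
    energy W φ = V.E {m} (λ z → avg (λ y → W (z ⊞ φ y)) * avg (λ y → W (z ⊞ φ y)))

    energy≥0 : ∀ W φ → 0ℚ ≤ energy W φ
    energy≥0 W φ = V.E-nn {m} (λ z → sq≥0 (avg (λ y → W (z ⊞ φ y))))

    energy-Bd : ∀ {W} → (∀ z → Bd (W z)) → ∀ φ → energy W φ ≤ 1ℚ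
    energy-Bd b φ = V.E-≤const {m} (λ z → M.Bd-E (λ y → b (z ⊞ φ y)))

    -- Translating z by φ(y) leaves one factor `W z` free of y and h, which Cauchy-Schwarz discards.
    differencing : ∀ W → (∀ z → Bd (W z)) → ∀ φ →
      energy W φ * energy W φ ≤ avg (λ h → energy W (λ y i → φ (y ⊕ h) i ⊝ φ y i))
    differencing W b φ = begin
      energy W φ * energy W φ                         ≡⟨ cong₂ _*_ eq eq ⟩
      V.E {m} (λ z → W z * Y z) * V.E {m} (λ z → W z * Y z) ≤⟨ V.cs {m} W Y b ⟩
      V.E {m} (λ z → Y z * Y z)                       ≤⟨ V.E-mono {m} (λ z → M.jensen (λ h → avg (λ y → W (z ⊞ δ h y)))) ⟩
      V.E {m} (λ z → avg (λ h → avg (λ y → W (z ⊞ δ h y)) * avg (λ y → W (z ⊞ δ h y)))) ≡⟨ avg-fubini (meanV m) _ ⟩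
      avg (λ h → energy W (δ h)) ∎
      where
      open ≤-Reasoning
      δ : Carrier → Carrier → Fin m → Carrier
      δ h y i = φ (y ⊕ h) i ⊝ φ y i
      Y : Tensor
      Y z = avg (λ h → avg (λ y → W (z ⊞ δ h y)))
      eq : energy W φ ≡ V.E {m} (λ z → W z * Y z)
      eq = trans (V.E-cong {m} (λ z → trans (E-prod meanF meanF _ _) (avg-cong (λ y → sym (avg-shiftˡ y _)))))
        (trans (avg-fubini (meanV m) _) (trans (avg-cong (λ y → trans (avg-fubini (meanV m) _) (avg-cong (λ h →
            trans (V.E-cong {m} (λ z → cong (λ w → W (z ⊞ φ y) * W w) (sym (trans (⊞-assoc z (φ y) (δ h y))
              (⊞-cong z (λ i → S.solve 2 (λ a b → a S.:+ (b S.:- a) S.:= b) refl (φ y i) (φ (y ⊕ h) i)))))))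
              (E-⊞ (φ y) (λ z → W z * W (z ⊞ δ h y)))))))
          (trans (avg-cong (λ y → sym (avg-fubini (meanV m) _))) (trans (sym (avg-fubini (meanV m) _))
            (V.E-cong {m} (λ z → trans (avg-fubini meanF _) (trans (avg-cong (λ h → avg-* (W z) _)) (avg-* (W z) _))))))))

    -- If W averages to zero along every line in direction a, differencing down to a linear polynomial
    -- in that direction makes the energy vanish except when one of the differences is zero.
    weyl : ∀ W (a : Fin m → Carrier) → (∀ z → Bd (W z)) → (∀ z → avg (λ t → W (z ⊞ (λ i → t ⊗ a i))) ≡ 0ℚ) →
      ∀ d κ φ → κ ≢ 0F → (∀ n → 0 ℕ.< n → n ℕ.≤ suc d → natF F n ≢ 0F) →
      (∀ i → SP (suc d) (κ ⊗ a i) (λ y → φ y i)) → pow2 d (energy W φ) ≤ natℚ d * ε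
    weyl W a b ker zero κ φ κ≢0 ch sp = ≤-reflexive (trans (trans (V.E-cong {m} (λ z → trans (cong₂ _*_ (vanish z) (vanish z)) (*-zeroˡ 0ℚ))) (V.E-const {m} 0ℚ)) (sym (*-zeroˡ ε)))
      where
      vanish : ∀ z → avg (λ y → W (z ⊞ φ y)) ≡ 0ℚ
      vanish z = trans (avg-cong (λ y → cong W (trans (⊞-cong z (λ i → step y i)) (sym (⊞-assoc z (φ 0F) _)))))
        (trans (avg-scale κ κ≢0 (λ t → W (z ⊞ φ 0F ⊞ (λ i → t ⊗ a i)))) (ker (z ⊞ φ 0F)))
        where
        step : ∀ y i → φ y i ≡ φ 0F i ⊕ (κ ⊗ y) ⊗ a i
        step y i = trans (S.solve 2 (λ u v → v S.:= u S.:+ (v S.:- u)) refl (φ 0F i) (φ y i))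
          (cong (φ 0F i ⊕_) (trans (cong (λ x → φ x i ⊝ φ 0F i) (sym (⊕-identityˡ y))) (trans (sp i y 0F)
            (S.solve 3 (λ y k a → (S.con (ℤ.+ 1) S.:+ S.con (ℤ.+ 0)) S.:* (y S.:* (k S.:* a)) S.:= (k S.:* y) S.:* a) refl y κ (a i)))))
    weyl W a b ker (suc d) κ φ κ≢0 ch sp = begin
      pow2 d (energy W φ * energy W φ)        ≤⟨ pow2-mono d (sq≥0 (energy W φ)) (differencing W b φ) ⟩
      pow2 d (avg (λ h → energy W (δ h)))     ≤⟨ M.pow2-jensen d _ ⟩
      avg (λ h → pow2 d (energy W (δ h)))     ≤⟨ avg-except (0F ∷ []) trivial each ⟩
      avg (λ _ → natℚ d * ε) + (1ℚ + 0ℚ) * ε  ≡⟨ cong (_+ (1ℚ + 0ℚ) * ε) (avg-const _) ⟩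
      natℚ d * ε + (1ℚ + 0ℚ) * ε              ≡⟨ solve 2 (λ n e → n :* e :+ (con 1ℚ :+ con 0ℚ) :* e := (con 1ℚ :+ n) :* e) refl (natℚ d) ε ⟩
      natℚ (suc d) * ε ∎
      where
      open ≤-Reasoning
      δ : Carrier → Carrier → Fin m → Carrier
      δ h y i = φ (y ⊕ h) i ⊝ φ y i
      trivial : ∀ h → pow2 d (energy W (δ h)) ≤ natℚ d * ε + 1ℚ
      trivial h = ≤-trans (pow2≤1 d (0≤≤1⇒Bd (energy≥0 W (δ h)) (energy-Bd {W} b (δ h)))) (≤-by (*-nn (natℚ≥0 d) 0≤ε) (+-comm (natℚ d * ε) 1ℚ))
      each : ∀ h → h ∉ (0F ∷ []) → pow2 d (energy W (δ h)) ≤ natℚ d * ε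
      each h h∉ = weyl W a b ker d (natF F (suc (suc d)) ⊗ (h ⊗ κ)) (δ h)
        (⊗≢0 (ch (suc (suc d)) (s≤s z≤n) ℕP.≤-refl) (⊗≢0 (λ q → h∉ (here q)) κ≢0)) (λ n l u → ch n l (ℕP.m≤n⇒m≤1+n u))
        (λ i → SP-cong (suc d) (S.solve 4 (λ n h k a → n S.:* (h S.:* (k S.:* a)) S.:= (n S.:* (h S.:* k)) S.:* a) refl (natF F (suc (suc d))) h κ (a i))
          (λ _ → refl) (sp i h))

    -- c i j is the coefficient of y^(j+1) in the i-th polynomial, of which evalD T uses the first T
    evalD : ℕ → (Fin m → ℕ → Carrier) → Carrier → Fin m → Carrier
    evalD zero c y i = 0F
    evalD (suc T) c y i = c i T ⊗ pw (suc T) y ⊕ evalD T c y i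

    SP-evalD : ∀ T c i → SP (suc T) (c i T) (λ y → evalD (suc T) c y i)
    SP-evalD′ : ∀ T c i → SP (suc T) 0F (λ y → evalD T c y i)
    SP-evalD′ zero c i = SP-raise 0 (λ _ → refl)
    SP-evalD′ (suc T) c i = SP-raise (suc T) (SP-evalD T c i)
    SP-evalD T c i = SP-cong (suc T) (trans (⊕-identityʳ _) (⊗-identityʳ _)) (λ _ → refl)
      (SP-+ (suc T) (SP-scale (suc T) (c i T) (SP-pw (suc T))) (SP-evalD′ T c i))

    along : (Fin m → Carrier) → Tensor → Tensor
    along a W z = avg (λ t → W (z ⊞ (λ i → t ⊗ a i)))

    along-invariant : ∀ a W z s → along a W (z ⊞ (λ i → s ⊗ a i)) ≡ along a W z
    along-invariant a W z s = trans (avg-cong (λ t → cong W (trans (⊞-assoc z _ _)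
        (⊞-cong z (λ i → S.solve 3 (λ s t a → s S.:* a S.:+ t S.:* a S.:= (s S.:+ t) S.:* a) refl s t (a i))))))
      (avg-shiftˡ s (λ t → W (z ⊞ (λ i → t ⊗ a i))))

    -- Successive averaging along the first T coefficient directions, that is, averaging over the
    -- cosets of their span.
    projection : ℕ → (Fin m → ℕ → Carrier) → Tensor → Tensor
    projection zero c W = W
    projection (suc T) c W = projection T c (along (λ i → c i T) W)

    discrepancy : ℕ → (Fin m → ℕ → Carrier) → Tensor → Tensor
    discrepancy T c W z = avg (λ y → W (z ⊞ evalD T c y)) - projection T c W z

    discrepancy² : ℕ → (Fin m → ℕ → Carrier) → Tensor → ℚ
    discrepancy² T c W = V.E {m} (λ z → discrepancy T c W z * discrepancy T c W z)

    discrepancy²≥0 : ∀ T c W → 0ℚ ≤ discrepancy² T c W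
    discrepancy²≥0 T c W = V.E-nn {m} (λ z → sq≥0 (discrepancy T c W z))

    half-difference : Tensor → Tensor → Tensor
    half-difference W W′ z = ½ * (W z - W′ z)

    -- `W` equals `W₁` + 2 `W₀`. The part `W₁` does not feel the monomial of top degree, and `W₀`
    -- averages to zero along its direction, as `weyl` demands. The ½ in `W₀` keeps it bounded;
    -- undoing it inside a square gives the factor 8.
    discrepancy-step : ∀ T c W → let W₁ = along (λ i → c i T) W ; W₀ = half-difference W W₁ in
      discrepancy² (suc T) c W ≤ 2ℚ * discrepancy² T c W₁ + (2ℚ * (2ℚ * 2ℚ)) * energy W₀ (evalD (suc T) c)
    discrepancy-step T c W = ≤-trans (V.E-mono {m} pointwise) (≤-reflexive
        (trans (V.E-+ {m} _ _) (cong₂ _+_ (V.E-* {m} 2ℚ _) (V.E-* {m} (2ℚ * (2ℚ * 2ℚ)) _))))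
      where
      a : Fin m → Carrier
      a i = c i T
      W₁ = along a W
      W₀ = half-difference W W₁
      X₀ : Tensor
      X₀ z = avg (λ y → W₀ (z ⊞ evalD (suc T) c y))
      drop-top : ∀ z y → W₁ (z ⊞ evalD T c y) ≡ W₁ (z ⊞ evalD (suc T) c y)
      drop-top z y = trans (sym (along-invariant a W (z ⊞ evalD T c y) (pw (suc T) y)))
        (cong W₁ (trans (⊞-assoc z _ _) (⊞-cong z (λ i → S.solve 3 (λ e p a → e S.:+ p S.:* a S.:= a S.:* p S.:+ e) refl (evalD T c y i) (pw (suc T) y) (a i)))))
      split : ∀ z → discrepancy (suc T) c W z ≡ discrepancy T c W₁ z + 2ℚ * X₀ z
      split z = trans (cong (_- projection T c W₁ z) (trans (avg-cong (λ y → trans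
            (solve 2 (λ w w₁ → w := w₁ :+ con 2ℚ :* (con ½ :* (w :- w₁))) refl (W (z ⊞ evalD (suc T) c y)) (W₁ (z ⊞ evalD (suc T) c y)))
            (cong (_+ 2ℚ * W₀ (z ⊞ evalD (suc T) c y)) (sym (drop-top z y)))))
          (trans (avg-+ _ _) (cong (avg (λ y → W₁ (z ⊞ evalD T c y)) +_) (avg-* 2ℚ _)))))
        (solve 3 (λ u x p → (u :+ x) :- p := (u :- p) :+ x) refl (avg (λ y → W₁ (z ⊞ evalD T c y))) (2ℚ * X₀ z) (projection T c W₁ z))
      pointwise : ∀ z → discrepancy (suc T) c W z * discrepancy (suc T) c W z ≤
        2ℚ * (discrepancy T c W₁ z * discrepancy T c W₁ z) + (2ℚ * (2ℚ * 2ℚ)) * (X₀ z * X₀ z)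
      pointwise z = ≤-trans (≤-reflexive (cong₂ _*_ (split z) (split z))) (≤-trans (sq-+ (discrepancy T c W₁ z) (2ℚ * X₀ z))
        (≤-reflexive (cong (2ℚ * (discrepancy T c W₁ z * discrepancy T c W₁ z) +_)
          (solve 1 (λ x → con 2ℚ :* ((con 2ℚ :* x) :* (con 2ℚ :* x)) := (con 2ℚ :* (con 2ℚ :* con 2ℚ)) :* (x :* x)) refl (X₀ z)))))

    kernel : ∀ a W z → avg (λ t → half-difference W (along a W) (z ⊞ (λ i → t ⊗ a i))) ≡ 0ℚ
    kernel a W z = trans (avg-* ½ _) (trans (cong (½ *_) (trans (M.E-sub _ _)
      (trans (cong (λ x → along a W z - x) (trans (avg-cong (λ t → along-invariant a W z t)) (avg-const _))) (+-inverseʳ (along a W z))))) (*-zeroʳ ½))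

8ℚ : ℚ
8ℚ = 2ℚ * (2ℚ * 2ℚ)

0≤8 : 0ℚ ≤ 8ℚ
0≤8 = *-nn 0≤2 (*-nn 0≤2 0≤2)

discN : ℕ → ℕ
discN zero = 0
discN (suc T) = discN T ℕ.+ T

discC : ℕ → ℚ
discC zero = 0ℚ
discC (suc T) = sumC (discN T) T (pow2 (discN T) 2ℚ * discC T) (pow2 T 8ℚ * natℚ T)

discC≥0 : ∀ T → 0ℚ ≤ discC T
discC≥0 zero = ≤-refl
discC≥0 (suc T) = sumC≥0 (discN T) T (*-nn (pow2-nn (discN T) 0≤2) (discC≥0 T)) (*-nn (pow2-nn T 0≤8) (natℚ≥0 T))

equidistribution : ∀ T F → let open Field F in let open Equidistribution F in ∀ {m} (c : Fin m → ℕ → Carrier) W → (∀ z → Bd (W z)) →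
  (∀ n → 0 ℕ.< n → n ℕ.≤ T → natF F n ≢ 0F) → pow2 (discN T) (discrepancy² T c W) ≤ discC T * ε
equidistribution zero F {m} c W b ch = ≤-reflexive (trans
  (trans (V.E-cong {m} (λ z → trans (cong₂ _*_ (zero-at z) (zero-at z)) (*-zeroˡ 0ℚ))) (V.E-const {m} 0ℚ)) (sym (*-zeroˡ ε)))
  where
  open Field F
  open Equidistribution F
  zero-at : ∀ z → discrepancy 0 c W z ≡ 0ℚ
  zero-at z = trans (cong (_- W z) (trans (avg-cong (λ y → cong W (⊞-0 z (λ _ → refl)))) (avg-const (W z)))) (+-inverseʳ (W z))
equidistribution (suc T) F {m} c W b ch = ≤-trans
  (pow2-mono (discN T ℕ.+ T) (discrepancy²≥0 (suc T) c W) (discrepancy-step T c W))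
  (small-+ 0≤ε ε≤1 (discN T) T (*-nn (pow2-nn (discN T) 0≤2) (discC≥0 T)) (*-nn (pow2-nn T 0≤8) (natℚ≥0 T))
    (*-nn 0≤2 (discrepancy²≥0 T c W₁)) (*-nn 0≤8 (energy≥0 W₀ (evalD (suc T) c)))
    (small-scale (discN T) 2ℚ 0≤2 (equidistribution T F c W₁ W₁-Bd (λ n l u → ch n l (ℕP.m≤n⇒m≤1+n u))))
    (small-scale T 8ℚ 0≤8 (weyl W₀ a (λ z → Bd-half-difference {a = W z} {b = W₁ z} (b z) (W₁-Bd z)) (kernel a W) T 1F (evalD (suc T) c) (λ q → 0≢1 (sym q)) ch
      (λ i → SP-cong (suc T) (S.solve 1 (λ a → a S.:= S.con (ℤ.+ 1) S.:* a) refl (c i T)) (λ _ → refl) (SP-evalD T c i)))))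
  where
  open Field F
  open Equidistribution F
  a : Fin m → Carrier
  a i = c i T
  W₁ = along a W
  W₀ = half-difference W W₁
  W₁-Bd : ∀ z → Bd (W₁ z)
  W₁-Bd z = M.Bd-E (λ t → b _)

-- One arbitrary slot: spanning directions and variance

δ : ∀ {m} (F : FiniteField) → Fin m → Fin m → Field.Carrier F
δ F zero zero = Field.1F F
δ F zero (suc j) = Field.0F F
δ F (suc i) zero = Field.0F F
δ F (suc i) (suc j) = δ F i j

module Base (F : FiniteField) where
  open Field F
  open Norms F
  open Polynomials F
  open Equidistribution F

  -- the linear combination of the first T coefficient vectors of c with weights w, highest coefficient first
  lin : ∀ {m} T → (Fin m → ℕ → Carrier) → (Fin T → Carrier) → Fin m → Carrier
  lin zero c w i = 0F
  lin (suc T) c w i = lin T c (w ∘ suc) i ⊕ w zero ⊗ c i T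

  lin-+ : ∀ {m} T (c : Fin m → ℕ → Carrier) w w′ i → lin T c (λ k → w k ⊕ w′ k) i ≡ lin T c w i ⊕ lin T c w′ i
  lin-+ zero c w w′ i = sym (⊕-identityʳ 0F)
  lin-+ (suc T) c w w′ i = trans (cong (_⊕ (w zero ⊕ w′ zero) ⊗ c i T) (lin-+ T c (w ∘ suc) (w′ ∘ suc) i))
    (S.solve 5 (λ a b u v c → (a S.:+ b) S.:+ (u S.:+ v) S.:* c S.:= (a S.:+ u S.:* c) S.:+ (b S.:+ v S.:* c)) refl
      (lin T c (w ∘ suc) i) (lin T c (w′ ∘ suc) i) (w zero) (w′ zero) (c i T))

  lin-* : ∀ {m} T (c : Fin m → ℕ → Carrier) a w i → lin T c (λ k → a ⊗ w k) i ≡ a ⊗ lin T c w i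
  lin-* zero c a w i = sym (⊗-zeroʳ a)
  lin-* (suc T) c a w i = trans (cong (_⊕ (a ⊗ w zero) ⊗ c i T) (lin-* T c a (w ∘ suc) i))
    (S.solve 4 (λ a l w c → a S.:* l S.:+ (a S.:* w) S.:* c S.:= a S.:* (l S.:+ w S.:* c)) refl a (lin T c (w ∘ suc) i) (w zero) (c i T))

  lin-0 : ∀ {m} T (c : Fin m → ℕ → Carrier) i → lin T c (λ _ → 0F) i ≡ 0F
  lin-0 zero c i = refl
  lin-0 (suc T) c i = trans (cong₂ _⊕_ (lin-0 T c i) (⊗-zeroˡ (c i T))) (⊕-identityʳ 0F)

  lin-cong : ∀ {m} T (c : Fin m → ℕ → Carrier) {w w′} → (∀ k → w k ≡ w′ k) → ∀ i → lin T c w i ≡ lin T c w′ i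
  lin-cong zero c p i = refl
  lin-cong (suc T) c p i = cong₂ (λ u v → u ⊕ v ⊗ c i T) (lin-cong T c (λ k → p (suc k)) i) (p zero)

  lookup-⊞ : ∀ {m} (z : Vec Carrier m) φ k → Vec.lookup (z ⊞ φ) k ≡ Vec.lookup z k ⊕ φ k
  lookup-⊞ (a ∷ z) φ zero = refl
  lookup-⊞ (a ∷ z) φ (suc k) = lookup-⊞ z (φ ∘ suc) k

  projection-E : ∀ {m} T c (W : Tensor {m}) z → projection T c W z ≡ V.E {T} (λ t → W (z ⊞ lin T c (Vec.lookup t)))
  projection-E zero c W z = cong W (sym (⊞-0 z (λ _ → refl)))
  projection-E (suc T) c W z = trans (projection-E T c _ z) (trans
    (V.E-cong {T} (λ t → avg-cong (λ s → cong W (⊞-assoc z _ _))))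
    (avg-fubini (meanV T) _))

  -- The vector (1,…,1) and the coefficient vectors span: B j has combination the j-th basis vector.
  Spans : ∀ {m} → ℕ → (Fin m → ℕ → Carrier) → Set
  Spans {m} T c = Σ (Fin m → Fin (suc T) → Carrier) λ B → ∀ i j → B j zero ⊕ lin T c (B j ∘ suc) i ≡ δ F i j

  aff : ∀ {m} T → (Fin m → ℕ → Carrier) → (Fin (suc T) → Carrier) → Fin m → Carrier
  aff T c w i = w zero ⊕ lin T c (w ∘ suc) i

  comb : ∀ {m k} → Vec Carrier m → (Fin m → Fin k → Carrier) → Fin k → Carrier
  comb [] B k = 0F
  comb (a ∷ s) B k = a ⊗ B zero k ⊕ comb s (B ∘ suc) k

  aff-+ : ∀ {m} T (c : Fin m → ℕ → Carrier) w w′ i → aff T c (λ k → w k ⊕ w′ k) i ≡ aff T c w i ⊕ aff T c w′ i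
  aff-+ T c w w′ i = trans (cong ((w zero ⊕ w′ zero) ⊕_) (lin-+ T c _ _ i))
    (S.solve 4 (λ a b c d → (a S.:+ b) S.:+ (c S.:+ d) S.:= (a S.:+ c) S.:+ (b S.:+ d)) refl (w zero) (w′ zero) _ _)

  select : ∀ {m} → Vec Carrier m → (Fin m → Carrier) → Carrier
  select [] g = 0F
  select (a ∷ s) g = a ⊗ g zero ⊕ select s (g ∘ suc)

  aff-comb : ∀ {m k} T (c : Fin m → ℕ → Carrier) (s : Vec Carrier k) (B : Fin k → Fin (suc T) → Carrier) i →
    aff T c (comb s B) i ≡ select s (λ j → aff T c (B j) i)
  aff-comb T c [] B i = trans (cong (0F ⊕_) (lin-0 T c i)) (⊕-identityʳ 0F)
  aff-comb T c (a ∷ s) B i = trans (aff-+ T c (λ k → a ⊗ B zero k) (comb s (B ∘ suc)) i)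
    (cong₂ _⊕_ (trans (cong (a ⊗ B zero zero ⊕_) (lin-* T c a (B zero ∘ suc) i)) (S.solve 3 (λ a b l → a S.:* b S.:+ a S.:* l S.:= a S.:* (b S.:+ l)) refl a _ _))
      (aff-comb T c s (B ∘ suc) i))

  select-0 : ∀ {m} (s : Vec Carrier m) g → (∀ j → g j ≡ 0F) → select s g ≡ 0F
  select-0 [] g p = refl
  select-0 (a ∷ s) g p = trans (cong₂ _⊕_ (trans (cong (a ⊗_) (p zero)) (⊗-zeroʳ a)) (select-0 s (g ∘ suc) (λ j → p (suc j)))) (⊕-identityʳ 0F)

  select-cong : ∀ {m} (s : Vec Carrier m) {g g′} → (∀ j → g j ≡ g′ j) → select s g ≡ select s g′
  select-cong [] p = refl
  select-cong (a ∷ s) p = cong₂ (λ u v → a ⊗ u ⊕ v) (p zero) (select-cong s (λ j → p (suc j)))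

  select-δ : ∀ {m} (s : Vec Carrier m) i → select s (δ F i) ≡ Vec.lookup s i
  select-δ (a ∷ s) zero = trans (cong₂ _⊕_ (⊗-identityʳ a) (select-0 s _ (λ _ → refl))) (⊕-identityʳ a)
  select-δ (a ∷ s) (suc i) = trans (cong₂ _⊕_ (⊗-zeroʳ a) (select-δ s i)) (⊕-identityˡ _)

  -- Adding `comb s B` to the integration variables changes nothing, but by `Spans` it adds s to the
  -- argument of `W`; averaging over s then gives the full mean.
  projection-total : ∀ {m} T c → Spans {m} T c → ∀ W z →
    avg (λ x → projection T c W (z ⊞ (λ _ → x))) ≡ V.E {m} W
  projection-total {m} T c (B , span) W z = begin
    avg (λ x → projection T c W (z ⊞ (λ _ → x)))
      ≡⟨ avg-cong (λ x → trans (projection-E T c W _) (V.E-cong {T} (λ t → cong W (⊞-assoc z _ _)))) ⟩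
    V.E {suc T} G                                               ≡⟨ sym (V.E-const {m} _) ⟩
    V.E {m} (λ s → V.E {suc T} G)                               ≡⟨ V.E-cong {m} (λ s → sym (E-⊞ (comb s B) G)) ⟩
    V.E {m} (λ s → V.E {suc T} (λ u → G (u ⊞ comb s B)))        ≡⟨ V.E-cong {m} (λ s → V.E-cong {suc T} (λ u → cong W (shift s u))) ⟩
    V.E {m} (λ s → V.E {suc T} (λ u → W (s ⊞ Vec.lookup (z ⊞ aff T c (Vec.lookup u))))) ≡⟨ meanV-comm (suc T) (meanV m) (λ s u → W (s ⊞ Vec.lookup (z ⊞ aff T c (Vec.lookup u)))) ⟩
    V.E {suc T} (λ u → V.E {m} (λ s → W (s ⊞ Vec.lookup (z ⊞ aff T c (Vec.lookup u))))) ≡⟨ V.E-cong {suc T} (λ u → E-⊞ (Vec.lookup (z ⊞ aff T c (Vec.lookup u))) W) ⟩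
    V.E {suc T} (λ u → V.E {m} W)                               ≡⟨ V.E-const {suc T} _ ⟩
    V.E {m} W ∎
    where
    open ≡-Reasoning
    G : Vec Carrier (suc T) → ℚ
    G u = W (z ⊞ aff T c (Vec.lookup u))
    shift : ∀ s u → z ⊞ aff T c (Vec.lookup (u ⊞ comb s B)) ≡ s ⊞ Vec.lookup (z ⊞ aff T c (Vec.lookup u))
    shift s u = trans (⊞-cong z (λ i → trans (cong₂ _⊕_ (lookup-⊞ u (comb s B) zero) (lin-cong T c (λ k → lookup-⊞ u (comb s B) (suc k)) i))
        (trans (aff-+ T c (Vec.lookup u) (comb s B) i) (cong (aff T c (Vec.lookup u) i ⊕_)
          (trans (aff-comb T c s B i) (trans (select-cong s (span i)) (select-δ s i)))))))
      (trans (sym (⊞-assoc z _ _)) (⊞-comm _ s))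

  variance : ∀ {m} T c → Tensor {m} → ℚ
  variance {m} T c W = V.E {m} (λ z → (avg (λ x → avg (λ y → W (z ⊞ (λ i → x ⊕ evalD T c y i)))) - V.E {m} W) *
                                      (avg (λ x → avg (λ y → W (z ⊞ (λ i → x ⊕ evalD T c y i)))) - V.E {m} W))

  variance≤ : ∀ {m} T c → Spans {m} T c → ∀ W → variance T c W ≤ discrepancy² T c W
  variance≤ {m} T c sp W = begin
    variance T c W                                                            ≡⟨ V.E-cong {m} (λ z → cong₂ _*_ (eq z) (eq z)) ⟩
    V.E {m} (λ z → avg (D z) * avg (D z))                                     ≤⟨ V.E-mono {m} (λ z → M.jensen (D z)) ⟩
    V.E {m} (λ z → avg (λ x → D z x * D z x))                                 ≡⟨ avg-fubini (meanV m) _ ⟩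
    avg (λ x → V.E {m} (λ z → D z x * D z x))                                 ≡⟨ avg-cong (λ x → E-⊞ (λ _ → x) (λ z → discrepancy T c W z * discrepancy T c W z)) ⟩
    avg (λ x → discrepancy² T c W)                                            ≡⟨ avg-const _ ⟩
    discrepancy² T c W ∎
    where
    open ≤-Reasoning
    D : Vec Carrier m → Carrier → ℚ
    D z x = discrepancy T c W (z ⊞ (λ _ → x))
    eq : ∀ z → avg (λ x → avg (λ y → W (z ⊞ (λ i → x ⊕ evalD T c y i)))) - V.E {m} W ≡ avg (D z)
    eq z = sym (trans (M.E-sub _ _) (cong₂ _-_ (avg-cong (λ x → avg-cong (λ y → cong W (⊞-assoc z _ _)))) (projection-total T c sp W z)))

  prodT : ∀ {m} → (Fin m → Fun) → Vec Carrier m → ℚ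
  prodT f z = prodF (λ i → f i (Vec.lookup z i))

  prodT-⊞ : ∀ {m} (f : Fin m → Fun) z φ → prodT f (z ⊞ φ) ≡ prodF (λ i → f i (Vec.lookup z i ⊕ φ i))
  prodT-⊞ f z φ = prodF-cong (λ i → cong (f i) (lookup-⊞ z φ i))

  E-prodT : ∀ {m} (f : Fin m → Fun) → V.E {m} (prodT f) ≡ prodF (λ i → avg (f i))
  E-prodT {zero} f = refl
  E-prodT {suc m} f = trans (avg-cong (λ a → V.E-* {m} (f zero a) (prodT (f ∘ suc)))) (trans (M.E-*ʳ (f zero) _) (cong (avg (f zero) *_) (E-prodT (f ∘ suc))))

  one : Fun
  one _ = 1ℚ

  -- Splitting off the factor at j; L is evaluation at a point or averaging.
  prodF-upd : ∀ {m} (L : Fin m → Fun → ℚ) (f : Fin m → Fun) j g →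
    (∀ k → L k one ≡ 1ℚ) → prodF (λ k → L k (upd f j g k)) ≡ L j g * prodF (λ k → L k (upd f j one k))
  prodF-upd L f zero g e = cong (L zero g *_) (sym (trans (cong (_* prodF (λ k → L (suc k) (f (suc k)))) (e zero)) (*-identityˡ _)))
  prodF-upd L f (suc j) g e = trans (cong (L zero (f zero) *_) (prodF-upd (L ∘ suc) (f ∘ suc) j g (e ∘ suc)))
    (solve 3 (λ a b c → a :* (b :* c) := b :* (a :* c)) refl (L zero (f zero)) (L (suc j) g) (prodF (λ k → L (suc k) (upd (f ∘ suc) j one k))))

  prodF-split : ∀ {m} (L : Fin m → Fun → ℚ) (f : Fin m → Fun) j →
    (∀ k → L k one ≡ 1ℚ) → prodF (λ k → L k (f k)) ≡ L j (f j) * prodF (λ k → L k (upd f j one k))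
  prodF-split L f zero e = cong (L zero (f zero) *_) (sym (trans (cong (_* prodF (λ k → L (suc k) (f (suc k)))) (e zero)) (*-identityˡ _)))
  prodF-split L f (suc j) e = trans (cong (L zero (f zero) *_) (prodF-split (L ∘ suc) (f ∘ suc) j (e ∘ suc)))
    (solve 3 (λ a b c → a :* (b :* c) := b :* (a :* c)) refl (L zero (f zero)) (L (suc j) (f (suc j))) (prodF (λ k → L (suc k) (upd (f ∘ suc) j one k))))

  at : ∀ {m} → (Fin m → Carrier) → Fin m → Fun → ℚ
  at x k f = f (x k)

  mean-of : ∀ {m} → Fin m → Fun → ℚ
  mean-of _ = avg

  mean-one : avg one ≡ 1ℚ
  mean-one = avg-const 1ℚ

  put : ∀ {m} → Vec Carrier m → Fin m → Carrier → Vec Carrier m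
  put z j w = z Vec.[ j ]≔ w

  -- Overwriting a coordinate by a fresh uniform one keeps the vector uniform; in `deviation-⋆` the
  -- fresh one is the translation parameter w.
  E-put : ∀ {m} j (G : Vec Carrier m → ℚ) → avg (λ w → V.E {m} (λ z → G (put z j w))) ≡ V.E {m} G
  E-put {suc m} zero G = avg-cong (λ w → avg-const _)
  E-put {suc m} (suc j) G = trans (avg-fubini meanF _) (avg-cong (λ a → E-put j (λ z → G (a ∷ z))))

  prodF-put : ∀ {m} (f : Fin m → Fun) j g z w (φ : Fin m → Carrier) →
    prodF (λ i → upd f j g i (Vec.lookup (put z j w) i ⊕ φ i)) ≡ g (w ⊕ φ j) * prodF (λ i → upd f j one i (Vec.lookup z i ⊕ φ i))
  prodF-put f zero g (a ∷ z) w φ = cong (g (w ⊕ φ zero) *_) (sym (*-identityˡ _))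
  prodF-put f (suc j) g (a ∷ z) w φ = trans (cong (f zero (a ⊕ φ zero) *_) (prodF-put (f ∘ suc) j g z w (φ ∘ suc)))
    (solve 3 (λ a b c → a :* (b :* c) := b :* (a :* c)) refl (f zero (a ⊕ φ zero)) (g (w ⊕ φ (suc j))) _)

  _⋆_ : Fun → Fun → Fun
  (u ⋆ v) x = avg (λ z → u z * v (z ⊕ x))

  avg-⋆ : ∀ u v → avg (u ⋆ v) ≡ avg u * avg v
  avg-⋆ u v = trans (avg-fubini meanF _) (trans (avg-cong (λ z → trans (avg-* (u z) _) (cong (u z *_) (avg-shiftˡ z v)))) (M.E-*ʳ u _))

  module _ {m : ℕ} (T : ℕ) (c : Fin m → ℕ → Carrier) where
    Lam : (Fin m → Fun) → ℚ
    Lam f = avg (λ x → avg (λ y → prodF (λ i → f i (x ⊕ evalD T c y i))))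

    deviation : (Fin m → Fun) → ℚ
    deviation f = Lam f - prodF (λ i → avg (f i))

    -- All slots but j hold convolutions u i ⋆ v i; averaging over translates w of the base point makes
    -- the function g in slot j part of a function on the whole space.
    deviation-⋆ : ∀ (u v₀ : Fin m → Fun) j g → let v = upd v₀ j one in (∀ i → Bdd (u i)) → (∀ x → u j x ≡ 1ℚ) →
      ∀ (f : Fin m → Fun) → (∀ x → f j x ≡ g x) → (∀ i → i ≢ j → ∀ x → f i x ≡ (u i ⋆ v i) x) →
      deviation f * deviation f ≤ variance T c (prodT (upd v₀ j g))
    deviation-⋆ u v₀ j g ub u1 f fj fi = begin
      deviation f * deviation f                                         ≡⟨ cong₂ _*_ dev-eq dev-eq ⟩
      wz.E (λ p → A p * (H p - μ)) * wz.E (λ p → A p * (H p - μ))         ≤⟨ wz.cs A (λ p → H p - μ) A-Bd ⟩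
      wz.E (λ p → (H p - μ) * (H p - μ))                                  ≡⟨ E-put j (λ z → (G z - μ) * (G z - μ)) ⟩
      variance T c (prodT (upd v₀ j g)) ∎
      where
      open ≤-Reasoning
      v = upd v₀ j one
      wz = meanF ×ᵐ meanV m
      module wz = Mean wz
      φ : Carrier → Carrier → Fin m → Carrier
      φ x y i = x ⊕ evalD T c y i
      μ = V.E {m} (prodT (upd v₀ j g))
      G : Vec Carrier m → ℚ
      G z = avg (λ x → avg (λ y → prodT (upd v₀ j g) (z ⊞ φ x y)))
      H : Carrier × Vec Carrier m → ℚ
      H (w , z) = G (put z j w)
      A : Carrier × Vec Carrier m → ℚ
      A (w , z) = prodF (λ i → u i (Vec.lookup z i ⊕ (⊖ w)))
      A-Bd : ∀ p → Bd (A p)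
      A-Bd (w , z) = prodF-Bd (λ i → ub i _)
      f⋆ : Fin m → Fun
      f⋆ i = u i ⋆ v i
      f-split : ∀ (x : Fin m → Carrier) → prodF (λ i → f i (x i)) ≡ g (x j) * prodF (λ i → f⋆ i (x i))
      f-split x = trans (prodF-split (at x) f j (λ _ → refl)) (cong₂ _*_ (fj (x j)) (prodF-cong same))
        where
        same : ∀ i → upd f j one i (x i) ≡ f⋆ i (x i)
        same i with i FinP.≟ j
        ... | yes refl = trans (cong (λ q → q (x i)) (upd-same f i one))
              (sym (trans (avg-cong (λ z → cong₂ _*_ (u1 z) (cong (λ q → q (z ⊕ x i)) (upd-same v₀ i one)))) (avg-const 1ℚ)))
        ... | no i≢j = trans (cong (λ q → q (x i)) (upd-other f j one i i≢j)) (fi i i≢j (x i))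
      -- The shift moves all dependence on w into the `u` factors, which only form a bounded weight;
      -- the `v` factors see z alone, and w is free to serve as coordinate `j`.
      translate : ∀ w i x → f⋆ i (w ⊕ x) ≡ avg (λ z → u i (z ⊕ (⊖ w)) * v i (z ⊕ x))
      translate w i x = trans (sym (avg-shift (⊖ w) (λ z → u i z * v i (z ⊕ (w ⊕ x)))))
        (avg-cong (λ z → cong (λ q → u i (z ⊕ (⊖ w)) * v i q) (S.solve 3 (λ z w x → (z S.:+ (S.:- w)) S.:+ (w S.:+ x) S.:= z S.:+ x) refl z w x)))
      H-eq : ∀ w z → H (w , z) ≡ avg (λ x → avg (λ y → g (w ⊕ φ x y j) * prodF (λ i → v i (Vec.lookup z i ⊕ φ x y i))))
      H-eq w z = avg-cong (λ x → avg-cong (λ y → trans (prodT-⊞ (upd v₀ j g) (put z j w) (φ x y)) (prodF-put v₀ j g z w (φ x y))))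
      Lam-w : ∀ w → Lam f ≡ V.E {m} (λ z → A (w , z) * H (w , z))
      Lam-w w = trans (sym (avg-shiftˡ w _)) (trans
        (avg-cong (λ x → avg-cong (λ y → trans (prodF-cong (λ i → cong (f i) (⊕-assoc w x (evalD T c y i)))) (trans (f-split (λ i → w ⊕ φ x y i))
          (trans (cong (g (w ⊕ φ x y j) *_) (trans (prodF-cong (λ i → translate w i (φ x y i)))
              (sym (trans (V.E-cong {m} (λ z → sym (prodF-* (λ i → u i (Vec.lookup z i ⊕ (⊖ w))) (λ i → v i (Vec.lookup z i ⊕ φ x y i)))))
                (E-prodT (λ i z → u i (z ⊕ (⊖ w)) * v i (z ⊕ φ x y i)))))))
            (trans (sym (V.E-* {m} (g (w ⊕ φ x y j)) _)) (V.E-cong {m} (λ z →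
              solve 3 (λ g a b → g :* (a :* b) := a :* (g :* b)) refl (g (w ⊕ φ x y j)) (A (w , z)) (prodF (λ i → v i (Vec.lookup z i ⊕ φ x y i)))))))))))
        (trans (avg-cong (λ x → meanV-comm m meanF _)) (trans (meanV-comm m meanF _) (V.E-cong {m} (λ z →
          trans (avg-cong (λ x → avg-* (A (w , z)) _)) (trans (avg-* (A (w , z)) _) (cong (A (w , z) *_) (sym (H-eq w z)))))))))
      main-w : ∀ w → prodF (λ i → avg (f i)) ≡ V.E {m} (λ z → A (w , z) * μ)
      main-w w = sym (trans (V.E-*ʳ {m} _ μ) (trans (cong₂ _*_ (trans (E-prodT (λ i z → u i (z ⊕ (⊖ w)))) (prodF-cong (λ i → avg-shift (⊖ w) (u i))))
          (trans (E-prodT (upd v₀ j g)) (prodF-upd mean-of v₀ j g (λ _ → mean-one))))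
        (trans (solve 3 (λ p g q → p :* (g :* q) := g :* (p :* q)) refl (prodF (λ i → avg (u i))) (avg g) (prodF (λ i → avg (v i))))
          (trans (cong (avg g *_) (sym (prodF-* (λ i → avg (u i)) (λ i → avg (v i)))))
            (trans (cong (avg g *_) (prodF-cong (λ i → sym (avg-⋆ (u i) (v i))))) (sym avg-split))))))
        where
        avg-split : prodF (λ i → avg (f i)) ≡ avg g * prodF (λ i → avg (f⋆ i))
        avg-split = trans (prodF-split mean-of f j (λ _ → mean-one)) (cong₂ _*_ (avg-cong fj) (prodF-cong same))
          where
          same : ∀ i → avg (upd f j one i) ≡ avg (f⋆ i)
          same i with i FinP.≟ j
          ... | yes refl = trans (cong avg (upd-same f i one))
                (avg-cong (λ x → sym (trans (avg-cong (λ z → cong₂ _*_ (u1 z) (cong (λ q → q (z ⊕ x)) (upd-same v₀ i one)))) (avg-const 1ℚ))))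
          ... | no i≢j = trans (cong avg (upd-other f j one i i≢j)) (avg-cong (fi i i≢j))
      dev-eq : deviation f ≡ wz.E (λ p → A p * (H p - μ))
      dev-eq = trans (sym (avg-const _)) (avg-cong (λ w → trans (cong₂ _-_ (Lam-w w) (main-w w))
        (trans (sym (V.E-sub {m} _ _)) (V.E-cong {m} (λ z → solve 3 (λ a h μ → a :* h :- a :* μ := a :* (h :- μ)) refl (A (w , z)) (H (w , z)) μ)))))

    Lam-upd : ∀ f i g → Lam (upd f i g) ≡ avg (λ x → avg (λ y → g (x ⊕ evalD T c y i) * prodF (λ k → upd f i one k (x ⊕ evalD T c y k))))
    Lam-upd f i g = avg-cong (λ x → avg-cong (λ y → prodF-upd (at (λ k → x ⊕ evalD T c y k)) f i g (λ _ → refl)))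

    Lam-split : ∀ f i → Lam f ≡ avg (λ x → avg (λ y → f i (x ⊕ evalD T c y i) * prodF (λ k → upd f i one k (x ⊕ evalD T c y k))))
    Lam-split f i = avg-cong (λ x → avg-cong (λ y → prodF-split (at (λ k → x ⊕ evalD T c y k)) f i (λ _ → refl)))

    means-upd : ∀ (f : Fin m → Fun) i g → prodF (λ k → avg (upd f i g k)) ≡ avg g * prodF (λ k → avg (upd f i one k))
    means-upd f i g = prodF-upd mean-of f i g (λ _ → mean-one)

    means-split : ∀ (f : Fin m → Fun) i → prodF (λ k → avg (f k)) ≡ avg (f i) * prodF (λ k → avg (upd f i one k))
    means-split f i = prodF-split mean-of f i (λ _ → mean-one)

    deviation-mean : ∀ f i (D : Carrier → Fun) → (∀ x → f i x ≡ avg (λ w → D w x)) → deviation f ≡ avg (λ w → deviation (upd f i (D w)))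
    deviation-mean f i D e = sym (trans (M.E-sub _ _) (cong₂ _-_ lam means))
      where
      rest : Carrier → Carrier → ℚ
      rest x y = prodF (λ k → upd f i one k (x ⊕ evalD T c y k))
      lam : avg (λ w → Lam (upd f i (D w))) ≡ Lam f
      lam = trans (avg-cong (λ w → Lam-upd f i (D w))) (trans (avg-fubini meanF _) (trans
        (avg-cong (λ x → trans (avg-fubini meanF _) (avg-cong (λ y → trans (M.E-*ʳ _ (rest x y))
          (cong (_* rest x y) (sym (e _)))))))
        (sym (Lam-split f i))))
      means : avg (λ w → prodF (λ k → avg (upd f i (D w) k))) ≡ prodF (λ k → avg (f k))
      means = trans (avg-cong (λ w → means-upd f i (D w))) (trans (M.E-*ʳ _ _)
        (trans (cong (_* prodF (λ k → avg (upd f i one k))) (trans (avg-fubini meanF _) (avg-cong (λ x → sym (e x))))) (sym (means-split f i))))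

    Pure : Fun → Set
    Pure D = Σ Fun λ u → Σ Fun λ v → Bdd u × Bdd v × (∀ x → D x ≡ (u ⋆ v) x)

    Small : ℕ → ℚ → (Fin m → Fun) → Set
    Small N C f = pow2 N (deviation f * deviation f) ≤ C * ε

    Wiener-slots : ∀ N C j → (∀ f → Bdd (f j) → (∀ i → i ≢ j → Pure (f i)) → Small N C f) →
      ∀ (todo : List (Fin m)) f → Bdd (f j) → (∀ i → i ≢ j → Pure (f i) ⊎ (i ∈ todo × Wiener (f i))) → Small N C f
    Wiener-slots N C j pure [] f b h = pure f b (λ i i≢j → only (h i i≢j))
      where
      only : ∀ {i} → Pure (f i) ⊎ (i ∈ [] × Wiener (f i)) → Pure (f i)
      only (inj₁ p) = p
      only (inj₂ (() , _))
    Wiener-slots N C j pure (i ∷ todo) f b h with i FinP.≟ j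
    ... | yes refl = Wiener-slots N C j pure todo f b (λ k k≢j → drop k≢j (h k k≢j))
      where
      drop : ∀ {k} → k ≢ i → Pure (f k) ⊎ (k ∈ (i ∷ todo) × Wiener (f k)) → Pure (f k) ⊎ (k ∈ todo × Wiener (f k))
      drop n (inj₁ p) = inj₁ p
      drop n (inj₂ (here e , w)) = ⊥-elim (n e)
      drop n (inj₂ (there r , w)) = inj₂ (r , w)
    ... | no i≢j = start (h i i≢j)
      where
      Off : (Fin m → Fun) → Set
      Off f = ∀ k → k ≢ j → k ≢ i → Pure (f k) ⊎ (k ∈ todo × Wiener (f k))
      off : Off f
      off k k≢j k≢i = drop (h k k≢j)
        where
        drop : Pure (f k) ⊎ (k ∈ (i ∷ todo) × Wiener (f k)) → Pure (f k) ⊎ (k ∈ todo × Wiener (f k))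
        drop (inj₁ p) = inj₁ p
        drop (inj₂ (here e , w)) = ⊥-elim (k≢i e)
        drop (inj₂ (there r , w)) = inj₂ (r , w)
      from-pure : ∀ f → Bdd (f j) → Pure (f i) → Off f → Small N C f
      from-pure f b p o = Wiener-slots N C j pure todo f b pick
        where
        pick : ∀ k → k ≢ j → Pure (f k) ⊎ (k ∈ todo × Wiener (f k))
        pick k k≢j with k FinP.≟ i
        ... | yes refl = inj₁ p
        ... | no k≢i = o k k≢j k≢i
      from-Wiener : ∀ {D} → Wiener D → ∀ f → Bdd (f j) → (∀ x → f i x ≡ D x) → Off f → Small N C f
      from-Wiener (conv u v p q _ e) f b eq o = from-pure f b (u , v , p , q , λ x → trans (eq x) (e x)) o
      from-Wiener (mean D ws e) f b eq o = begin
        pow2 N (deviation f * deviation f)                   ≡⟨ cong (λ d → pow2 N (d * d)) (deviation-mean f i D (λ x → trans (eq x) (e x))) ⟩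
        pow2 N (avg dev * avg dev)                           ≤⟨ pow2-mono N (sq≥0 (avg dev)) (M.jensen dev) ⟩
        pow2 N (avg (λ w → dev w * dev w))                   ≤⟨ M.pow2-jensen N _ ⟩
        avg (λ w → pow2 N (dev w * dev w))                   ≤⟨ M.E-≤const each ⟩
        C * ε ∎
        where
        open ≤-Reasoning
        dev : Carrier → ℚ
        dev w = deviation (upd f i (D w))
        each : ∀ w → pow2 N (dev w * dev w) ≤ C * ε
        each w = from-Wiener (ws w) (upd f i (D w)) (subst Bdd (sym (upd-other f i (D w) j (λ q → i≢j (sym q)))) b)
          (λ x → cong (λ q → q x) (upd-same f i (D w)))
          (λ k k≢j k≢i → subst (λ g → Pure g ⊎ (k ∈ todo × Wiener g)) (sym (upd-other f i (D w) k k≢i)) (o k k≢j k≢i))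
      start : Pure (f i) ⊎ (i ∈ (i ∷ todo) × Wiener (f i)) → Small N C f
      start (inj₁ p) = from-pure f b p off
      start (inj₂ (_ , w)) = from-Wiener w f b (λ _ → refl) off

    one-free-slot : Spans T c → (∀ n → 0 ℕ.< n → n ℕ.≤ T → natF F n ≢ 0F) → ∀ j f → Bdd (f j) → (∀ i → i ≢ j → Wiener (f i)) → Small (discN T) (discC T) f
    one-free-slot sp ch j f b w = Wiener-slots (discN T) (discC T) j pure (Data.List.allFin m) f b (λ i i≢j → inj₂ (∈-allFin i , w i i≢j))
      where
      pure : ∀ f → Bdd (f j) → (∀ i → i ≢ j → Pure (f i)) → Small (discN T) (discC T) f
      pure f b p = ≤-trans (pow2-mono (discN T) (sq≥0 (deviation f)) (≤-trans
          (deviation-⋆ u v j (f j) ub (λ x → cong (λ q → q x) u-j) f (λ _ → refl) f-eq) (variance≤ T c sp (prodT (upd v j (f j))))))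
        (equidistribution T F c (prodT (upd v j (f j))) (λ z → prodF-Bd (λ i → upd-all Bdd v j (f j) b (λ k _ → vb k) i (Vec.lookup z i))) ch)
        where
        -- In slot `j` both functions are the constant 1, as `deviation-⋆` asks of `u j`.
        pick : ∀ i → Σ Fun λ u → Σ Fun λ v → Bdd u × Bdd v × (i ≢ j → ∀ x → f i x ≡ (u ⋆ v) x) × (i ≡ j → u ≡ one)
        pick i with i FinP.≟ j
        ... | yes q = one , one , (λ _ → Bd-1) , (λ _ → Bd-1) , (λ n → ⊥-elim (n q)) , λ _ → refl
        ... | no n = let (u , v , ub , vb , e) = p i n in u , v , ub , vb , (λ _ → e) , λ q → ⊥-elim (n q)
        u v : Fin m → Fun
        u i = proj₁ (pick i)
        v i = proj₁ (proj₂ (pick i))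
        ub : ∀ i → Bdd (u i)
        ub i = proj₁ (proj₂ (proj₂ (pick i)))
        vb : ∀ i → Bdd (v i)
        vb i = proj₁ (proj₂ (proj₂ (proj₂ (pick i))))
        u-j : u j ≡ one
        u-j = proj₂ (proj₂ (proj₂ (proj₂ (proj₂ (pick j))))) refl
        f-eq : ∀ i → i ≢ j → ∀ x → f i x ≡ (u i ⋆ upd v j one i) x
        f-eq i n x = trans (proj₁ (proj₂ (proj₂ (proj₂ (proj₂ (pick i))))) n x) (cong (λ q → (u i ⋆ q) x) (sym (upd-other v j one i n)))

-- Induction on the number of arbitrary slots

module Slots (F : FiniteField) where
  open Field F
  open Norms F
  open Polynomials F
  open Equidistribution F
  open Base F

  δ-same : ∀ {m} (i : Fin m) → δ F i i ≡ 1F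
  δ-same zero = refl
  δ-same (suc i) = δ-same i

  δ-other : ∀ {m} (i j : Fin m) → i ≢ j → δ F i j ≡ 0F
  δ-other zero zero n = ⊥-elim (n refl)
  δ-other zero (suc j) n = refl
  δ-other (suc i) zero n = refl
  δ-other (suc i) (suc j) n = δ-other i j (λ q → n (cong suc q))

  monic : ∀ T → (ℕ → Carrier) → Poly (suc T)
  monic zero b = 1F ∷ []
  monic (suc T) b = b 0 ∷ monic T (b ∘ suc)

  cf-monic-top : ∀ T b → cf (monic T b) T ≡ 1F
  cf-monic-top zero b = refl
  cf-monic-top (suc T) b = cf-monic-top T (b ∘ suc)

  cf-monic-above : ∀ T b → Zab T (monic T b)
  cf-monic-above zero b (suc i) _ = refl
  cf-monic-above (suc T) b (suc i) (s≤s l) = cf-monic-above T (b ∘ suc) i l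

  cf-monic : ∀ T b j → j ℕ.< T → cf (monic T b) j ≡ b j
  cf-monic (suc T) b zero _ = refl
  cf-monic (suc T) b (suc j) (s≤s l) = cf-monic T (b ∘ suc) j l

  evalD-suc : ∀ {m} T (c : Fin m → ℕ → Carrier) y i → evalD (suc T) c y i ≡ y ⊗ (c i 0 ⊕ evalD T (λ k j → c k (suc j)) y i)
  evalD-suc zero c y i = S.solve 2 (λ c y → c S.:* (y S.:* S.con (ℤ.+ 1)) S.:+ S.con (ℤ.+ 0) S.:= y S.:* (c S.:+ S.con (ℤ.+ 0))) refl (c i 0) y
  evalD-suc (suc T) c y i = trans (cong (c i (suc T) ⊗ pw (suc (suc T)) y ⊕_) (evalD-suc T c y i))
    (S.solve 5 (λ a b p y e → a S.:* (y S.:* p) S.:+ y S.:* (b S.:+ e) S.:= y S.:* (b S.:+ (a S.:* p S.:+ e))) refl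
      (c i (suc T)) (c i 0) (pw (suc T) y) y (evalD T (λ k j → c k (suc j)) y i))

  ev-monic : ∀ {m} T (c : Fin m → ℕ → Carrier) y i → y ⊗ ev (monic T (c i)) y ≡ evalD T c y i ⊕ pw (suc T) y
  ev-monic zero c y i = S.solve 1 (λ y → y S.:* (S.con (ℤ.+ 1) S.:+ y S.:* S.con (ℤ.+ 0)) S.:= S.con (ℤ.+ 0) S.:+ y S.:* S.con (ℤ.+ 1)) refl y
  ev-monic (suc T) c y i = trans (cong (λ z → y ⊗ (c i 0 ⊕ z)) (ev-monic T (λ k j → c k (suc j)) y i))
    (trans (S.solve 4 (λ y c e p → y S.:* (c S.:+ (e S.:+ y S.:* p)) S.:= y S.:* (c S.:+ e) S.:+ y S.:* (y S.:* p)) refl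
        y (c i 0) (evalD T (λ k j → c k (suc j)) y i) (pw T y))
      (cong (_⊕ pw (suc (suc T)) y) (sym (evalD-suc T c y i))))

  lin-determined : ∀ {m} T (c : Fin m → ℕ → Carrier) w i i′ → (∀ j → j ℕ.< T → c i j ≡ c i′ j) → lin T c w i ≡ lin T c w i′
  lin-determined zero c w i i′ p = refl
  lin-determined (suc T) c w i i′ p = cong₂ (λ u v → u ⊕ w zero ⊗ v) (lin-determined T c (w ∘ suc) i i′ (λ j l → p j (ℕP.m<n⇒m<1+n l))) (p T ℕP.≤-refl)

  -- The common summand y^(T+1) is absorbed by a translation of x and gives all polynomials the same known degree.
  lifted : ∀ {m} T → (Fin m → ℕ → Carrier) → Fin m → Poly (suc (suc T))
  lifted T c i = 0F ∷ monic T (c i)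

  ev-lifted : ∀ {m} T (c : Fin m → ℕ → Carrier) y i → ev (lifted T c i) y ≡ evalD T c y i ⊕ pw (suc T) y
  ev-lifted T c y i = trans (⊕-identityˡ _) (ev-monic T c y i)

  -- A combination of (1,...,1) and the coefficient vectors takes equal values at slots with equal
  -- coefficients, so it could not be the basis vector at `l`.
  Spans⇒NC : ∀ {m} T (c : Fin m → ℕ → Carrier) → Spans T c → ∀ l i → i ≢ l → NC (lifted T c l) (lifted T c i)
  Spans⇒NC T c (B , span) l i i≢l e = 0≢1 (trans (sym (δ-other i l i≢l)) (trans (sym (span i l)) (trans
    (cong (B l zero ⊕_) (lin-determined T c _ i l (λ j j<T → trans (sym (cf-monic T (c i) j j<T)) (trans (sym (e j)) (cf-monic T (c l) j j<T)))))
    (trans (span l l) (δ-same l)))))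

  module _ (T : ℕ) where
    open Systems F T

    everything : ∀ {m} → (Fin m → Poly T) → (Fin m → Fun) → List Item
    everything {zero} q f = []
    everything {suc m} q f = (q zero , f zero) ∷ everything (q ∘ suc) (f ∘ suc)

    others : ∀ {m} → Fin m → (Fin m → Poly T) → (Fin m → Fun) → List Item
    others zero q f = everything (q ∘ suc) (f ∘ suc)
    others (suc l) q f = (q zero , f zero) ∷ others l (q ∘ suc) (f ∘ suc)

    prodI-everything : ∀ {m} (q : Fin m → Poly T) f x y → prodI (everything q f) x y ≡ prodF (λ i → f i (x ⊕ ev (q i) y))
    prodI-everything {zero} q f x y = refl
    prodI-everything {suc m} q f x y = cong (f zero (x ⊕ ev (q zero) y) *_) (prodI-everything (q ∘ suc) (f ∘ suc) x y)

    prodI-others : ∀ {m} l (q : Fin m → Poly T) f x y → prodI (others l q f) x y ≡ prodF (λ i → upd f l one i (x ⊕ ev (q i) y))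
    prodI-others zero q f x y = trans (prodI-everything (q ∘ suc) (f ∘ suc) x y) (sym (*-identityˡ _))
    prodI-others (suc l) q f x y = cong (f zero (x ⊕ ev (q zero) y) *_) (prodI-others l (q ∘ suc) (f ∘ suc) x y)

    All-everything : ∀ {m} {X : Item → Set} (q : Fin m → Poly T) f → (∀ i → X (q i , f i)) → All X (everything q f)
    All-everything {zero} q f p = []
    All-everything {suc m} q f p = p zero ∷ All-everything (q ∘ suc) (f ∘ suc) (λ i → p (suc i))

    All-others : ∀ {m} {X : Item → Set} l (q : Fin m → Poly T) f → (∀ i → i ≢ l → X (q i , f i)) → All X (others l q f)
    All-others zero q f p = All-everything (q ∘ suc) (f ∘ suc) (λ i → p (suc i) (λ ()))
    All-others (suc l) q f p = p zero (λ ()) ∷ All-others l (q ∘ suc) (f ∘ suc) (λ i n → p (suc i) (λ e → n (FinP.suc-injective e)))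

    length-everything : ∀ {m} (q : Fin m → Poly T) f → length (everything q f) ≡ m
    length-everything {zero} q f = refl
    length-everything {suc m} q f = cong suc (length-everything (q ∘ suc) (f ∘ suc))

    length-others : ∀ {m} l (q : Fin m → Poly T) f → length (others l q f) ℕ.≤ m
    length-others {suc m} zero q f = ℕP.m≤n⇒m≤1+n (ℕP.≤-reflexive (length-everything (q ∘ suc) (f ∘ suc)))
    length-others (suc l) q f = s≤s (length-others l (q ∘ suc) (f ∘ suc))

  Π-prodF : ∀ {k m} (p : Vec Pair k) (Γ : Fin m → Vec Carrier k → ℚ) → Π p (λ h → prodF (λ i → Γ i h)) ≡ prodF (λ i → Π p (Γ i))
  Π-prodF {m = zero} p Γ = Π-one p
    where
    Π-one : ∀ {k} (p : Vec Pair k) → Π p (λ _ → 1ℚ) ≡ 1ℚ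
    Π-one [] = refl
    Π-one (_ ∷ p) = trans (Π-cong p (λ _ → *-identityʳ 1ℚ)) (Π-one p)
  Π-prodF {m = suc m} p Γ = trans (Π-* p (Γ zero) _) (cong (Π p (Γ zero) *_) (Π-prodF p (Γ ∘ suc)))

  module _ {m : ℕ} (T : ℕ) (c : Fin m → ℕ → Carrier) where

    -- The product over the other slots, translated so that slot `l` sits at x itself; its mean over
    -- y is the dual function.
    dual : (Fin m → Fun) → Fin m → Carrier → Fun
    dual f l y x = prodF (λ i → upd f l one i (x ⊕ (evalD T c y i ⊝ evalD T c y l)))

    Lam-dual : ∀ f l h → Lam T c (upd f l h) ≡ avg (λ x → h x * avg (λ y → dual f l y x))
    Lam-dual f l h = begin
      Lam T c (upd f l h)                                        ≡⟨ trans (Lam-upd T c f l h) (avg-fubini meanF _) ⟩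
      avg (λ y → avg (λ x → h (x ⊕ evalD T c y l) * rest x y))   ≡⟨ avg-cong (λ y → sym (avg-shift (⊖ evalD T c y l) _)) ⟩
      avg (λ y → avg (λ x → h ((x ⊝ evalD T c y l) ⊕ evalD T c y l) * rest (x ⊝ evalD T c y l) y))
        ≡⟨ avg-cong (λ y → avg-cong (λ x → cong₂ _*_ (cong h (S.solve 2 (λ x e → (x S.:- e) S.:+ e S.:= x) refl x (evalD T c y l)))
             (prodF-cong (λ i → cong (upd f l one i) (S.solve 3 (λ x e d → (x S.:- e) S.:+ d S.:= x S.:+ (d S.:- e)) refl x (evalD T c y l) (evalD T c y i)))))) ⟩
      avg (λ y → avg (λ x → h x * dual f l y x))                 ≡⟨ avg-fubini meanF _ ⟩
      avg (λ x → avg (λ y → h x * dual f l y x))                 ≡⟨ avg-cong (λ x → avg-* (h x) _) ⟩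
      avg (λ x → h x * avg (λ y → dual f l y x)) ∎
      where
      open ≡-Reasoning
      rest : Carrier → Carrier → ℚ
      rest x y = prodF (λ k → upd f l one k (x ⊕ evalD T c y k))

    Lam-cong : ∀ {f g} → (∀ i x → f i x ≡ g i x) → Lam T c f ≡ Lam T c g
    Lam-cong p = avg-cong (λ x → avg-cong (λ y → prodF-cong (λ i → p i _)))

    upd-id : ∀ {n} (f : Fin n → Fun) l i x → upd f l (f l) i x ≡ f i x
    upd-id f zero zero x = refl
    upd-id f zero (suc i) x = refl
    upd-id f (suc l) zero x = refl
    upd-id f (suc l) (suc i) x = upd-id (f ∘ suc) l i x

    open Systems F (suc (suc T)) using (Λ)

    Lam-system : ∀ f l h → Lam T c (upd f l h) ≡ Λ one (lifted T c l) h (others (suc (suc T)) l (lifted T c) f)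
    Lam-system f l h = trans (Lam-upd T c f l h) (trans (avg-fubini meanF _) (trans
      (avg-cong (λ y → trans (sym (avg-shift (pw (suc T) y) _)) (avg-cong (λ x → trans
        (cong₂ _*_ (cong h (at-lift x y l)) (trans (prodF-cong (λ i → cong (upd f l one i) (at-lift x y i))) (sym (prodI-others (suc (suc T)) l (lifted T c) f x y))))
        (sym (*-identityˡ _))))))
      (avg-fubini meanF _)))
      where
      at-lift : ∀ x y i → (x ⊕ pw (suc T) y) ⊕ evalD T c y i ≡ x ⊕ ev (lifted T c i) y
      at-lift x y i = trans (S.solve 3 (λ x p e → (x S.:+ p) S.:+ e S.:= x S.:+ (e S.:+ p)) refl x (pw (suc T) y) (evalD T c y i)) (cong (x ⊕_) (sym (ev-lifted T c y i)))

-- The slots in `L` hold arbitrary bounded functions. `N` and `C` come before the field and the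
-- coefficients, which enter only through `Spans`.
record FreeSlots (T m : ℕ) (L : List (Fin m)) : Set₁ where
  field
    N : ℕ
    C : ℚ
    0≤C : 0ℚ ≤ C
    small : ∀ F → let open Field F in let open Norms F in let open Base F in CharAtLeast F (suc (suc T)) →
      ∀ (c : Fin m → ℕ → Carrier) → Spans T c → ∀ f → (∀ i → Bdd (f i)) → (∀ i → i ∉ L → Wiener (f i)) → Small T c N C f

-- Both hypotheses have one free slot fewer but serve different ends: `hj` is applied with a
-- convolution or the constant 1 in slot `l`, and `hl` once slot `j` is constant.
module FreeStep {T m : ℕ} (j l : Fin m) (L : List (Fin m)) (j≢l : j ≢ l) (hl : FreeSlots T m (l ∷ L)) (hj : FreeSlots T m (j ∷ L)) where
  module Hl = FreeSlots hl
  module Hj = FreeSlots hj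
  -- The lifted polynomials have degree T + 1, hence T + 2 coefficients, and differencing them needs
  -- characteristic at least T + 2.
  pet = controlled {suc (suc T)} T (suc (suc T)) m ℕP.≤-refl ℕP.≤-refl
  module Pet = Controlled pet
  2CB = pow2 Hj.N 2ℚ * Hj.C
  0≤2CB : 0ℚ ≤ 2CB
  0≤2CB = *-nn (pow2-nn Hj.N 0≤2) Hj.0≤C
  decN = Hj.N ℕ.+ Hj.N
  decC = sumC Hj.N Hj.N 2CB 2CB
  0≤decC : 0ℚ ≤ decC
  0≤decC = sumC≥0 Hj.N Hj.N 0≤2CB 0≤2CB
  lower = degree-lowering decN decC 0≤decC Pet.s
  lowN = proj₁ lower
  lowC = proj₁ (proj₂ lower)
  0≤lowC : 0ℚ ≤ lowC
  0≤lowC = proj₁ (proj₂ (proj₂ lower))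
  petC = Pet.C + 1ℚ
  0≤petC : 0ℚ ≤ petC
  0≤petC = +-nn Pet.0≤C 0≤1
  dualN = (Pet.N ℕ.+ lowN) ℕ.+ Hj.N
  dualC = domC Hj.N (domC lowN petC lowC) Hj.C
  0≤dualC : 0ℚ ≤ dualC
  0≤dualC = domC≥0 Hj.N (domC≥0 lowN 0≤petC 0≤lowC) Hj.0≤C

  module _ (F : FiniteField) where
    open Field F
    open Norms F
    open Polynomials F
    open Equidistribution F using (evalD)
    open Base F
    open Slots F

    module _ (char : CharAtLeast F (suc (suc T))) (c : Fin m → ℕ → Carrier) (sp : Spans T c)
             (f : Fin m → Fun) (fb : ∀ i → Bdd (f i)) (fw : ∀ i → i ∉ (j ∷ l ∷ L) → Wiener (f i)) where

      g : Carrier → Fun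
      g = dual T c f l

      gb : ∀ y → Bdd (g y)
      gb y x = prodF-Bd (λ i → upd-all Bdd f l one (λ _ → Bd-1) (λ k _ → fb k) i _)

      open Dual g gb renaming (f to G; fb to Gb)

      -- With x′ = x + z the form becomes `Lam` with the convolution `D` of Ψ and W in slot `l`, so
      -- `hj` applies; a second application, with 1 in slot `l`, evaluates the mean of W. Box
      -- products of averages of convolutions are again such averages, so the hypotheses on the
      -- other slots persist.
      decorrelated : Decorrelated decN decC
      decorrelated {k} p Ψ pd = begin
        pow2 decN (err W Ψ * err W Ψ)
          ≤⟨ pow2-mono decN (sq≥0 (err W Ψ)) err-sq ⟩
        pow2 decN (2ℚ * (d₁ * d₁) + 2ℚ * (d₂ * d₂))
          ≤⟨ small-+ 0≤ε ε≤1 Hj.N Hj.N 0≤2CB 0≤2CB (*-nn 0≤2 (sq≥0 d₁)) (*-nn 0≤2 (sq≥0 d₂))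
               (small-scale Hj.N 2ℚ 0≤2 (smallB D D-Bd D-Wiener)) (small-scale Hj.N 2ℚ 0≤2 (smallB one (λ _ → Bd-1) (Wiener-const Bd-1))) ⟩
        decC * ε ∎
        where
        open ≤-Reasoning
        W = Wᵖ p
        fᵖ : Fin m → Fun
        fᵖ i t = Π p (λ h → f i (t ⊕ sumV h))
        D : Fun
        D = Ψ ⋆ W
        D-Bd : Bdd D
        D-Bd x = M.Bd-E (λ z → Bd-* {Ψ z} (Conv-Bd pd z) (Wᵖ-Bd p (z ⊕ x)))
        D-Wiener : Wiener D
        D-Wiener = conv Ψ W (Conv-Bd pd) (Wᵖ-Bd p) tt (λ _ → refl)
        d₁ = deviation T c (upd fᵖ l D)
        d₂ = deviation T c (upd fᵖ l one)
        smallB : ∀ H → Bdd H → Wiener H → Small T c Hj.N Hj.C (upd fᵖ l H)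
        smallB H Hb Hw = Hj.small F char c sp (upd fᵖ l H)
          (upd-all Bdd fᵖ l H Hb (λ i _ t → Π-Bd p _ (λ h → fb i _)))
          slots
          where
          slots : ∀ i → i ∉ (j ∷ L) → Wiener (upd fᵖ l H i)
          slots i i∉ with i FinP.≟ l
          ... | yes refl = subst Wiener (sym (upd-same fᵖ i H)) Hw
          ... | no i≢l = subst Wiener (sym (upd-other fᵖ l H i i≢l))
                (Conv-Π Wiener-∙ p (λ h → sh (sumV h) (f i)) (λ h → Wiener-sh (sumV h) (fw i
                  (λ { (here e) → i∉ (here e) ; (there (here e)) → i≢l e ; (there (there r)) → i∉ (there r) }))))
        upd-Π : ∀ {n} (f : Fin n → Fun) l i t → Π p (λ h → upd f l one i (t ⊕ sumV h)) ≡ upd (λ i t → Π p (λ h → f i (t ⊕ sumV h))) l one i t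
        upd-Π f zero zero t = Π-prodF {m = 0} p (λ ())
        upd-Π f zero (suc i) t = refl
        upd-Π f (suc l) zero t = refl
        upd-Π f (suc l) (suc i) t = upd-Π (f ∘ suc) l i t
        gᵖ-eq : ∀ y x → gᵖ p y x ≡ dual T c fᵖ l y x
        gᵖ-eq y x = trans (Π-prodF p (λ i h → upd f l one i ((x ⊕ sumV h) ⊕ (evalD T c y i ⊝ evalD T c y l)))) (prodF-cong (λ i → trans
          (Π-cong p (λ h → cong (upd f l one i) (⊕-swap x (sumV h) (evalD T c y i ⊝ evalD T c y l))))
          (upd-Π f l i (x ⊕ (evalD T c y i ⊝ evalD T c y l)))))
        W-eq : ∀ x → W x ≡ avg (λ y → dual T c fᵖ l y x)
        W-eq x = avg-cong (λ y → gᵖ-eq y x)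
        form-eq : form W Ψ ≡ Lam T c (upd fᵖ l D)
        form-eq = trans (avg-cong (λ x → trans (sym (avg-shiftˡ x _)) (trans
            (avg-cong (λ z → trans (cong₂ (λ a b → (W x * W a) * Ψ b) (⊕-comm x z) (S.solve 2 (λ x z → (x S.:+ z) S.:- x S.:= z) refl x z))
              (solve 3 (λ a b c → (a :* b) :* c := (c :* b) :* a) refl (W x) (W (z ⊕ x)) (Ψ z))))
            (trans (M.E-*ʳ _ (W x)) (cong (D x *_) (W-eq x))))))
          (sym (Lam-dual T c fᵖ l D))
        avgW-eq : avg W ≡ Lam T c (upd fᵖ l one)
        avgW-eq = trans (avg-cong (λ x → trans (W-eq x) (sym (*-identityˡ _)))) (sym (Lam-dual T c fᵖ l one))
        π = prodF (λ i → avg (upd fᵖ l one i))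
        -- The main terms cancel because avg D = avg Ψ avg W.
        err-eq : err W Ψ ≡ d₁ - avg D * d₂
        err-eq = trans (cong₂ _-_ form-eq (trans (solve 2 (λ w z → (w :* w) :* z := (z :* w) :* w) refl (avg W) (avg Ψ))
            (cong₂ _*_ (sym (avg-⋆ Ψ W)) avgW-eq)))
          (trans (solve 4 (λ u a v q → u :- a :* v := (u :- a :* q) :- a :* (v :- q)) refl (Lam T c (upd fᵖ l D)) (avg D) (Lam T c (upd fᵖ l one)) π)
            (cong (λ z → (Lam T c (upd fᵖ l D) - z) - avg D * d₂) (sym (means-upd T c fᵖ l D))))
        err-sq : err W Ψ * err W Ψ ≤ 2ℚ * (d₁ * d₁) + 2ℚ * (d₂ * d₂)
        err-sq = begin
          err W Ψ * err W Ψ                                       ≡⟨ cong₂ _*_ err-eq err-eq ⟩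
          (d₁ - avg D * d₂) * (d₁ - avg D * d₂)                     ≤⟨ sq-+ d₁ (- (avg D * d₂)) ⟩
          2ℚ * (d₁ * d₁) + 2ℚ * ((- (avg D * d₂)) * (- (avg D * d₂)))
            ≡⟨ cong (λ z → 2ℚ * (d₁ * d₁) + 2ℚ * z) (solve 2 (λ a d → (:- (a :* d)) :* (:- (a :* d)) := (a :* a) :* (d :* d)) refl (avg D) d₂) ⟩
          2ℚ * (d₁ * d₁) + 2ℚ * ((avg D * avg D) * (d₂ * d₂))
            ≤⟨ +-monoʳ-≤ (2ℚ * (d₁ * d₁)) (*-monoL 0≤2 (*-monoR (sq≥0 d₂) (M.Bd-E D-Bd))) ⟩
          2ℚ * (d₁ * d₁) + 2ℚ * (1ℚ * (d₂ * d₂))                   ≡⟨ cong (λ z → 2ℚ * (d₁ * d₁) + 2ℚ * z) (*-identityˡ (d₂ * d₂)) ⟩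
          2ℚ * (d₁ * d₁) + 2ℚ * (d₂ * d₂) ∎

      Y : ℚ
      Y = avg (λ x → G x * G x)

      Y≥0 : 0ℚ ≤ Y
      Y≥0 = M.E-nn (λ x → sq≥0 (G x))

      Y-controlled : pow2 Pet.N Y ≤ petC * (U (suc Pet.s) G + ε)
      Y-controlled = ≤-trans (≤-reflexive (cong (pow2 Pet.N) (trans (sym (Lam-dual T c f l G)) (Lam-system T c f l G))))
        (≤-trans (Pet.control F record
          { char = char ; i = tt ; f₀ = one ; P = lifted T c l ; f = G ; is = others (suc (suc T)) l (lifted T c) f
          ; f₀-Bd = λ _ → Bd-1 ; f-Bd = Gb ; is-Bd = All-others (suc (suc T)) l (lifted T c) f (λ i _ → fb i)
          ; few = length-others (suc (suc T)) l (lifted T c) f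
          ; P-deg = lifted-deg l ; P-lead = λ e → 0≢1 (sym (trans (sym (cf-monic-top T (c l))) e)) ; P-X = tt
          ; is-X = All-others (suc (suc T)) l (lifted T c) f (λ i _ → lifted-deg i)
          ; is-NC = All-others (suc (suc T)) l (lifted T c) f (λ i n → Spans⇒NC T c sp l i n) })
        (≤-by (+-nn (*-nn Pet.0≤C (U≥0 Pet.s G)) 0≤ε)
          (solve 3 (λ c u e → (c :+ con 1ℚ) :* (u :+ e) := (u :+ c :* e) :+ (c :* u :+ e)) refl Pet.C (U (suc Pet.s) G) ε)))
        where
        lifted-deg : ∀ i → Zab (suc T) (lifted T c i)
        lifted-deg i (suc k) (s≤s u) = cf-monic-above T (c i) k u

      -- When slot j has mean zero, so has the dual function up to a small error; hence it is small in mean square.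
      Y-small : avg (f j) ≡ 0ℚ → pow2 dualN Y ≤ dualC * ε
      Y-small fj≡0 = subst (λ z → pow2 dualN Y ≤ dualC * z) (+-identityˡ ε)
        -- With 0 as the last quantity of the chain, domination up to ε becomes smallness.
        (dom-trans 0≤ε ε≤1 (Pet.N ℕ.+ lowN) Hj.N (domC≥0 lowN 0≤petC 0≤lowC) Hj.0≤C Y≥0 (U1≥0 G) ≤-refl
          (dom-trans 0≤ε ε≤1 Pet.N lowN 0≤petC 0≤lowC Y≥0 (U≥0 Pet.s G) (U1≥0 G) Y-controlled (proj₂ (proj₂ (proj₂ lower)) F g gb decorrelated))
          (≤-trans (≤-reflexive (cong (pow2 Hj.N) (trans (U1 G) (cong₂ _*_ avgG avgG))))
            (≤-trans (Hj.small F char c sp (upd f l one) (upd-all Bdd f l one (λ _ → Bd-1) (λ i _ → fb i)) slots)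
              (≤-reflexive (cong (Hj.C *_) (sym (+-identityˡ ε)))))))
        where
        slots : ∀ i → i ∉ (j ∷ L) → Wiener (upd f l one i)
        slots i i∉ with i FinP.≟ l
        ... | yes refl = subst Wiener (sym (upd-same f i one)) (Wiener-const Bd-1)
        ... | no i≢l = subst Wiener (sym (upd-other f l one i i≢l))
              (fw i (λ { (here e) → i∉ (here e) ; (there (here e)) → i≢l e ; (there (there r)) → i∉ (there r) }))
        avgG : avg G ≡ deviation T c (upd f l one)
        avgG = trans (avg-cong (λ x → sym (*-identityˡ (G x)))) (trans (sym (Lam-dual T c f l one))
          (sym (trans (cong (λ z → Lam T c (upd f l one) - z) means) (+-identityʳ _))))
          where
          means : prodF (λ i → avg (upd f l one i)) ≡ 0ℚ
          means = trans (means-split T c (upd f l one) j) (trans (cong (λ q → avg q * prodF (λ k → avg (upd (upd f l one) j one k))) (upd-other f l one j j≢l))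
            (trans (cong (_* prodF (λ k → avg (upd (upd f l one) j one k))) fj≡0) (*-zeroˡ (prodF (λ k → avg (upd (upd f l one) j one k))))))

      Lam-small : avg (f j) ≡ 0ℚ → pow2 dualN (Lam T c f * Lam T c f) ≤ dualC * ε
      Lam-small fj≡0 = ≤-trans (pow2-mono dualN (sq≥0 (Lam T c f)) (≤-trans (≤-reflexive (cong₂ _*_ eq eq)) (M.cs (f l) G (fb l)))) (Y-small fj≡0)
        where
        eq : Lam T c f ≡ avg (λ x → f l x * G x)
        eq = trans (Lam-cong T c (λ i x → sym (upd-id T c f l i x))) (Lam-dual T c f l (f l))

  -- Slot `j` is 2 `centred` plus its mean. The centred part has no main term and falls to
  -- `Lam-small`; the constant part carries the whole main term, and since a constant is a
  -- convolution, slot `j` is no longer free there and `hl` applies.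
  free-step : FreeSlots T m (j ∷ l ∷ L)
  free-step = record
    { N = dualN ℕ.+ Hl.N ; C = sumC dualN Hl.N (pow2 dualN 8ℚ * dualC) (pow2 Hl.N 2ℚ * Hl.C)
    ; 0≤C = sumC≥0 dualN Hl.N (*-nn (pow2-nn dualN 0≤8) 0≤dualC) (*-nn (pow2-nn Hl.N 0≤2) Hl.0≤C)
    ; small = result }
    where
    result : ∀ F → let open Field F in let open Norms F in let open Base F in CharAtLeast F (suc (suc T)) →
      ∀ (c : Fin m → ℕ → Carrier) → Spans T c → ∀ f → (∀ i → Bdd (f i)) → (∀ i → i ∉ (j ∷ l ∷ L) → Wiener (f i)) →
      Small T c (dualN ℕ.+ Hl.N) (sumC dualN Hl.N (pow2 dualN 8ℚ * dualC) (pow2 Hl.N 2ℚ * Hl.C)) f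
    result F char c sp f fb fw = ≤-trans
      (pow2-mono (dualN ℕ.+ Hl.N) (sq≥0 (deviation T c f)) (≤-trans (≤-reflexive (cong₂ _*_ dev-eq dev-eq))
        (≤-trans (sq-+ (2ℚ * x) d) (≤-reflexive (cong (_+ 2ℚ * (d * d))
          (solve 1 (λ x → con 2ℚ :* ((con 2ℚ :* x) :* (con 2ℚ :* x)) := con 8ℚ :* (x :* x)) refl x))))))
      (small-+ 0≤ε ε≤1 dualN Hl.N (*-nn (pow2-nn dualN 0≤8) 0≤dualC) (*-nn (pow2-nn Hl.N 0≤2) Hl.0≤C) (*-nn 0≤8 (sq≥0 x)) (*-nn 0≤2 (sq≥0 d))
        (small-scale dualN 8ℚ 0≤8 (Lam-small F char c sp fa fa-Bd fa-W fa-mean))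
        (small-scale Hl.N 2ℚ 0≤2 (Hl.small F char c sp fc fc-Bd fc-W)))
      where
      open Field F
      open Norms F
      open Equidistribution F using (evalD; Bd-half-difference)
      open Base F
      open Slots F
      μ = avg (f j)
      centred constant : Fun
      centred x = ½ * (f j x - μ)
      constant _ = μ
      fa fc : Fin m → Fun
      fa = upd f j centred
      fc = upd f j constant
      x = Lam T c fa
      d = deviation T c fc
      μ-Bd : Bd μ
      μ-Bd = M.Bd-E (fb j)
      fa-Bd : ∀ i → Bdd (fa i)
      fa-Bd = upd-all Bdd f j centred (λ x → Bd-half-difference {f j x} {μ} (fb j x) μ-Bd) (λ i _ → fb i)
      fc-Bd : ∀ i → Bdd (fc i)
      fc-Bd = upd-all Bdd f j constant (λ _ → μ-Bd) (λ i _ → fb i)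
      fa-W : ∀ i → i ∉ (j ∷ l ∷ L) → Wiener (fa i)
      fa-W i i∉ = subst Wiener (sym (upd-other f j centred i (λ e → i∉ (here e)))) (fw i i∉)
      fc-W : ∀ i → i ∉ (l ∷ L) → Wiener (fc i)
      fc-W i i∉ with i FinP.≟ j
      ... | yes refl = subst Wiener (sym (upd-same f i constant)) (Wiener-const {μ} μ-Bd)
      ... | no i≢j = subst Wiener (sym (upd-other f j constant i i≢j)) (fw i (λ { (here e) → i≢j e ; (there r) → i∉ r }))
      centred-mean : avg centred ≡ 0ℚ
      centred-mean = trans (avg-* ½ _) (trans (cong (½ *_) (trans (M.E-sub _ _) (trans (cong (λ z → μ - z) (avg-const μ)) (+-inverseʳ μ)))) (*-zeroʳ ½))
      fa-mean : avg (fa j) ≡ 0ℚ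
      fa-mean = trans (cong avg (upd-same f j centred)) centred-mean
      rest : Carrier → Carrier → ℚ
      rest x y = prodF (λ k → upd f j one k (x ⊕ evalD T c y k))
      Lam-eq : Lam T c f ≡ 2ℚ * x + Lam T c fc
      Lam-eq = trans (Lam-split T c f j) (trans (avg-cong (λ x → trans (avg-cong (λ y →
            solve 3 (λ a m r → a :* r := con 2ℚ :* ((con ½ :* (a :- m)) :* r) :+ m :* r) refl (f j (x ⊕ evalD T c y j)) μ (rest x y)))
          (trans (avg-+ _ _) (cong (_+ avg (λ y → μ * rest x y)) (avg-* 2ℚ _)))))
        (trans (avg-+ _ _) (cong₂ _+_ (trans (avg-* 2ℚ _) (cong (2ℚ *_) (sym (Lam-upd T c f j centred)))) (sym (Lam-upd T c f j constant)))))
      means-eq : prodF (λ i → avg (f i)) ≡ prodF (λ i → avg (fc i))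
      means-eq = trans (means-split T c f j) (trans (cong (_* prodF (λ k → avg (upd f j one k))) (sym (avg-const μ))) (sym (means-upd T c f j constant)))
      dev-eq : deviation T c f ≡ 2ℚ * x + d
      dev-eq = trans (cong₂ _-_ Lam-eq means-eq) (+-assoc (2ℚ * x) (Lam T c fc) _)

free-slots : ∀ T m k (L : List (Fin m)) → length L ≡ suc k → FreeSlots T m L
free-slots T m zero (j ∷ []) refl = record
  { N = discN T ; C = discC T ; 0≤C = discC≥0 T
  ; small = λ F char c sp f fb fw → Base.one-free-slot F T c sp (λ n l u → char n l (s≤s (ℕP.m≤n⇒m≤1+n u))) j f (fb j)
      (λ i i≢j → fw i (λ { (here e) → i≢j e })) }
free-slots T m (suc k) (j ∷ l ∷ L) e with j FinP.≟ l
... | no j≢l = FreeStep.free-step j l L j≢l (free-slots T m k (l ∷ L) (ℕP.suc-injective e)) (free-slots T m k (j ∷ L) (ℕP.suc-injective e))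
-- A repeated slot adds no freedom, so the shorter list serves.
... | yes refl = record { N = N ; C = C ; 0≤C = 0≤C
    ; small = λ F char c sp f fb fw → small F char c sp f fb (λ i i∉ → fw i (λ { (here q) → i∉ (here q) ; (there r) → i∉ r })) }
  where open FreeSlots (free-slots T m k (j ∷ L) (ℕP.suc-injective e))

-- Rational independence as integral duality

fromℤ : ℤ → ℚ
fromℤ i = i / 1

toℚᵘ-fromℤ : ∀ i → toℚᵘ (fromℤ i) ℚᵘ.≃ ℚᵘ.mkℚᵘ i 0
toℚᵘ-fromℤ i = toℚᵘ-fromℚᵘ (ℚᵘ.mkℚᵘ i 0)

fromℤ-* : ∀ i j → fromℤ i * fromℤ j ≡ fromℤ (i ℤ.* j)
fromℤ-* i j = toℚᵘ-injective (ℚᵘP.≃-trans (toℚᵘ-homo-* (fromℤ i) (fromℤ j))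
  (ℚᵘP.≃-trans (ℚᵘP.*-cong (toℚᵘ-fromℤ i) (toℚᵘ-fromℤ j)) (ℚᵘP.≃-sym (toℚᵘ-fromℤ (i ℤ.* j)))))

fromℤ-+ : ∀ i j → fromℤ i + fromℤ j ≡ fromℤ (i ℤ.+ j)
fromℤ-+ i j = toℚᵘ-injective (ℚᵘP.≃-trans (toℚᵘ-homo-+ (fromℤ i) (fromℤ j))
  (ℚᵘP.≃-trans (ℚᵘP.+-cong (toℚᵘ-fromℤ i) (toℚᵘ-fromℤ j))
    (ℚᵘP.≃-trans (ℚᵘ.*≡* (cong (ℤ._* ℤ.+ 1) (cong₂ ℤ._+_ (ℤP.*-identityʳ i) (ℤP.*-identityʳ j)))) (ℚᵘP.≃-sym (toℚᵘ-fromℤ (i ℤ.+ j))))))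

fromℤ-injective : ∀ i → fromℤ i ≡ 0ℚ → i ≡ ℤ.+ 0
fromℤ-injective i e with ℚᵘP.≃-trans (ℚᵘP.≃-sym (toℚᵘ-fromℤ i)) (toℚᵘ-cong e)
... | ℚᵘ.*≡* q = trans (sym (ℤP.*-identityʳ i)) (trans q (ℤP.*-zeroˡ (ℤ.+ 1)))

sumℚ-suc : ∀ {m} (f : Fin (suc m) → ℚ) → sumℚ f ≡ f zero + sumℚ (f ∘ suc)
sumℚ-suc {m} f = cong (λ xs → f zero + Data.List.foldr _+_ 0ℚ xs)
  (trans (ListP.map-tabulate suc f) (sym (ListP.map-tabulate (λ i → i) (f ∘ suc))))

sumℚ-fromℤ : ∀ {m} (s : Fin m → ℤ) (f : Fin m → ℤ) → sumℚ (λ i → fromℤ (s i) * fromℤ (f i)) ≡ fromℤ (Integers.sumᶻ (λ i → s i ℤ.* f i))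
sumℚ-fromℤ {zero} s f = refl
sumℚ-fromℤ {suc m} s f = trans (sumℚ-suc (λ i → fromℤ (s i) * fromℤ (f i))) (trans (cong₂ _+_ (fromℤ-* (s zero) (f zero)) (sumℚ-fromℤ (s ∘ suc) (f ∘ suc))) (fromℤ-+ (s zero ℤ.* f zero) _))

shifted-coeffs : ∀ {m} → (Fin m → List ℤ) → Fin m → ℕ → ℤ
shifted-coeffs P i d = coeff (P i) (suc d)

-- Constant coefficients vanish by hypothesis and those beyond y^T by length, so an integer
-- dependence among the T remaining ones is already a dependence of the polynomials.
independent⇒dual : ∀ {m} T (P : Fin m → List ℤ) → (∀ i → length (P i) ℕ.≤ suc T) → (∀ i → ZeroConstTerm (P i)) → LinIndepℚ P →
  Integers.Dual T (shifted-coeffs P)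
independent⇒dual {m} T P len zc ind with Integers.dual-or-dependent T (shifted-coeffs P)
... | inj₁ d = d
... | inj₂ (s , i , s≢0 , e) = ⊥-elim (s≢0 (fromℤ-injective (s i) (ind (λ i → fromℤ (s i)) vanish i)))
  where
  all-zero : ∀ j → (∀ i → coeff (P i) j ≡ ℤ.+ 0) → sumℚ (λ i → fromℤ (s i) * (coeff (P i) j / 1)) ≡ 0ℚ
  all-zero j z = trans (sumℚ-fromℤ s (λ i → coeff (P i) j)) (cong fromℤ (trans
    (Integers.Σᶜ.sum-cong-≗ (λ i → trans (cong (s i ℤ.*_) (z i)) (ℤP.*-zeroʳ (s i)))) (Integers.Σᶜ.sum-replicate-zero m)))
  vanish : ∀ j → sumℚ (λ i → fromℤ (s i) * (coeff (P i) j / 1)) ≡ 0ℚ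
  vanish zero = all-zero zero zc
  vanish (suc d) with suc d ℕP.≤? T
  ... | yes l = trans (sumℚ-fromℤ s (λ i → coeff (P i) (suc d))) (cong fromℤ (e d l))
  ... | no n = all-zero (suc d) (λ i → Integers.coeff-beyond (P i) (suc d) (ℕP.≤-trans (len i) (ℕP.≰⇒> n)))

-- From counting to averages

module Encoding (F : FiniteField) where
  open Field F
  open Norms F
  open Polynomials F
  open Equidistribution F
  open Base F
  open Slots F

  natF≡ι : ∀ n → natF F n ≡ S.ι (ℤ.+ n)
  natF≡ι zero = refl
  natF≡ι (suc n) = cong (1F ⊕_) (natF≡ι n)

  intF≡ι : ∀ z → intF F z ≡ S.ι z
  intF≡ι (ℤ.+ n) = natF≡ι n
  intF≡ι ℤ.-[1+ n ] = cong ⊖_ (natF≡ι (suc n))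

  intF-+ : ∀ a b → intF F (a ℤ.+ b) ≡ intF F a ⊕ intF F b
  intF-+ a b = trans (intF≡ι (a ℤ.+ b)) (trans (S.ι-+ a b) (sym (cong₂ _⊕_ (intF≡ι a) (intF≡ι b))))

  intF-* : ∀ a b → intF F (a ℤ.* b) ≡ intF F a ⊗ intF F b
  intF-* a b = trans (intF≡ι (a ℤ.* b)) (trans (S.ι-* a b) (sym (cong₂ _⊗_ (intF≡ι a) (intF≡ι b))))

  intF-1 : intF F (ℤ.+ 1) ≡ 1F
  intF-1 = ⊕-identityʳ 1F

  intF≢0 : ∀ z c → z ≢ ℤ.+ 0 → ℤ.∣ z ∣ ℕ.< c → CharAtLeast F c → intF F z ≢ 0F
  intF≢0 (ℤ.+ zero) c n _ _ = ⊥-elim (n refl)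
  intF≢0 (ℤ.+ suc k) c n l ch = ch (suc k) (s≤s z≤n) l
  intF≢0 ℤ.-[1+ k ] c n l ch e = ch (suc k) (s≤s z≤n) l
    (trans (S.solve 1 (λ x → x S.:= S.:- (S.:- x)) refl (natF F (suc k))) (trans (cong ⊖_ e) (S.solve 0 (S.:- S.con (ℤ.+ 0) S.:= S.con (ℤ.+ 0)) refl)))

  -- Mediates between `lin`, whose weights start at the highest coefficient, and `dot`, which is
  -- indexed from the lowest.
  reversed : ∀ T → (ℕ → Carrier) → Fin T → Carrier
  reversed (suc T) b zero = b T
  reversed (suc T) b (suc k) = reversed T b k

  module _ {m : ℕ} (P : Fin m → List ℤ) where
    -- slot 0 is the base point of the progression
    slots : Fin (suc m) → ℕ → Carrier
    slots zero j = 0F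
    slots (suc i) j = intF F (shifted-coeffs P i j)

    evalD-zero : ∀ {n} T (c : Fin n → ℕ → Carrier) y i → (∀ j → c i j ≡ 0F) → evalD T c y i ≡ 0F
    evalD-zero zero c y i z = refl
    evalD-zero (suc T) c y i z = trans (cong₂ (λ a b → a ⊗ pw (suc T) y ⊕ b) (z T) (evalD-zero T c y i z)) (trans (⊕-identityʳ _) (⊗-zeroˡ _))

    evalF-evalD : ∀ {n} T (as : List ℤ) (c : Fin n → ℕ → Carrier) i y → (∀ j → c i j ≡ intF F (coeff as j)) → length as ℕ.≤ T → y ⊗ evalF F as y ≡ evalD T c y i
    evalF-evalD T [] c i y e _ = trans (⊗-zeroʳ y) (sym (evalD-zero T c y i e))
    evalF-evalD (suc T) (a ∷ as) c i y e (s≤s l) = trans (cong₂ (λ u v → y ⊗ (u ⊕ v)) (sym (e 0)) (evalF-evalD T as (λ k j → c k (suc j)) i y (λ j → e (suc j)) l))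
      (sym (evalD-suc T c y i))

    evalF-slots : ∀ T i y → ZeroConstTerm (P i) → length (P i) ℕ.≤ suc T → evalF F (P i) y ≡ evalD T slots y (suc i)
    evalF-slots T i y = go (P i) (λ _ → refl)
      where
      go : ∀ as → (∀ j → slots (suc i) j ≡ intF F (coeff as (suc j))) → ZeroConstTerm as → length as ℕ.≤ suc T → evalF F as y ≡ evalD T slots y (suc i)
      go [] e _ _ = sym (evalD-zero T slots y (suc i) e)
      go (a ∷ as) e z (s≤s l) = trans (cong (λ x → intF F x ⊕ y ⊗ evalF F as y) z) (trans (⊕-identityˡ _) (evalF-evalD T as slots (suc i) y e l))

    module _ (T : ℕ) (du : Integers.Dual T (shifted-coeffs P)) (N≢0 : intF F (Integers.Dual.N du) ≢ 0F) where
      open Integers.Dual du using (N; b; duality)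

      ν : Carrier
      ν = proj₁ (F-inverse (intF F N) N≢0)

      δ-intF : ∀ {n} (i j : Fin n) → intF F (Integers.δᶻ i j) ≡ δ F i j
      δ-intF zero zero = intF-1
      δ-intF zero (suc j) = refl
      δ-intF (suc i) zero = refl
      δ-intF (suc i) (suc j) = δ-intF i j

      weights : Fin m → Fin (suc T) → Carrier
      weights j zero = 0F
      weights j (suc k) = reversed T (λ d → intF F (b j d) ⊗ ν) k

      lin-zero : ∀ T w → lin T slots w zero ≡ 0F
      lin-zero zero w = refl
      lin-zero (suc T) w = trans (cong₂ _⊕_ (lin-zero T (w ∘ suc)) (⊗-zeroʳ _)) (⊕-identityʳ 0F)

      lin-dot : ∀ T (u : ℕ → ℤ) i → lin T slots (reversed T (λ d → intF F (u d) ⊗ ν)) (suc i) ≡ intF F (Integers.dot T (shifted-coeffs P i) u) ⊗ ν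
      lin-dot zero u i = sym (⊗-zeroˡ ν)
      lin-dot (suc T) u i = trans (cong (_⊕ (intF F (u T) ⊗ ν) ⊗ a) (lin-dot T u i))
        (trans (S.solve 4 (λ d u v a → d S.:* v S.:+ (u S.:* v) S.:* a S.:= (d S.:+ a S.:* u) S.:* v) refl (intF F (Integers.dot T (shifted-coeffs P i) u)) (intF F (u T)) ν a)
          (cong (_⊗ ν) (sym (trans (intF-+ (Integers.dot T (shifted-coeffs P i) u) _) (cong (intF F (Integers.dot T (shifted-coeffs P i) u) ⊕_) (intF-* (shifted-coeffs P i T) (u T)))))))
        where a = intF F (shifted-coeffs P i T)

      aff-weights : ∀ i j → aff T slots (weights j) (suc i) ≡ δ F i j
      aff-weights i j = trans (⊕-identityˡ _) (trans (lin-dot T (b j) i) (trans (cong (λ z → intF F z ⊗ ν) (duality i j))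
        (trans (cong (_⊗ ν) (intF-* N (Integers.δᶻ i j))) (trans (S.solve 3 (λ n d v → (n S.:* d) S.:* v S.:= (n S.:* v) S.:* d) refl (intF F N) (intF F (Integers.δᶻ i j)) ν)
          (trans (cong₂ _⊗_ (proj₂ (F-inverse (intF F N) N≢0)) (δ-intF i j)) (S.solve 1 (λ d → S.con (ℤ.+ 1) S.:* d S.:= d) refl (δ F i j)))))))

      aff-weights-zero : ∀ j → aff T slots (weights j) zero ≡ 0F
      aff-weights-zero j = trans (⊕-identityˡ _) (lin-zero T _)

      base-weights : Fin (suc T) → Carrier
      base-weights zero = 1F
      base-weights (suc k) = 0F

      aff-base : ∀ i → aff T slots base-weights i ≡ 1F
      aff-base i = trans (cong (1F ⊕_) (lin-0 T slots i)) (⊕-identityʳ 1F)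

      minus : Vec Carrier m
      minus = Vec.replicate m (⊖ 1F)

      dual-weights : Fin (suc m) → Fin (suc T) → Carrier
      -- Slot 0 has zero coefficients, so its basis vector is (1,...,1) minus all the others.
      dual-weights zero k = base-weights k ⊕ comb minus weights k
      dual-weights (suc j) = weights j

      spans : Spans T slots
      spans = dual-weights , check
        where
        base : ∀ i → aff T slots (dual-weights zero) i ≡ 1F ⊕ select minus (λ j → aff T slots (weights j) i)
        base i = trans (aff-+ T slots base-weights (comb minus weights) i) (cong₂ _⊕_ (aff-base i) (aff-comb T slots minus weights i))
        check : ∀ i j → aff T slots (dual-weights j) i ≡ δ F i j
        check zero zero = trans (base zero) (trans (cong (1F ⊕_) (select-0 minus _ aff-weights-zero)) (⊕-identityʳ 1F))
        check zero (suc j) = aff-weights-zero j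
        check (suc i) zero = trans (base (suc i)) (trans (cong (1F ⊕_) (trans (select-cong minus (aff-weights i)) (trans (select-δ minus i) (VecP.lookup-replicate i (⊖ 1F))))) (⊕-inverseʳ 1F))
        check (suc i) (suc j) = aff-weights i j

natℚ-+ : ∀ a b → natℚ (a ℕ.+ b) ≡ natℚ a + natℚ b
natℚ-+ zero b = sym (+-identityˡ _)
natℚ-+ (suc a) b = trans (cong (1ℚ +_) (natℚ-+ a b)) (sym (+-assoc 1ℚ (natℚ a) (natℚ b)))

natℚ-* : ∀ a b → natℚ (a ℕ.* b) ≡ natℚ a * natℚ b
natℚ-* zero b = sym (*-zeroˡ (natℚ b))
natℚ-* (suc a) b = trans (natℚ-+ b (a ℕ.* b)) (trans (cong (natℚ b +_) (natℚ-* a b))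
  (solve 2 (λ a b → b :+ a :* b := (con 1ℚ :+ a) :* b) refl (natℚ a) (natℚ b)))

natℚ-reflects : ∀ {a b} → natℚ a ≤ natℚ b → a ℕ.≤ b
natℚ-reflects {a} {b} l with a ℕP.≤? b
... | yes p = p
... | no n = ⊥-elim (<-irrefl refl (<-≤-trans (positive⁻¹ 1ℚ) (subst₂ _≤_ eq (+-inverseʳ (natℚ b))
      (+-monoˡ-≤ (- natℚ b) (≤-trans (natℚ-mono (ℕP.≰⇒> n)) l)))))
  where
  eq : natℚ (suc b) - natℚ b ≡ 1ℚ
  eq = solve 1 (λ b → (con 1ℚ :+ b) :- b := con 1ℚ) refl (natℚ b)

pow2-natℚ : ∀ N z → pow2 N (natℚ z) ≡ natℚ (z ℕ.^ (2 ℕ.^ N))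
pow2-natℚ zero z = cong natℚ (sym (ℕP.*-identityʳ z))
pow2-natℚ (suc N) z = trans (cong (pow2 N) (sym (natℚ-* z z))) (trans (pow2-natℚ N (z ℕ.* z))
  (cong natℚ (trans (cong (λ x → (z ℕ.* x) ℕ.^ (2 ℕ.^ N)) (sym (ℕP.*-identityʳ z))) (ℕP.^-*-assoc z 2 (2 ℕ.^ N)))))

-- Squaring removes the case distinction in the absolute value; the estimates bound only even
-- powers.
natℚ-dist² : ∀ a b → natℚ ℤ.∣ ℤ.+ a ℤ.- ℤ.+ b ∣ * natℚ ℤ.∣ ℤ.+ a ℤ.- ℤ.+ b ∣ ≡ (natℚ a - natℚ b) * (natℚ a - natℚ b)
natℚ-dist² a b = subst (λ z → natℚ ℤ.∣ z ∣ * natℚ ℤ.∣ z ∣ ≡ (natℚ a - natℚ b) * (natℚ a - natℚ b)) (sym (ℤP.m-n≡m⊖n a b)) (go (ℕP.≤-total b a))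
  where
  truncated : ∀ {x y} → y ℕ.≤ x → natℚ (x ℕ.∸ y) ≡ natℚ x - natℚ y
  truncated {x} {y} l = trans (solve 2 (λ d y → d := (d :+ y) :- y) refl (natℚ (x ℕ.∸ y)) (natℚ y))
    (cong (_- natℚ y) (trans (sym (natℚ-+ (x ℕ.∸ y) y)) (cong natℚ (ℕP.m∸n+n≡m l))))
  go : b ℕ.≤ a ⊎ a ℕ.≤ b → natℚ ℤ.∣ a ℤ.⊖ b ∣ * natℚ ℤ.∣ a ℤ.⊖ b ∣ ≡ (natℚ a - natℚ b) * (natℚ a - natℚ b)
  go (inj₁ l) = trans (cong (λ z → natℚ ℤ.∣ z ∣ * natℚ ℤ.∣ z ∣) (ℤP.⊖-≥ l)) (cong₂ _*_ (truncated l) (truncated l))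
  go (inj₂ l) = trans (cong (λ z → natℚ z * natℚ z) (trans (ℤP.∣m⊖n∣≡∣n⊖m∣ a b) (cong ℤ.∣_∣ (ℤP.⊖-≥ l))))
    (trans (cong₂ _*_ (truncated l) (truncated l)) (solve 2 (λ a b → (b :- a) :* (b :- a) := (a :- b) :* (a :- b)) refl (natℚ a) (natℚ b)))

listsum-natℚ : ∀ {n k} (e : Fin n → Fin k) (g : Fin k → ℕ) → natℚ (ℕL.sum (map g (Data.List.tabulate e))) ≡ sum (λ i → natℚ (g (e i)))
listsum-natℚ {zero} e g = refl
listsum-natℚ {suc n} e g = trans (natℚ-+ (g (e zero)) _) (cong (natℚ (g (e zero)) +_) (listsum-natℚ (e ∘ suc) g))

all-tabulate : ∀ {n k} (e : Fin n → Fin k) (p : Fin k → Bool) (χ : Bool → ℚ) → χ true ≡ 1ℚ → (∀ a b → χ (a ∧ b) ≡ χ a * χ b) →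
  χ (BL.all p (Data.List.tabulate e)) ≡ prodF (λ i → χ (p (e i)))
all-tabulate {zero} e p χ t h = t
all-tabulate {suc n} e p χ t h = trans (h (p (e zero)) _) (cong (χ (p (e zero)) *_) (all-tabulate (e ∘ suc) p χ t h))

χ : Bool → ℚ
χ true = 1ℚ
χ false = 0ℚ

χ-∧ : ∀ a b → χ (a ∧ b) ≡ χ a * χ b
χ-∧ true b = sym (*-identityˡ (χ b))
χ-∧ false b = sym (*-zeroˡ (χ b))

χ-natℚ : ∀ b → natℚ (if b then 1 else 0) ≡ χ b
χ-natℚ true = +-identityʳ 1ℚ
χ-natℚ false = refl

χ-Bd : ∀ b → Bd (χ b)
χ-Bd true = Bd-1
χ-Bd false = ≤-trans (≤-reflexive (*-zeroˡ 0ℚ)) 0≤1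

χ≥0 : ∀ b → 0ℚ ≤ χ b
χ≥0 true = 0≤1
χ≥0 false = ≤-refl

powℚ : ℚ → ℕ → ℚ
powℚ x zero = 1ℚ
powℚ x (suc n) = x * powℚ x n

powℚ-* : ∀ x y n → powℚ (x * y) n ≡ powℚ x n * powℚ y n
powℚ-* x y zero = sym (*-identityʳ 1ℚ)
powℚ-* x y (suc n) = trans (cong (x * y *_) (powℚ-* x y n)) (solve 4 (λ a b c d → (a :* b) :* (c :* d) := (a :* c) :* (b :* d)) refl x y (powℚ x n) (powℚ y n))

natℚ-^ : ∀ a n → natℚ (a ℕ.^ n) ≡ powℚ (natℚ a) n
natℚ-^ a zero = +-identityʳ 1ℚ
natℚ-^ a (suc n) = trans (natℚ-* a (a ℕ.^ n)) (cong (natℚ a *_) (natℚ-^ a n))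

prodF-const : ∀ n a → prodF {n} (λ _ → a) ≡ powℚ a n
prodF-const zero a = refl
prodF-const (suc n) a = cong (a *_) (prodF-const n a)

-- The numerator serves, as the denominator is at least 1.
natural-bound : ∀ C → 0ℚ ≤ C → Σ ℕ λ n → C ≤ natℚ n
natural-bound C@(mkℚ n d _) 0≤C = ℤ.∣ n ∣ , subst (C ≤_) (fromℤ-nat ℤ.∣ n ∣) (≤-trans bound (≤-reflexive (cong fromℤ (sym (ℤP.0≤i⇒+∣i∣≡i (num≥0 0≤C))))))
  where
  fromℤ-nat : ∀ k → fromℤ (ℤ.+ k) ≡ natℚ k
  fromℤ-nat zero = refl
  fromℤ-nat (suc k) = trans (sym (fromℤ-+ (ℤ.+ 1) (ℤ.+ k))) (cong (1ℚ +_) (fromℤ-nat k))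
  num≥0 : 0ℚ ≤ C → ℤ.+ 0 ℤ.≤ n
  num≥0 (*≤* l) = subst₂ ℤ._≤_ (ℤP.*-zeroˡ (ℤ.+ suc d)) (ℤP.*-identityʳ n) l
  bound : C ≤ fromℤ n
  bound = toℚᵘ-cancel-≤ (ℚᵘP.≤-trans (ℚᵘ.*≤*
      (ℤP.*-monoˡ-≤-nonNeg n {{ℤ.nonNegative (num≥0 0≤C)}} (ℤ.+≤+ (s≤s z≤n)))) (ℚᵘP.≤-reflexive (ℚᵘP.≃-sym (toℚᵘ-fromℤ n))))

total-length : ∀ {m} → (Fin m → List ℤ) → ℕ
total-length {zero} P = 0
total-length {suc m} P = length (P zero) ℕ.+ total-length (P ∘ suc)

length≤total : ∀ {m} (P : Fin m → List ℤ) i → length (P i) ℕ.≤ total-length P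
length≤total P zero = ℕP.m≤m+n _ _
length≤total P (suc i) = ℕP.≤-trans (length≤total (P ∘ suc) i) (ℕP.m≤n+m _ (length (P zero)))

module Counting (F : FiniteField) {m : ℕ} (P : Fin m → List ℤ) (T : ℕ) (short : ∀ i → length (P i) ℕ.≤ suc T) (zc : ∀ i → ZeroConstTerm (P i))
                (A : Field.Carrier F → Bool) where
  open Field F
  open Norms F
  open Equidistribution F
  open Base F
  open Encoding F

  χA : Fun
  χA x = χ (A x)

  indicators : Fin (suc m) → Fun
  indicators _ = χA

  progression : ∀ x y → prodF {suc m} (λ i → χA (x ⊕ evalD T (slots P) y i)) ≡ χ (ProgIn F P A x y)
  progression x y = sym (trans (χ-∧ (A x) _) (cong₂ _*_
    (cong χA (sym (trans (cong (x ⊕_) (evalD-zero P T (slots P) y zero (λ _ → refl))) (⊕-identityʳ x))))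
    (trans (all-tabulate (λ i → i) (λ i → A (FiniteField._+_ F x (evalF F (P i) y))) χ refl χ-∧)
      (prodF-cong (λ i → cong (λ z → χA (x ⊕ z)) (evalF-slots P T i y (zc i) (short i)))))))

  avg-count : (p : Carrier → Bool) → avg (λ x → χ (p x)) ≡ ε * natℚ (card F p)
  avg-count p = trans (avg-def _) (cong (ε *_) (sym (trans (listsum-natℚ (λ i → i) (λ i → if p (element i) then 1 else 0))
    (sum-cong-≗ (λ i → χ-natℚ (p (element i)))))))

  Lam-count : Lam T (slots P) indicators ≡ ε * (ε * natℚ (countProg F P A))
  Lam-count = trans (avg-cong (λ x → trans (avg-cong (λ y → progression x y)) (avg-count (ProgIn F P A x))))
    (trans (avg-* ε _) (cong (ε *_) (trans (avg-def _) (cong (ε *_) (sym (listsum-natℚ (λ i → i)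
      (λ i → ℕL.sum (map (λ j → if ProgIn F P A (element i) (element j) then 1 else 0) (Data.List.allFin size)))))))))

  α : ℚ
  α = ε * natℚ (card F A)

  means : prodF {suc m} (λ i → avg (indicators i)) ≡ powℚ α (suc m)
  means = trans (prodF-const (suc m) (avg χA)) (cong (λ z → powℚ z (suc m)) (avg-count A))

  Qᴹ : ℚ
  Qᴹ = natℚ (size ℕ.^ suc m)

  unscale : ∀ n x → natℚ (size ℕ.^ n) * powℚ (ε * natℚ x) n ≡ natℚ (x ℕ.^ n)
  unscale n x = trans (cong (_* powℚ (ε * natℚ x) n) (natℚ-^ size n)) (trans (sym (powℚ-* qℚ (ε * natℚ x) n))
    (trans (cong (λ z → powℚ z n) (trans (solve 3 (λ q e x → q :* (e :* x) := (e :* q) :* x) refl qℚ ε (natℚ x)) (trans (cong (_* natℚ x) ε*q) (*-identityˡ _))))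
      (sym (natℚ-^ x n))))

  card-scaled : natℚ (card F A ℕ.^ suc m) ≡ Qᴹ * powℚ α (suc m)
  card-scaled = sym (unscale (suc m) (card F A))

  deviation-scaled : 1 ℕ.≤ m → natℚ (countProg F P A ℕ.* size ℕ.^ (m ℕ.∸ 1)) - natℚ (card F A ℕ.^ suc m) ≡ Qᴹ * deviation T (slots P) indicators
  deviation-scaled 1≤m = trans (cong₂ _-_ (lemma m 1≤m) card-scaled)
    (trans (solve 3 (λ q a b → q :* a :- q :* b := q :* (a :- b)) refl Qᴹ (ε * (ε * natℚ cnt)) (powℚ α (suc m)))
      (cong (Qᴹ *_) (cong₂ _-_ (sym Lam-count) (sym means))))
    where
    cnt = countProg F P A
    lemma : ∀ n → 1 ℕ.≤ n → natℚ (cnt ℕ.* size ℕ.^ (n ℕ.∸ 1)) ≡ natℚ (size ℕ.^ suc n) * (ε * (ε * natℚ cnt))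
    lemma (suc n) _ = trans (natℚ-* cnt (size ℕ.^ n)) (sym (trans
      (cong (_* (ε * (ε * natℚ cnt))) (trans (natℚ-* size (size ℕ.* size ℕ.^ n)) (cong (qℚ *_) (natℚ-* size (size ℕ.^ n)))))
      (trans (solve 4 (λ q e r c → (q :* (q :* r)) :* (e :* (e :* c)) := ((e :* q) :* (e :* q)) :* (c :* r)) refl qℚ ε (natℚ (size ℕ.^ n)) (natℚ cnt))
        (trans (cong (λ z → (z * z) * (natℚ cnt * natℚ (size ℕ.^ n))) ε*q) (trans (cong (_* (natℚ cnt * natℚ (size ℕ.^ n))) (*-identityˡ 1ℚ)) (*-identityˡ _))))))

  -- only y = 0 contributes
  Lam≤ε : ProgFree F P A → Lam T (slots P) indicators ≤ ε
  Lam≤ε free = ≤-trans (≤-reflexive (trans (avg-cong (λ x → avg-cong (λ y → progression x y))) (avg-fubini meanF _)))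
    (≤-trans (avg-except (0F ∷ []) {f = λ y → avg (λ x → χ (ProgIn F P A x y))} {g = λ _ → 0ℚ}
        (λ y → M.E-≤const (λ x → ≤-trans (Bd⇒≤1 (χ-Bd (ProgIn F P A x y))) (≤-reflexive (sym (+-identityˡ 1ℚ)))))
        (λ y y∉ → ≤-reflexive (trans (avg-cong (λ x → cong χ (free x y (λ e → y∉ (here e))))) (avg-const 0ℚ))))
      (≤-reflexive (trans (cong (_+ (1ℚ + 0ℚ) * ε) (avg-const 0ℚ)) (solve 1 (λ e → con 0ℚ :+ (con 1ℚ :+ con 0ℚ) :* e := e) refl ε))))

  0≤Lam : 0ℚ ≤ Lam T (slots P) indicators
  0≤Lam = ≤-trans (M.E-nn (λ x → M.E-nn (λ y → χ≥0 (ProgIn F P A x y))))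
    (≤-reflexive (avg-cong (λ x → avg-cong (λ y → sym (progression x y)))))

  -- The factor q^(m+1) clears the denominators of the averages, and one more q that of ε. The link
  -- between z and w is stated for squares because z may be an absolute value.
  to-ℕ : ∀ N z w c Cₙ → natℚ z * natℚ z ≡ (Qᴹ * w) * (Qᴹ * w) → pow2 N (w * w) ≤ c * ε → c ≤ natℚ Cₙ →
    z ℕ.^ (2 ℕ.^ suc N) ℕ.* size ℕ.≤ Cₙ ℕ.* (size ℕ.^ suc m) ℕ.^ (2 ℕ.^ suc N)
  to-ℕ N z w c Cₙ sq small c≤ = natℚ-reflects (begin
    natℚ (z ℕ.^ (2 ℕ.^ suc N) ℕ.* size)           ≡⟨ natℚ-* (z ℕ.^ (2 ℕ.^ suc N)) size ⟩
    natℚ (z ℕ.^ (2 ℕ.^ suc N)) * qℚ               ≡⟨ cong (_* qℚ) (sym (pow2-natℚ (suc N) z)) ⟩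
    pow2 N (natℚ z * natℚ z) * qℚ                 ≡⟨ cong (λ x → pow2 N x * qℚ) sq ⟩
    pow2 (suc N) (Qᴹ * w) * qℚ                    ≡⟨ cong (_* qℚ) (pow2-* (suc N) Qᴹ w) ⟩
    (pow2 (suc N) Qᴹ * pow2 N (w * w)) * qℚ       ≤⟨ *-monoR (natℚ≥0 size) (*-monoL Q≥0 small) ⟩
    (pow2 (suc N) Qᴹ * (c * ε)) * qℚ              ≡⟨ solve 4 (λ p c e q → (p :* (c :* e)) :* q := (c :* p) :* (e :* q)) refl (pow2 (suc N) Qᴹ) c ε qℚ ⟩
    (c * pow2 (suc N) Qᴹ) * (ε * qℚ)              ≡⟨ trans (cong ((c * pow2 (suc N) Qᴹ) *_) ε*q) (*-identityʳ _) ⟩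
    c * pow2 (suc N) Qᴹ                           ≤⟨ *-monoR Q≥0 c≤ ⟩
    natℚ Cₙ * pow2 (suc N) Qᴹ                     ≡⟨ cong (natℚ Cₙ *_) (pow2-natℚ (suc N) (size ℕ.^ suc m)) ⟩
    natℚ Cₙ * natℚ ((size ℕ.^ suc m) ℕ.^ (2 ℕ.^ suc N)) ≡⟨ sym (natℚ-* Cₙ _) ⟩
    natℚ (Cₙ ℕ.* (size ℕ.^ suc m) ℕ.^ (2 ℕ.^ suc N)) ∎)
    where
    open ≤-Reasoning
    Q≥0 : 0ℚ ≤ pow2 (suc N) Qᴹ
    Q≥0 = pow2-nn (suc N) (natℚ≥0 (size ℕ.^ suc m))

-- Matching exponents, and the final constants

^-distrib-* : ∀ n a b → (a ℕ.* b) ℕ.^ n ≡ a ℕ.^ n ℕ.* b ℕ.^ n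
^-distrib-* zero a b = refl
^-distrib-* (suc n) a b = trans (cong (a ℕ.* b ℕ.*_) (^-distrib-* n a b)) (ℕP.[m*n]*[o*p]≡[m*o]*[n*p] a b (a ℕ.^ n) (b ℕ.^ n))

-- With M = m + 1, taking M-th powers turns the saved factor q into q^M, which is the required
-- q^((m+1)a) for a = 1.
raise : ∀ k M z q C₁ C → 1 ℕ.≤ C → C₁ ℕ.≤ C → 1 ℕ.≤ k → z ℕ.^ k ℕ.* q ℕ.≤ C₁ ℕ.* (q ℕ.^ M) ℕ.^ k →
  z ℕ.^ (k ℕ.* M) ℕ.* q ℕ.^ M ℕ.≤ C ℕ.^ (k ℕ.* M) ℕ.* q ℕ.^ (M ℕ.* (k ℕ.* M))
raise k M z q C₁ C 1≤C C₁≤C 1≤k l = begin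
  z ℕ.^ (k ℕ.* M) ℕ.* q ℕ.^ M                       ≡⟨ cong (ℕ._* q ℕ.^ M) (sym (ℕP.^-*-assoc z k M)) ⟩
  (z ℕ.^ k) ℕ.^ M ℕ.* q ℕ.^ M                       ≡⟨ sym (^-distrib-* M (z ℕ.^ k) q) ⟩
  (z ℕ.^ k ℕ.* q) ℕ.^ M                             ≤⟨ ℕP.^-monoˡ-≤ M l ⟩
  (C₁ ℕ.* (q ℕ.^ M) ℕ.^ k) ℕ.^ M                    ≡⟨ ^-distrib-* M C₁ _ ⟩
  C₁ ℕ.^ M ℕ.* ((q ℕ.^ M) ℕ.^ k) ℕ.^ M              ≤⟨ ℕP.*-mono-≤ (ℕP.≤-trans (ℕP.^-monoˡ-≤ M C₁≤C) (ℕP.^-monoʳ-≤ C {{ℕ.>-nonZero 1≤C}} (ℕP.m≤n*m M k {{ℕ.>-nonZero 1≤k}})))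
                                                         (ℕP.≤-reflexive (trans (ℕP.^-*-assoc (q ℕ.^ M) k M) (ℕP.^-*-assoc q M (k ℕ.* M)))) ⟩
  C ℕ.^ (k ℕ.* M) ℕ.* q ℕ.^ (M ℕ.* (k ℕ.* M)) ∎
  where open ℕP.≤-Reasoning

theorem1 : (m : ℕ) → 1 ℕ.≤ m → (P : Fin m → List ℤ) →
    (∀ i → ZeroConstTerm (P i)) → LinIndepℚ P →
    Σ ℕ λ c → Σ ℕ λ a → Σ ℕ λ b → Σ ℕ λ C →
    0 ℕ.< a × 0 ℕ.< b ×
    ((F : FiniteField) → CharAtLeast F c →
    ((A : FiniteField.Carrier F → _) → ProgFree F P A →
    card F A ℕ.^ b ℕ.* FiniteField.size F ℕ.^ a ℕ.≤ C ℕ.^ b ℕ.* FiniteField.size F ℕ.^ b)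
    ×
    ((A : FiniteField.Carrier F → _) →
    ℤ.∣ (ℤ.+ (countProg F P A ℕ.* FiniteField.size F ℕ.^ (m ℕ.∸ 1))) ℤ.- (ℤ.+ (card F A ℕ.^ (m ℕ.+ 1))) ∣ ℕ.^ b
    ℕ.* FiniteField.size F ℕ.^ ((m ℕ.+ 1) ℕ.* a)
    ℕ.≤ C ℕ.^ b ℕ.* FiniteField.size F ℕ.^ ((m ℕ.+ 1) ℕ.* b)))
theorem1 m 1≤m P zc ind = c₀ , 1 , b₀ , C₀ , s≤s z≤n , 0<b ,
    λ F char → (λ A free → let open Bounds F char A in progression-free free) , (λ A → let open Bounds F char A in count)
  where
  -- The sum of the lengths is a convenient common bound for all degrees.
  T = total-length P
  short : ∀ i → length (P i) ℕ.≤ suc T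
  short i = ℕP.m≤n⇒m≤1+n (length≤total P i)
  dual : Integers.Dual T (shifted-coeffs P)
  dual = independent⇒dual T P short zc ind
  D = Integers.Dual.N dual
  -- T + 2 for the differencing, |D| + 1 to keep the denominator of the dual family invertible.
  c₀ = suc (suc T) ℕ.+ suc ℤ.∣ D ∣
  -- Every slot is free here, the base point included.
  open FreeSlots (free-slots T (suc m) m (Data.List.allFin (suc m)) (ListP.length-tabulate (λ i → i)))
  freeC = sumC 0 N 2ℚ (pow2 N 2ℚ * C)
  0≤freeC : 0ℚ ≤ freeC
  0≤freeC = sumC≥0 0 N 0≤2 (*-nn (pow2-nn N 0≤2) 0≤C)
  C₁ = natural-bound C 0≤C
  C₂ = natural-bound freeC 0≤freeC
  C₀ = suc (proj₁ C₁ ℕ.+ proj₁ C₂)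
  k = 2 ℕ.^ suc N
  -- γ is 1/b₀: the factor `k` accounts for the squarings, the factor m + 1 for the power |A|^(m+1).
  b₀ = k ℕ.* suc m
  1≤k : 1 ℕ.≤ k
  1≤k = ℕP.m^n>0 2 (suc N)
  0<b : 0 ℕ.< b₀
  0<b = ℕP.*-mono-≤ 1≤k (s≤s (z≤n {m}))
  module Bounds (F : FiniteField) (char : CharAtLeast F c₀) (A : Field.Carrier F → Bool) where
    open Field F
    open Base F
    open Encoding F
    open Counting F P T short zc A
    dev = deviation T (slots P) indicators
    dev-small : pow2 N (dev * dev) ≤ C * ε
    dev-small = small F (λ n l u → char n l (ℕP.<-≤-trans u (ℕP.m≤m+n _ _))) (slots P)
      (spans P T dual (intF≢0 D (suc ℤ.∣ D ∣) (Integers.Dual.N≢0 dual) ℕP.≤-refl (λ n l u → char n l (ℕP.<-≤-trans u (ℕP.m≤n+m _ (suc (suc T)))))))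
      indicators (λ _ x → χ-Bd (A x)) (λ i i∉ → ⊥-elim (i∉ (∈-allFin i)))
    -- α^(m+1) is `Lam` minus the deviation. Without nontrivial progressions `Lam` is at most ε, so
    -- its square needs no further power: exponent 0 in the sum.
    power-small : ProgFree F P A → pow2 N (powℚ α (suc m) * powℚ α (suc m)) ≤ freeC * ε
    power-small free = ≤-trans (pow2-mono N (sq≥0 (powℚ α (suc m))) (≤-trans (≤-reflexive (cong₂ _*_ eq eq)) (sq-+ (Lam T (slots P) indicators) (- dev))))
      (small-+ 0≤ε ε≤1 0 N 0≤2 (*-nn (pow2-nn N 0≤2) 0≤C) (*-nn 0≤2 (sq≥0 (Lam T (slots P) indicators))) (*-nn 0≤2 (sq≥0 (- dev)))
        (*-monoL 0≤2 (≤-trans (*-mono 0≤Lam 0≤1 (Lam≤ε free) (≤-trans (Lam≤ε free) ε≤1)) (≤-reflexive (*-identityʳ ε))))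
        (small-scale N 2ℚ 0≤2 (subst (λ x → pow2 N x ≤ C * ε) (solve 1 (λ d → d :* d := (:- d) :* (:- d)) refl dev) dev-small)))
      where
      eq : powℚ α (suc m) ≡ Lam T (slots P) indicators - dev
      eq = trans (sym means) (solve 2 (λ l p → p := l :- (l :- p)) refl (Lam T (slots P) indicators) (prodF {suc m} (λ i → avg (indicators i))))
    count : _
    count = subst (λ M → ℤ.∣ (ℤ.+ (countProg F P A ℕ.* size ℕ.^ (m ℕ.∸ 1))) ℤ.- (ℤ.+ (card F A ℕ.^ M)) ∣ ℕ.^ b₀ ℕ.* size ℕ.^ (M ℕ.* 1)
          ℕ.≤ C₀ ℕ.^ b₀ ℕ.* size ℕ.^ (M ℕ.* b₀)) (ℕP.+-comm 1 m)
        (subst (λ e → z ℕ.^ b₀ ℕ.* size ℕ.^ e ℕ.≤ C₀ ℕ.^ b₀ ℕ.* size ℕ.^ (suc m ℕ.* b₀)) (sym (ℕP.*-identityʳ (suc m)))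
          (raise k (suc m) z size (proj₁ C₁) C₀ (s≤s z≤n) (ℕP.m≤n⇒m≤1+n (ℕP.m≤m+n _ _)) 1≤k
            (to-ℕ N z dev C (proj₁ C₁) (trans (natℚ-dist² X Y) (cong (λ x → x * x) (deviation-scaled 1≤m))) dev-small (proj₂ C₁))))
      where
      X = countProg F P A ℕ.* size ℕ.^ (m ℕ.∸ 1)
      Y = card F A ℕ.^ suc m
      z = ℤ.∣ ℤ.+ X ℤ.- ℤ.+ Y ∣
    progression-free : ProgFree F P A → card F A ℕ.^ b₀ ℕ.* size ℕ.^ 1 ℕ.≤ C₀ ℕ.^ b₀ ℕ.* size ℕ.^ b₀
    progression-free free = begin
      card F A ℕ.^ b₀ ℕ.* size ℕ.^ 1                ≡⟨ cong₂ ℕ._*_ (trans (cong (card F A ℕ.^_) (ℕP.*-comm k (suc m))) (sym (ℕP.^-*-assoc (card F A) (suc m) k))) (ℕP.*-identityʳ size) ⟩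
      (card F A ℕ.^ suc m) ℕ.^ k ℕ.* size
        ≤⟨ to-ℕ N (card F A ℕ.^ suc m) (powℚ α (suc m)) freeC (proj₁ C₂) (cong₂ _*_ card-scaled card-scaled) (power-small free) (proj₂ C₂) ⟩
      proj₁ C₂ ℕ.* (size ℕ.^ suc m) ℕ.^ k
        ≤⟨ ℕP.*-mono-≤ (ℕP.≤-trans (ℕP.m≤n⇒m≤1+n (ℕP.m≤n+m (proj₁ C₂) (proj₁ C₁)))
             (ℕP.≤-trans (ℕP.≤-reflexive (sym (ℕP.^-identityʳ C₀))) (ℕP.^-monoʳ-≤ C₀ 0<b)))
             (ℕP.≤-reflexive (trans (ℕP.^-*-assoc size (suc m) k) (cong (size ℕ.^_) (ℕP.*-comm (suc m) k)))) ⟩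
      C₀ ℕ.^ b₀ ℕ.* size ℕ.^ b₀ ∎
      where open ℕP.≤-Reasoning
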